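{- Let $q$ be a prime power, let $n$ be a positive integer, and let $\Delta$ be an $n\times n$ diagonal matrix over $\mathbb{F}_q$ with $n$ distinct diagonal entries, viewed as a linear operator on $\mathbb{F}_q^n$. For every integer partition $\mu=(\mu_1,\dots,\mu_k)$ (with positive parts), the number $\sigma_n(\mu)$ of subspaces of $\mathbb{F}_q^n$ with $\Delta$-profile $\mu$ is $$\sigma_n(\mu)=\binom{n}{|\mu|}(q-1)^{\sum_{j\ge 2}\mu_j}\,q^{\sum_{j\ge 2}\binom{\mu_j}{2}}\,b_{\mu'}(q),$$ where $|\mu|=\mu_1+\dots+\mu_k$ and $\mu'$ is the conjugate partition of $\mu$.
   Context: A subspace $W\subseteq\mathbb{F}_q^n$ has partial $\Delta$-profile $\mu=(\mu_1,\dots,\mu_k)$ if $\dim(W+\Delta W+\dots+\Delta^{j-1}W)=\mu_1+\dots+\mu_j$ for $1\le j\le k$; it has $\Delta$-profile $\mu$ if in addition $\dim(W+\Delta W+\dots+\Delta^{k-1}W)=\dim(W+\Delta W+\dots+\Delta^{k}W)$. A standard tableau of shape $\lambda=(\lambda_1,\dots,\lambda_m)$ with $N=|\lambda|$ cells is a filling $T=(T_{ij})_{1\le i\le m,\,1\le j\le\lambda_i}$ of the Young diagram of $\lambda$ by $1,\dots,N$, each used once, with rows increasing left to right and columns increasing top to bottom. For such $T$, $1\le i\le m$ and $2\le j\le\lambda_i$, let $c_{ij}(T)=\#\{i'\ge i : \text{the cell }(i',j-1)\text{ exists and } T_{i',j-1}<T_{ij}\}$, and define $c_q(T)=\prod_{i=1}^m\prod_{j=2}^{\lambda_i}[c_{ij}(T)]_q$,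 where $[a]_q=1+q+\dots+q^{a-1}$. Finally $b_\lambda(q)=\sum_T c_q(T)$, the sum over all standard tableaux $T$ of shape $\lambda$. -}

module Defs where

open import Level using (0ℓ)
open import Data.Nat using (ℕ; zero; suc; _+_; _*_; _∸_; _^_; _≤_; _≥_; _<ᵇ_)
open import Data.Nat.Combinatorics using (_C_)
open import Data.Bool using (Bool; true; false; _∧_; if_then_else_)
open import Data.Maybe using (Maybe; just; nothing)
open import Data.Fin using (Fin; toℕ)
open import Data.Nat.ListAction using (sum)
open import Data.List using (List; []; _∷_; map; length; take; drop; concatMap; upTo; filterᵇ)
open import Data.List.Relation.Unary.All using (All)
open import Data.List.Relation.Unary.Any using (Any)
open import Data.List.Relation.Unary.AllPairs using (AllPairs)
open import Data.List.Relation.Unary.Linked using (Linked)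
open import Data.Product using (Σ; ∃; _×_; _,_)
open import Function.Bundles using (_↔_; _⇔_)
open import Relation.Binary.PropositionalEquality using (_≡_)
open import Relation.Nullary using (¬_)
open import Algebra.Structures using (IsCommutativeRing)

-- Finite fields: a field with exactly q elements (q is then necessarily
-- a prime power, and every prime power arises; F_q is unique up to iso).

record FiniteField (q : ℕ) : Set₁ where
  field
    F        : Set
    _⊕_      : F → F → F
    _⊗_      : F → F → F
    ⊖_       : F → F
    𝟘        : F
    𝟙        : F
    isCommutativeRing : IsCommutativeRing _≡_ _⊕_ _⊗_ ⊖_ 𝟘 𝟙
    𝟘≢𝟙      : ¬ (𝟘 ≡ 𝟙)
    inverse  : ∀ x → ¬ (x ≡ 𝟘) → ∃ λ y → x ⊗ y ≡ 𝟙
    enum     : Fin q ↔ F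

module LinAlg {q : ℕ} (𝔽 : FiniteField q) (n : ℕ) (δ : Fin n → FiniteField.F 𝔽) where
  open FiniteField 𝔽

  V : Set
  V = Fin n → F

  _≈ᵥ_ : V → V → Set
  u ≈ᵥ v = ∀ k → u k ≡ v k

  0ᵥ : V
  0ᵥ _ = 𝟘

  _+ᵥ_ : V → V → V
  (u +ᵥ v) k = u k ⊕ v k

  _·ᵥ_ : F → V → V
  (c ·ᵥ v) k = c ⊗ v k

  Σᵥ : {d : ℕ} → (Fin d → V) → V
  Σᵥ {zero}  f = 0ᵥ
  Σᵥ {suc d} f = f Fin.zero +ᵥ Σᵥ (λ i → f (Fin.suc i))

  linComb : {d : ℕ} → (Fin d → F) → (Fin d → V) → V
  linComb c b = Σᵥ (λ i → c i ·ᵥ b i)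

  Δ : V → V
  Δ v k = δ k ⊗ v k

  Δ^ : ℕ → V → V
  Δ^ zero    v = v
  Δ^ (suc i) v = Δ (Δ^ i v)

  LinIndep : {d : ℕ} → (Fin d → V) → Set
  LinIndep b = ∀ c → linComb c b ≈ᵥ 0ᵥ → ∀ i → c i ≡ 𝟘

  HasDim : (V → Set) → ℕ → Set
  HasDim U d = ∃ λ (b : Fin d → V) →
    (∀ i → U (b i)) × LinIndep b × (∀ v → U v → ∃ λ c → v ≈ᵥ linComb c b)

  Subset : Set
  Subset = V → Bool

  _∈ₛ_ : V → Subset → Set
  v ∈ₛ W = W v ≡ true

  _≗ₛ_ : Subset → Subset → Set
  W ≗ₛ W' = ∀ v → W v ≡ W' v

  IsSubspace : Subset → Set
  IsSubspace W =
    (∀ u v → u ≈ᵥ v → u ∈ₛ W → v ∈ₛ W) ×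
    (0ᵥ ∈ₛ W) ×
    (∀ u v → u ∈ₛ W → v ∈ₛ W → (u +ᵥ v) ∈ₛ W) ×
    (∀ c v → v ∈ₛ W → (c ·ᵥ v) ∈ₛ W)

  SumSpace : Subset → ℕ → V → Set
  SumSpace W j v = ∃ λ (ws : Fin j → V) →
    (∀ i → ws i ∈ₛ W) × (v ≈ᵥ Σᵥ (λ i → Δ^ (toℕ i) (ws i)))

  HasPartialProfile : Subset → List ℕ → Set
  HasPartialProfile W μ =
    ∀ j → 1 ≤ j → j ≤ length μ → HasDim (SumSpace W j) (sum (take j μ))

  HasProfile : Subset → List ℕ → Set
  HasProfile W μ = HasPartialProfile W μ ×
    (∃ λ e → HasDim (SumSpace W (length μ)) e × HasDim (SumSpace W (suc (length μ))) e)

  Counts : (Subset → Set) → ℕ → Set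
  Counts P s = ∃ λ (L : List Subset) →
    length L ≡ s ×
    AllPairs (λ A B → ¬ (A ≗ₛ B)) L ×
    (∀ W → P W ⇔ Any (λ A → W ≗ₛ A) L)

IsPartition : List ℕ → Set
IsPartition μ = All (λ x → 1 ≤ x) μ × Linked _≥_ μ

head0 : List ℕ → ℕ
head0 []      = 0
head0 (x ∷ _) = x

countGe : ℕ → List ℕ → ℕ
countGe i []       = 0
countGe i (x ∷ xs) = (if x <ᵇ i then 0 else 1) + countGe i xs

conj : List ℕ → List ℕ
conj μ = map (λ i → countGe (suc i) μ) (upTo (head0 μ))

qint : ℕ → ℕ → ℕ
qint q a = sum (map (q ^_) (upTo a))

insertAll : ℕ → List ℕ → List (List ℕ)
insertAll x []       = (x ∷ []) ∷ []
insertAll x (y ∷ ys) = (x ∷ y ∷ ys) ∷ map (y ∷_) (insertAll x ys)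

perms : List ℕ → List (List ℕ)
perms []       = [] ∷ []
perms (x ∷ xs) = concatMap (insertAll x) (perms xs)

-- lay out a sequence of entries row by row into shape λ
-- (a filling of the Young diagram, rows listed top to bottom)
layout : List ℕ → List ℕ → List (List ℕ)
layout []      xs = []
layout (l ∷ ls) xs = take l xs ∷ layout ls (drop l xs)

strictIncr : List ℕ → Bool
strictIncr []           = true
strictIncr (x ∷ [])     = true
strictIncr (x ∷ y ∷ ys) = (x <ᵇ y) ∧ strictIncr (y ∷ ys)

colIncr : List ℕ → List ℕ → Bool
colIncr xs       []       = true
colIncr []       (y ∷ ys) = false
colIncr (x ∷ xs) (y ∷ ys) = (x <ᵇ y) ∧ colIncr xs ys

isStandard : List (List ℕ) → Bool
isStandard []           = true
isStandard (r ∷ [])     = strictIncr r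
isStandard (r ∷ s ∷ rs) = strictIncr r ∧ colIncr r s ∧ isStandard (s ∷ rs)

at : List ℕ → ℕ → Maybe ℕ
at []       _       = nothing
at (x ∷ xs) zero    = just x
at (x ∷ xs) (suc k) = at xs k

countBelow : List (List ℕ) → ℕ → ℕ → ℕ
countBelow []       col v = 0
countBelow (r ∷ rs) col v with at r col
... | just x  = (if x <ᵇ v then 1 else 0) + countBelow rs col v
... | nothing = countBelow rs col v

-- product over cells (i,j), j ≥ 2, of row i of [c_ij(T)]_q;
-- suf = rows i, i+1, …; the list holds T_{i,col+1}, T_{i,col+2}, …
rowFactor : ℕ → List (List ℕ) → ℕ → List ℕ → ℕ
rowFactor q suf col []       = 1
rowFactor q suf col (v ∷ vs) = qint q (countBelow suf col v) * rowFactor q suf (suc col) vs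

cq : ℕ → List (List ℕ) → ℕ
cq q []       = 1
cq q (r ∷ rs) = rowFactor q (r ∷ rs) 0 (drop 1 r) * cq q rs

standardTableaux : List ℕ → List (List (List ℕ))
standardTableaux sh = filterᵇ isStandard (map (layout sh) (perms (map suc (upTo (sum sh)))))

b : List ℕ → ℕ → ℕ
b sh q = sum (map (cq q) (standardTableaux sh))

sigmaFormula : ℕ → ℕ → List ℕ → ℕ
sigmaFormula q n μ =
  (n C sum μ) * ((q ∸ 1) ^ sum (drop 1 μ)) * (q ^ sum (map (_C 2) (drop 1 μ))) * b (conj μ) q

-- Translating Δ by a scalar does not change the Krylov spaces
-- W + ΔW + … + Δ^(j-1)W, so its first diagonal entry may be taken to be 0; call
-- the result ε.  Let e₀ be the first unit vector and π the projection forgetting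
-- its coordinate, and let W have image U = π W.  The Krylov spaces of W project
-- onto those of U, and the j-th of them has the same dimension as that of U or
-- exceeds it by 1, according as e₀ lies outside or inside.  So the profile of W
-- is that of U, or that of U with one part enlarged.
--
-- If U has profile ν, then W ∌ e₀ is the graph of a linear functional on U, and
-- e₀ lies outside the Krylov space W + … + ε^j W exactly when this functional
-- vanishes on U ∩ ε(U + … + ε^(j-1) U), a subspace of codimension ν_(j+1) in U.
-- Hence q^ν_(j-1) - q^ν_j subspaces W over U acquire e₀ at step j ≥ 2; one
-- acquires it at step 1, and one never does.
--
-- This gives a recursion in n for the number of subspaces.  Removing the largest
-- entry from a standard tableau gives the matching recursion for b: a corner in
-- column j ≥ 2 of the diagram of μ' carries the weight [μ_(j-1) - μ_j + 1]_q.
module Submission where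

open import Defs
open import Level using (0ℓ)
open import Data.Nat as ℕ using (_≤_; ℕ; zero; suc; pred; z≤n; s≤s)
import Data.Nat.Properties as ℕ
open import Data.Fin as Fin using (Fin; zero; suc; finToFun; funToFin; splitAt; _↑ˡ_; _↑ʳ_; toℕ)
import Data.Fin.Properties as Fin
open import Data.List as List using (List; []; _∷_)
open import Data.List.Properties using (length-tabulate; take-all)
import Data.Nat.ListAction as ListAction
open import Data.List.Relation.Unary.AllPairs using ([]; _∷_)
open import Data.List.Relation.Unary.Any using (here)
open import Data.List.Relation.Unary.Linked using (Linked)
open import Data.List.Relation.Unary.All as All using (All; []; _∷_)
import Data.List.Relation.Unary.All.Properties as All
import Data.List.Relation.Unary.Any.Properties as Any
import Data.List.Relation.Unary.AllPairs.Properties as AllPairs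
open import Data.Vec.Functional as Vec using () renaming (_∷_ to _∷ᵥ_; _++_ to _++ᵥ_)
import Data.Vec.Functional.Properties as Vec
open import Data.Maybe using (nothing)
open import Data.Bool using (Bool; true; false)
import Data.Bool as Bool
open import Data.Bool.Properties using (⇔→≡)
open import Data.Product using (∃; ∃₂; _×_; _,_; proj₁; proj₂)
open import Data.Sum using (_⊎_; inj₁; inj₂)
open import Data.Unit using (⊤)
open import Data.Empty using (⊥; ⊥-elim)
open import Function.Definitions using (Injective)
open import Function using (_∘_; id; mk⇔; Inverse; Equivalence)
open import Relation.Nullary using (¬_; Dec; yes; no; does; _×-dec_; ¬?; map′)
open import Relation.Unary using (Decidable)
open import Relation.Nullary.Decidable using (dec-true; decidable-stable)
open import Relation.Binary using (Setoid)
open import Relation.Binary.PropositionalEquality hiding (resp)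
open import Algebra.Bundles using (CommutativeRing)
import Algebra.Properties.CommutativeMonoid.Sum
import Algebra.Properties.Semiring.Sum
import Algebra.Properties.Ring
open import Tactic.RingSolver.Core.AlmostCommutativeRing using (AlmostCommutativeRing; fromCommutativeRing)
import Tactic.RingSolver.NonReflective as RingSolver

-- Distinctness of the diagonal entries makes all entries of ε but the first nonzero, so ε is
-- injective on the remaining coordinates. Write K_j for the j-th Krylov space of U. Then ε K_j has
-- the dimension of K_j, and U / (U ∩ ε K_j) is isomorphic to K_(j+1) / ε K_j; this is the origin of
-- the codimension ν_(j+1). The intersections U ∩ ε K_j grow with j, so the increments of dim K_j
-- decrease, and a part can be enlarged only if the result is again a partition.
--
-- The two recursions agree because, for ν equal to μ with its j-th part lowered to i, q^μ_(j-1) -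
-- q^i = q^i (q-1) [μ_(j-1) - i]_q. Here q^i accounts for the change of binom(μ_j, 2), q-1 for the
-- change of the exponent of q-1, and the q-integer is the weight of the removed cell. Pascal's rule
-- accounts for binom(n, |μ|).
--
-- Lowering a part can leave a zero, and the Krylov spaces of W and U may become stationary at
-- different steps. The induction therefore runs over weakly decreasing lists and prescribes the
-- dimension at every step j.

-- Tableau sums, conjugate partitions, and the recursion satisfied by the formula

module TableauSums where

  open import Data.Nat using (ℕ; zero; suc; pred; _+_; _*_; _∸_; _^_; _≤_; _<_; _≥_; _<ᵇ_; z≤n; s≤s; z<s; s<s; s≤s⁻¹; s<s⁻¹)
  open import Data.Nat.Properties
  open import Data.Nat.ListAction using (sum)
  open import Data.Nat.ListAction.Properties using (sum-++)
  open import Data.Nat.Combinatorics using (_C_; nCk+nC[k+1]≡[n+1]C[k+1]; nC1≡n)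
  open import Data.Nat.Tactic.RingSolver using (solve-∀)
  open import Data.Bool using (Bool; true; false; _∧_; if_then_else_; T)
  open import Data.Bool.Properties using (∧-zeroʳ; ∧-comm)
  open import Data.Maybe using (Maybe; just; nothing)
  open import Data.List using (List; []; _∷_; _++_; map; length; take; drop; concatMap; upTo; applyUpTo; filterᵇ)
  open import Data.List.Properties using (length-++; length-drop; map-++; length-map; length-take; take-all; drop-all; upTo-∷ʳ; applyUpTo-∷ʳ; map-upTo; length-upTo; length-applyUpTo)
  open import Data.List.Relation.Unary.Linked using (Linked; []; [-]; _∷_; tail)
  import Data.List.Relation.Unary.Linked.Properties as Linked
  open import Data.Product using (∃; _×_; _,_; proj₁; proj₂)
  open import Data.Unit using (tt)
  open import Function using (_∘_)
  open import Relation.Nullary using (¬_; yes; no; does)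
  open import Relation.Nullary.Decidable using (dec-true; dec-false)
  open import Relation.Binary.PropositionalEquality

  <ᵇ-true : ∀ {m n} → m < n → (m <ᵇ n) ≡ true
  <ᵇ-true {m} {n} p with m <ᵇ n | <⇒<ᵇ p
  ... | true | _ = refl

  <ᵇ-false : ∀ {m n} → n ≤ m → (m <ᵇ n) ≡ false
  <ᵇ-false {m} {n} p with m <ᵇ n in eq
  ... | false = refl
  ... | true = ⊥-elim (<⇒≱ (<ᵇ⇒< m n (subst T (sym eq) tt)) p)

  -- Sums over lists and over initial segments of ℕ

  ΣL : {A : Set} → (A → ℕ) → List A → ℕ
  ΣL f xs = sum (map f xs)

  ∑ : ℕ → (ℕ → ℕ) → ℕ
  ∑ zero    f = 0
  ∑ (suc k) f = f 0 + ∑ k (f ∘ suc)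

  ∑-cong : ∀ k {f g : ℕ → ℕ} → (∀ i → i < k → f i ≡ g i) → ∑ k f ≡ ∑ k g
  ∑-cong zero    h = refl
  ∑-cong (suc k) h = cong₂ _+_ (h 0 z<s) (∑-cong k (λ i p → h (suc i) (s<s p)))

  ∑-zero : ∀ k → ∑ k (λ _ → 0) ≡ 0
  ∑-zero zero    = refl
  ∑-zero (suc k) = ∑-zero k

  ∑-*ˡ : ∀ c k (f : ℕ → ℕ) → c * ∑ k f ≡ ∑ k (λ i → c * f i)
  ∑-*ˡ c zero    f = *-zeroʳ c
  ∑-*ˡ c (suc k) f = trans (*-distribˡ-+ c (f 0) _) (cong (c * f 0 +_) (∑-*ˡ c k (f ∘ suc)))

  module _ {A : Set} where

    ΣL-++ : (f : A → ℕ) (xs ys : List A) → ΣL f (xs ++ ys) ≡ ΣL f xs + ΣL f ys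
    ΣL-++ f xs ys = trans (cong sum (map-++ f xs ys)) (sum-++ (map f xs) _)

    ΣL-cong-All : {P : A → Set} {f g : A → ℕ} → (∀ {x} → P x → f x ≡ g x) →
                  ∀ {xs} → All P xs → ΣL f xs ≡ ΣL g xs
    ΣL-cong-All h []       = refl
    ΣL-cong-All h (p ∷ ps) = cong₂ _+_ (h p) (ΣL-cong-All h ps)

    ΣL-cong : {f g : A → ℕ} → (∀ x → f x ≡ g x) → ∀ xs → ΣL f xs ≡ ΣL g xs
    ΣL-cong h []       = refl
    ΣL-cong h (x ∷ xs) = cong₂ _+_ (h x) (ΣL-cong h xs)

    ΣL-+ : (f g : A → ℕ) (xs : List A) → ΣL (λ x → f x + g x) xs ≡ ΣL f xs + ΣL g xs
    ΣL-+ f g []       = refl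
    ΣL-+ f g (x ∷ xs) = trans (cong (f x + g x +_) (ΣL-+ f g xs)) (interchange (f x) (g x) _ _)
      where
      interchange : ∀ a b c d → (a + b) + (c + d) ≡ (a + c) + (b + d)
      interchange = solve-∀

    ΣL-*ˡ : (c : ℕ) (f : A → ℕ) (xs : List A) → ΣL (λ x → c * f x) xs ≡ c * ΣL f xs
    ΣL-*ˡ c f []       = sym (*-zeroʳ c)
    ΣL-*ˡ c f (x ∷ xs) = trans (cong (c * f x +_) (ΣL-*ˡ c f xs)) (sym (*-distribˡ-+ c (f x) _))

    ΣL-zero : (xs : List A) → ΣL (λ _ → 0) xs ≡ 0
    ΣL-zero []       = refl
    ΣL-zero (x ∷ xs) = ΣL-zero xs

    ΣL-filterᵇ : (f : A → ℕ) (p : A → Bool) (xs : List A) →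
                 ΣL f (filterᵇ p xs) ≡ ΣL (λ x → if p x then f x else 0) xs
    ΣL-filterᵇ f p []       = refl
    ΣL-filterᵇ f p (x ∷ xs) with p x
    ... | true  = cong (f x +_) (ΣL-filterᵇ f p xs)
    ... | false = ΣL-filterᵇ f p xs

    ΣL-∑ : (k : ℕ) (f : ℕ → A → ℕ) (xs : List A) →
           ΣL (λ x → ∑ k (λ i → f i x)) xs ≡ ∑ k (λ i → ΣL (f i) xs)
    ΣL-∑ zero    f xs = ΣL-zero xs
    ΣL-∑ (suc k) f xs = trans (ΣL-+ (f 0) _ xs) (cong (ΣL (f 0) xs +_) (ΣL-∑ k (f ∘ suc) xs))

  module _ {A B : Set} where

    ΣL-map : (f : B → ℕ) (g : A → B) (xs : List A) → ΣL f (map g xs) ≡ ΣL (f ∘ g) xs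
    ΣL-map f g []       = refl
    ΣL-map f g (x ∷ xs) = cong (f (g x) +_) (ΣL-map f g xs)

    ΣL-concatMap : (f : B → ℕ) (g : A → List B) (xs : List A) →
                   ΣL f (concatMap g xs) ≡ ΣL (λ x → ΣL f (g x)) xs
    ΣL-concatMap f g []       = refl
    ΣL-concatMap f g (x ∷ xs) =
      trans (ΣL-++ f (g x) (concatMap g xs)) (cong (ΣL f (g x) +_) (ΣL-concatMap f g xs))

  -- Permutations

  Ins : ℕ → (List ℕ → ℕ) → List ℕ → ℕ
  Ins x f zs = ΣL f (insertAll x zs)

  Ins-∷ : ∀ x f z zs → Ins x f (z ∷ zs) ≡ f (x ∷ z ∷ zs) + Ins x (f ∘ (z ∷_)) zs
  Ins-∷ x f z zs = cong (f (x ∷ z ∷ zs) +_) (ΣL-map f (z ∷_) (insertAll x zs))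

  Ins-comm : ∀ x y f zs → Ins x (Ins y f) zs ≡ Ins y (Ins x f) zs
  Ins-comm x y f [] = lem (f (y ∷ x ∷ [])) (f (x ∷ y ∷ []))
    where
    lem : ∀ a b → a + (b + 0) + 0 ≡ b + (a + 0) + 0
    lem = solve-∀
  Ins-comm x y f (z ∷ zs) = begin
    Ins x (Ins y f) (z ∷ zs)                           ≡⟨ step x y ⟩
    f (y ∷ x ∷ z ∷ zs) + (f (x ∷ y ∷ z ∷ zs) + p)
      + (r + Ins x (Ins y (f ∘ (z ∷_))) zs)            ≡⟨ cong (λ h → f (y ∷ x ∷ z ∷ zs) + (f (x ∷ y ∷ z ∷ zs) + p) + (r + h))
                                                           (Ins-comm x y (f ∘ (z ∷_)) zs) ⟩
    f (y ∷ x ∷ z ∷ zs) + (f (x ∷ y ∷ z ∷ zs) + p)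
      + (r + Ins y (Ins x (f ∘ (z ∷_))) zs)            ≡⟨ lem (f (y ∷ x ∷ z ∷ zs)) (f (x ∷ y ∷ z ∷ zs)) p r _ ⟩
    f (x ∷ y ∷ z ∷ zs) + (f (y ∷ x ∷ z ∷ zs) + r)
      + (p + Ins y (Ins x (f ∘ (z ∷_))) zs)            ≡⟨ step y x ⟨
    Ins y (Ins x f) (z ∷ zs)                           ∎
    where
    open ≡-Reasoning
    p = Ins y (λ w → f (x ∷ z ∷ w)) zs
    r = Ins x (λ w → f (y ∷ z ∷ w)) zs
    lem : ∀ a b p r s → a + (b + p) + (r + s) ≡ b + (a + r) + (p + s)
    lem = solve-∀
    step : ∀ x y → Ins x (Ins y f) (z ∷ zs) ≡
             f (y ∷ x ∷ z ∷ zs) + (f (x ∷ y ∷ z ∷ zs) + Ins y (λ w → f (x ∷ z ∷ w)) zs)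
               + (Ins x (λ w → f (y ∷ z ∷ w)) zs + Ins x (Ins y (f ∘ (z ∷_))) zs)
    step x y = trans (Ins-∷ x (Ins y f) z zs) (cong₂ _+_
      (trans (Ins-∷ y f x (z ∷ zs)) (cong (f (y ∷ x ∷ z ∷ zs) +_) (Ins-∷ y (f ∘ (x ∷_)) z zs)))
      (trans (ΣL-cong (λ w → Ins-∷ y f z w) (insertAll x zs)) (ΣL-+ _ _ (insertAll x zs))))

  -- `perms` inserts the head of its list last and the final letter first. The largest letter stands
  -- at the end, and `Ins-comm` moves its insertion to the outside.
  ΣL-perms-∷ʳ : ∀ f xs y → ΣL f (perms (xs ++ y ∷ [])) ≡ ΣL (Ins y f) (perms xs)
  ΣL-perms-∷ʳ f []       y = sym (+-identityʳ _)
  ΣL-perms-∷ʳ f (x ∷ xs) y = begin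
    ΣL f (concatMap (insertAll x) (perms (xs ++ y ∷ []))) ≡⟨ ΣL-concatMap f (insertAll x) (perms (xs ++ y ∷ [])) ⟩
    ΣL (Ins x f) (perms (xs ++ y ∷ []))                   ≡⟨ ΣL-perms-∷ʳ (Ins x f) xs y ⟩
    ΣL (Ins y (Ins x f)) (perms xs)                       ≡⟨ ΣL-cong (Ins-comm y x f) (perms xs) ⟩
    ΣL (Ins x (Ins y f)) (perms xs)                       ≡⟨ ΣL-concatMap (Ins y f) (insertAll x) (perms xs) ⟨
    ΣL (Ins y f) (concatMap (insertAll x) (perms xs))     ∎
    where open ≡-Reasoning

  All-concatMap : {A B : Set} {P : A → Set} {Q : B → Set} {g : A → List B} →
                  (∀ {x} → P x → All Q (g x)) → ∀ {xs} → All P xs → All Q (concatMap g xs)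
  All-concatMap h ps = All.concat⁺ (All.map⁺ (All.map h ps))

  insertAll-All : ∀ {P : ℕ → Set} {x ys} → P x → All P ys → All (All P) (insertAll x ys)
  insertAll-All px []         = (px ∷ []) ∷ []
  insertAll-All px (py ∷ pys) = (px ∷ py ∷ pys) ∷ All.map⁺ (All.map (py ∷_) (insertAll-All px pys))

  perms-All : ∀ {P : ℕ → Set} {xs} → All P xs → All (All P) (perms xs)
  perms-All []         = [] ∷ []
  perms-All (px ∷ pxs) = All-concatMap (insertAll-All px) (perms-All pxs)

  insertAll-length : ∀ x ys → All (λ zs → length zs ≡ suc (length ys)) (insertAll x ys)
  insertAll-length x []       = refl ∷ []
  insertAll-length x (y ∷ ys) = refl ∷ All.map⁺ (All.map (cong suc) (insertAll-length x ys))

  perms-length : ∀ xs → All (λ zs → length zs ≡ length xs) (perms xs)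
  perms-length []       = refl ∷ []
  perms-length (x ∷ xs) = All-concatMap
    (λ {ys} eq → All.map (λ e → trans e (cong suc eq)) (insertAll-length x ys)) (perms-length xs)

  -- Layouts of a word and the position of its largest letter

  nth : List ℕ → ℕ → ℕ
  nth []       _       = 0
  nth (x ∷ xs) zero    = x
  nth (x ∷ xs) (suc i) = nth xs i

  decAt : ℕ → List ℕ → List ℕ
  decAt _       []       = []
  decAt zero    (x ∷ xs) = pred x ∷ xs
  decAt (suc i) (x ∷ xs) = x ∷ decAt i xs

  snocAt : ℕ → ℕ → List (List ℕ) → List (List ℕ)
  snocAt _       M []       = []
  snocAt zero    M (r ∷ rs) = (r ++ M ∷ []) ∷ rs
  snocAt (suc i) M (r ∷ rs) = r ∷ snocAt i M rs

  -- Guards against empty rows: the largest letter cannot lie there, but `decAt` truncates at 0 and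
  -- would still produce a term.
  ifPos : ℕ → ℕ → ℕ
  ifPos zero    x = 0
  ifPos (suc _) x = x

  strictIncr-∷-false : ∀ x r → strictIncr r ≡ false → strictIncr (x ∷ r) ≡ false
  strictIncr-∷-false x (y ∷ ys) eq = trans (cong ((x <ᵇ y) ∧_) eq) (∧-zeroʳ (x <ᵇ y))

  strictIncr-max-∷ : ∀ {M z} zs → z < M → strictIncr (M ∷ z ∷ zs) ≡ false
  strictIncr-max-∷ {M} {z} zs z<M = cong (_∧ strictIncr (z ∷ zs)) (<ᵇ-false (<⇒≤ z<M))

  module _ {M : ℕ} where

    -- If `M` falls inside the first block but not at its end, a smaller letter follows it and `g`
    -- vanishes. What survives is `M` ending the block or falling beyond it.
    Ins-split : ∀ l (g : List ℕ → List ℕ → ℕ) → (∀ r w → strictIncr r ≡ false → g r w ≡ 0) →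
      ∀ zs → All (_< M) zs → l ≤ length zs →
      Ins M (λ w → g (take l w) (drop l w)) zs ≡
      ifPos l (g (take (pred l) zs ++ M ∷ []) (drop (pred l) zs)) + Ins M (g (take l zs)) (drop l zs)
    Ins-split zero          g h zs       ps       le       = refl
    Ins-split (suc zero)    g h (z ∷ zs) ps       (s≤s le) = Ins-∷ M _ z zs
    Ins-split (suc (suc l)) g h (z ∷ zs) (p ∷ ps) (s≤s le) =
      trans (Ins-∷ M _ z zs) (cong₂ _+_
        (h (M ∷ z ∷ take l zs) (drop l zs) (strictIncr-max-∷ (take l zs) p))
        (Ins-split (suc l) (λ r → g (z ∷ r)) (λ r w e → h (z ∷ r) w (strictIncr-∷-false z r e)) zs ps le))

    Ins-last : ∀ (g : List ℕ → List ℕ → ℕ) → (∀ r w → strictIncr r ≡ false → g r w ≡ 0) →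
      ∀ zs → All (_< M) zs →
      Ins M (λ w → g (take (suc (length zs)) w) (drop (suc (length zs)) w)) zs ≡ g (zs ++ M ∷ []) []
    Ins-last g h []       []       = +-identityʳ _
    Ins-last g h (z ∷ zs) (p ∷ ps) =
      trans (Ins-∷ M _ z zs) (cong₂ _+_
        (h _ _ (strictIncr-max-∷ (take (length zs) zs) p))
        (Ins-last (λ r → g (z ∷ r)) (λ r w e → h (z ∷ r) w (strictIncr-∷-false z r e)) zs ps))

  nth-sum≡0 : ∀ ls → sum ls ≡ 0 → ∀ i → nth ls i ≡ 0
  nth-sum≡0 []       _ i       = refl
  nth-sum≡0 (l ∷ ls) e zero    = m+n≡0⇒m≡0 l e
  nth-sum≡0 (l ∷ ls) e (suc i) = nth-sum≡0 ls (m+n≡0⇒n≡0 l e) i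

  -- The rows `T` above are quantified so that the property passes to `H ∘ (r ∷_)` when a row is
  -- peeled off.
  VanishesOffIncr : (List (List ℕ) → ℕ) → Set
  VanishesOffIncr H = ∀ T r T′ → strictIncr r ≡ false → H (T ++ r ∷ T′) ≡ 0

  -- In a filling with increasing rows, the largest letter ends its row.
  Ins-layout : ∀ {M} sh H → VanishesOffIncr H → ∀ zs → All (_< M) zs → suc (length zs) ≡ sum sh →
    Ins M (H ∘ layout sh) zs ≡
    ∑ (length sh) (λ i → ifPos (nth sh i) (H (snocAt i M (layout (decAt i sh) zs))))
  Ins-layout {M} (l ∷ ls) H h zs ps eq with l ≤? length zs
  ... | yes le = trans
        (Ins-split l (λ r w → H (r ∷ layout ls w)) (λ r w → h [] r (layout ls w)) zs ps le)
        (cong (ifPos l (H ((take (pred l) zs ++ M ∷ []) ∷ layout ls (drop (pred l) zs))) +_) (Ins-layout ls (H ∘ (take l zs ∷_)) (λ T → h (take l zs ∷ T))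
          (drop l zs) (All.drop⁺ l ps) len))
    where
    len : suc (length (drop l zs)) ≡ sum ls
    len = trans (cong suc (length-drop l zs)) (trans (sym (+-∸-assoc 1 le))
          (trans (cong (_∸ l) eq) (m+n∸m≡n l (sum ls))))
  -- The first row now takes the whole enlarged word, so `sum ls` is 0 and every lower row is empty.
  ... | no l≰ with l | ≰⇒> l≰ | eq
  ...   | suc l | s≤s lz≤l | eq₁ = begin
    Ins M (H ∘ layout (suc l ∷ ls)) zs
      ≡⟨ cong (λ k → Ins M (H ∘ layout (suc k ∷ ls)) zs) (sym lz≡l) ⟩
    Ins M (H ∘ layout (suc (length zs) ∷ ls)) zs
      ≡⟨ Ins-last (λ r w → H (r ∷ layout ls w)) (λ r w → h [] r (layout ls w)) zs ps ⟩
    H ((zs ++ M ∷ []) ∷ layout ls [])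
      ≡⟨ cong₂ (λ r w → H ((r ++ M ∷ []) ∷ layout ls w))
           (take-all l zs (≤-reflexive lz≡l)) (drop-all l zs (≤-reflexive lz≡l)) ⟨
    H ((take l zs ++ M ∷ []) ∷ layout ls (drop l zs))
      ≡⟨ +-identityʳ _ ⟨
    H ((take l zs ++ M ∷ []) ∷ layout ls (drop l zs)) + 0
      ≡⟨ cong (H ((take l zs ++ M ∷ []) ∷ layout ls (drop l zs)) +_) rest≡0 ⟨
    H ((take l zs ++ M ∷ []) ∷ layout ls (drop l zs)) + ∑ (length ls) rest ∎
    where
    open ≡-Reasoning
    eq′ : length zs ≡ l + sum ls
    eq′ = suc-injective eq₁
    lz≡l : length zs ≡ l
    lz≡l = ≤-antisym lz≤l (subst (l ≤_) (sym eq′) (m≤m+n l _))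
    ls≡0 : sum ls ≡ 0
    ls≡0 = +-cancelˡ-≡ l _ _ (trans (sym eq′) (trans lz≡l (sym (+-identityʳ l))))
    lower : ℕ → ℕ
    lower i = H (take (suc l) zs ∷ snocAt i M (layout (decAt i ls) (drop (suc l) zs)))
    rest : ℕ → ℕ
    rest i = ifPos (nth ls i) (lower i)
    rest≡0 : ∑ (length ls) rest ≡ 0
    rest≡0 = trans (∑-cong (length ls) (λ i _ → cong (λ k → ifPos k (lower i)) (nth-sum≡0 ls ls≡0 i)))
                   (∑-zero (length ls))

  layout-lengths : ∀ sh zs → length zs ≡ sum sh → map length (layout sh zs) ≡ sh
  layout-lengths []       zs eq = refl
  layout-lengths (l ∷ ls) zs eq = cong₂ _∷_
    (trans (length-take l zs) (m≤n⇒m⊓n≡m (subst (l ≤_) (sym eq) (m≤m+n l _))))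
    (layout-lengths ls (drop l zs) (trans (length-drop l zs) (trans (cong (_∸ l) eq) (m+n∸m≡n l _))))

  layout-All : ∀ {P : ℕ → Set} sh zs → All P zs → All (All P) (layout sh zs)
  layout-All []       zs ps = []
  layout-All (l ∷ ls) zs ps = All.take⁺ l ps ∷ layout-All ls (drop l zs) (All.drop⁺ l ps)

  -- Adding the largest letter at the end of a row

  cellBelow : Maybe ℕ → ℕ → ℕ
  cellBelow (just x) v = if x <ᵇ v then 1 else 0
  cellBelow nothing  v = 0

  countBelow-∷ : ∀ r rs c v → countBelow (r ∷ rs) c v ≡ cellBelow (at r c) v + countBelow rs c v
  countBelow-∷ r rs c v with at r c
  ... | just x  = refl
  ... | nothing = refl

  -- Here `l` is the length of the row before the new cell is added. A first cell carries no factor.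
  -- Otherwise the new entry exceeds all others, so its count is the number of rows, from its own
  -- downwards, that reach the column before it.
  weight : ℕ → ℕ → List ℕ → ℕ
  weight q zero    sh = 1
  weight q (suc l) sh = qint q (countGe (suc l) sh)

  cellWeight : ℕ → ℕ → List ℕ → ℕ
  cellWeight q i sh = weight q (nth sh i) (drop i sh)

  colIncr-short : ∀ r s → length r < length s → colIncr r s ≡ false
  colIncr-short []      (y ∷ s) _        = refl
  colIncr-short (x ∷ r) (y ∷ s) (s≤s lt) = trans (cong ((x <ᵇ y) ∧_) (colIncr-short r s lt)) (∧-zeroʳ (x <ᵇ y))

  module _ {M : ℕ} where

    strictIncr-∷ʳ : ∀ {r} → All (_< M) r → strictIncr (r ++ M ∷ []) ≡ strictIncr r
    strictIncr-∷ʳ []               = refl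
    strictIncr-∷ʳ (p ∷ [])         = cong (_∧ true) (<ᵇ-true p)
    strictIncr-∷ʳ {x ∷ y ∷ _} (p ∷ p′ ∷ ps) = cong ((x <ᵇ y) ∧_) (strictIncr-∷ʳ (p′ ∷ ps))

    -- If `s` has a cell under `M`, both sides are false: on the left `M` exceeds that entry, on the
    -- right `r` is too short.
    colIncr-∷ʳˡ : ∀ r {s} → All (_< M) s → colIncr (r ++ M ∷ []) s ≡ colIncr r s
    colIncr-∷ʳˡ r       []       = refl
    colIncr-∷ʳˡ []      {_ ∷ s} (p ∷ ps) = cong (_∧ colIncr [] s) (<ᵇ-false (<⇒≤ p))
    colIncr-∷ʳˡ (x ∷ r) {y ∷ _} (p ∷ ps) = cong ((x <ᵇ y) ∧_) (colIncr-∷ʳˡ r ps)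

    colIncr-∷ʳʳ : ∀ {r} s → All (_< M) r → length s < length r → colIncr r (s ++ M ∷ []) ≡ colIncr r s
    colIncr-∷ʳʳ []      (p ∷ ps) lt       = cong (_∧ true) (<ᵇ-true p)
    colIncr-∷ʳʳ {x ∷ _} (y ∷ s) (p ∷ ps) (s≤s lt) = cong ((x <ᵇ y) ∧_) (colIncr-∷ʳʳ s ps lt)

    -- The condition on lengths gives `M` an entry above it. A cell below `M` makes both sides
    -- false, by `colIncr-∷ʳˡ`.
    isStandard-snocAt : ∀ i T → All (All (_< M)) T →
      (∀ k → i ≡ suc k → nth (map length T) i < nth (map length T) k) →
      isStandard (snocAt i M T) ≡ isStandard T
    isStandard-snocAt i       []       _ _ = refl
    isStandard-snocAt zero    (r ∷ []) (p ∷ []) _ = strictIncr-∷ʳ p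
    isStandard-snocAt zero    (r ∷ s ∷ rs) (p ∷ p′ ∷ ps) _ =
      cong₂ _∧_ (strictIncr-∷ʳ p) (cong (_∧ isStandard (s ∷ rs)) (colIncr-∷ʳˡ r p′))
    isStandard-snocAt (suc i) (r ∷ []) _ _ = refl
    isStandard-snocAt (suc zero) (r ∷ s ∷ rs) (p ∷ ps) h =
      cong (strictIncr r ∧_) (cong₂ _∧_ (colIncr-∷ʳʳ s p (h 0 refl))
        (isStandard-snocAt zero (s ∷ rs) ps (λ _ ())))
    isStandard-snocAt (suc (suc i)) (r ∷ s ∷ rs) (p ∷ ps) h =
      cong (λ b → strictIncr r ∧ colIncr r s ∧ b)
        (isStandard-snocAt (suc i) (s ∷ rs) ps (λ k e → h (suc k) (cong suc e)))

    -- The bound is weak so that it also covers `v = M`: the strict comparison keeps `M` out of its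
    -- own count.
    cellBelow-∷ʳ : ∀ r c {v} → v ≤ M → cellBelow (at (r ++ M ∷ []) c) v ≡ cellBelow (at r c) v
    cellBelow-∷ʳ []      zero    le = cong (if_then 1 else 0) (<ᵇ-false le)
    cellBelow-∷ʳ []      (suc c) le = refl
    cellBelow-∷ʳ (x ∷ r) zero    le = refl
    cellBelow-∷ʳ (x ∷ r) (suc c) le = cellBelow-∷ʳ r c le

    countBelow-snocAt : ∀ i T c {v} → v ≤ M → countBelow (snocAt i M T) c v ≡ countBelow T c v
    countBelow-snocAt i       []       c le = refl
    countBelow-snocAt zero    (r ∷ rs) c {v} le = trans (countBelow-∷ (r ++ M ∷ []) rs c v)
      (trans (cong (_+ countBelow rs c v) (cellBelow-∷ʳ r c le)) (sym (countBelow-∷ r rs c v)))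
    countBelow-snocAt (suc i) (r ∷ rs) c {v} le = trans (countBelow-∷ r (snocAt i M rs) c v)
      (trans (cong (cellBelow (at r c) v +_) (countBelow-snocAt i rs c le)) (sym (countBelow-∷ r rs c v)))

    cellBelow-max : ∀ {r} c → All (_< M) r → cellBelow (at r c) M ≡ (if length r <ᵇ suc c then 0 else 1)
    cellBelow-max c       []       = refl
    cellBelow-max zero    (p ∷ ps) = cong (if_then 1 else 0) (<ᵇ-true p)
    cellBelow-max (suc c) (p ∷ ps) = cellBelow-max c ps

    countBelow-max : ∀ {T} c → All (All (_< M)) T → countBelow T c M ≡ countGe (suc c) (map length T)
    countBelow-max c []                = refl
    countBelow-max {r ∷ rs} c (p ∷ ps) = trans (countBelow-∷ r rs c M) (cong₂ _+_ (cellBelow-max c p) (countBelow-max c ps))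

  module _ (q : ℕ) where

    rowFactor-cong : ∀ {P : ℕ → Set} S S′ → (∀ c {v} → P v → countBelow S c v ≡ countBelow S′ c v) →
      ∀ c {vs} → All P vs → rowFactor q S c vs ≡ rowFactor q S′ c vs
    rowFactor-cong S S′ h c []       = refl
    rowFactor-cong S S′ h c (p ∷ ps) = cong₂ _*_ (cong (qint q) (h c p)) (rowFactor-cong S S′ h (suc c) ps)

    rowFactor-∷ʳ : ∀ S c vs M →
      rowFactor q S c (vs ++ M ∷ []) ≡ qint q (countBelow S (c + length vs) M) * rowFactor q S c vs
    rowFactor-∷ʳ S c []       M = cong (λ k → qint q (countBelow S k M) * 1) (sym (+-identityʳ c))
    rowFactor-∷ʳ S c (v ∷ vs) M = begin
      a * rowFactor q S (suc c) (vs ++ M ∷ [])                          ≡⟨ cong (a *_) (rowFactor-∷ʳ S (suc c) vs M) ⟩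
      a * (qint q (countBelow S (suc c + length vs) M) * z)             ≡⟨ cong (λ k → a * (qint q (countBelow S k M) * z)) (sym (+-suc c (length vs))) ⟩
      a * (qint q (countBelow S (c + suc (length vs)) M) * z)           ≡⟨ lem a (qint q (countBelow S (c + suc (length vs)) M)) z ⟩
      qint q (countBelow S (c + suc (length vs)) M) * (a * z)           ∎
      where
      open ≡-Reasoning
      a = qint q (countBelow S c v)
      z = rowFactor q S (suc c) vs
      lem : ∀ x y z → x * (y * z) ≡ y * (x * z)
      lem = solve-∀

    -- The appended `M` is never below an older entry, so all old factors stay, also in the rows
    -- above that see the longer row; only the factor of the new cell is added.
    cq-snocAt : ∀ {M} i T → i < length T → All (All (_< M)) T →
      cq q (snocAt i M T) ≡ cellWeight q i (map length T) * cq q T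
    cq-snocAt {M} zero ([] ∷ rs) _ _ = sym (+-identityʳ _)
    cq-snocAt {M} zero ((x ∷ r) ∷ rs) _ ((p ∷ ps) ∷ pss) = begin
      rowFactor q S′ 0 (r ++ M ∷ []) * cq q rs
        ≡⟨ cong (_* cq q rs) (rowFactor-∷ʳ S′ 0 r M) ⟩
      qint q (countBelow S′ (length r) M) * rowFactor q S′ 0 r * cq q rs
        ≡⟨ cong₂ (λ u v → qint q u * v * cq q rs)
             (trans (countBelow-snocAt 0 S (length r) ≤-refl) (countBelow-max (length r) ((p ∷ ps) ∷ pss)))
             (rowFactor-cong S′ S (λ c lt → countBelow-snocAt 0 S c (<⇒≤ lt)) 0 ps) ⟩
      qint q (countGe (suc (length r)) (map length S)) * rowFactor q S 0 r * cq q rs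
        ≡⟨ *-assoc (qint q (countGe (suc (length r)) (map length S))) _ _ ⟩
      qint q (countGe (suc (length r)) (map length S)) * (rowFactor q S 0 r * cq q rs) ∎
      where
      open ≡-Reasoning
      S  = (x ∷ r) ∷ rs
      S′ = (x ∷ r ++ M ∷ []) ∷ rs
    cq-snocAt {M} (suc i) (r ∷ rs) (s≤s lt) (p ∷ ps) = begin
      rowFactor q (r ∷ snocAt i M rs) 0 (drop 1 r) * cq q (snocAt i M rs)
        ≡⟨ cong₂ _*_ (rowFactor-cong (r ∷ snocAt i M rs) (r ∷ rs)
             (λ c lt → countBelow-snocAt (suc i) (r ∷ rs) c (<⇒≤ lt)) 0 (All.drop⁺ 1 p)) (cq-snocAt i rs lt ps) ⟩
      rowFactor q (r ∷ rs) 0 (drop 1 r) * (cellWeight q i (map length rs) * cq q rs)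
        ≡⟨ lem (rowFactor q (r ∷ rs) 0 (drop 1 r)) (cellWeight q i (map length rs)) (cq q rs) ⟩
      cellWeight q i (map length rs) * (rowFactor q (r ∷ rs) 0 (drop 1 r) * cq q rs) ∎
      where
      open ≡-Reasoning
      lem : ∀ x y z → x * (y * z) ≡ y * (x * z)
      lem = solve-∀

  -- Recursion for b

  sum-decAt : ∀ i sh {l} → nth sh i ≡ suc l → sum sh ≡ suc (sum (decAt i sh))
  sum-decAt zero    (suc x ∷ sh) eq = refl
  sum-decAt (suc i) (x ∷ sh)     eq = trans (cong (x +_) (sum-decAt i sh eq)) (+-suc x _)

  nth-decAt : ∀ i sh → nth (decAt i sh) i ≡ pred (nth sh i)
  nth-decAt i       []       = refl
  nth-decAt zero    (x ∷ sh) = refl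
  nth-decAt (suc i) (x ∷ sh) = nth-decAt i sh

  nth-decAt-≢ : ∀ i k sh → i ≢ k → nth (decAt i sh) k ≡ nth sh k
  nth-decAt-≢ i       k       []       _  = refl
  nth-decAt-≢ zero    zero    (x ∷ sh) ne = ⊥-elim (ne refl)
  nth-decAt-≢ zero    (suc k) (x ∷ sh) ne = refl
  nth-decAt-≢ (suc i) zero    (x ∷ sh) ne = refl
  nth-decAt-≢ (suc i) (suc k) (x ∷ sh) ne = nth-decAt-≢ i k sh (ne ∘ cong suc)

  length-decAt : ∀ i sh → length (decAt i sh) ≡ length sh
  length-decAt i       []       = refl
  length-decAt zero    (x ∷ sh) = refl
  length-decAt (suc i) (x ∷ sh) = cong suc (length-decAt i sh)

  nth-antitone : ∀ {sh} → Linked _≥_ sh → ∀ k → nth sh (suc k) ≤ nth sh k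
  nth-antitone []       k       = z≤n
  nth-antitone [-]      k       = z≤n
  nth-antitone (p ∷ ps) zero    = p
  nth-antitone (p ∷ ps) (suc k) = nth-antitone ps k

  isStandard-∷-false : ∀ r T → isStandard T ≡ false → isStandard (r ∷ T) ≡ false
  isStandard-∷-false r (s ∷ T) eq =
    trans (cong (λ b → strictIncr r ∧ colIncr r s ∧ b) eq)
      (trans (cong (strictIncr r ∧_) (∧-zeroʳ (colIncr r s))) (∧-zeroʳ (strictIncr r)))

  isStandard-offIncr : ∀ T r T′ → strictIncr r ≡ false → isStandard (T ++ r ∷ T′) ≡ false
  isStandard-offIncr []      r []       eq = eq
  isStandard-offIncr []      r (s ∷ T′) eq = cong (_∧ (colIncr r s ∧ isStandard (s ∷ T′))) eq
  isStandard-offIncr (t ∷ T) r T′       eq = isStandard-∷-false t (T ++ r ∷ T′) (isStandard-offIncr T r T′ eq)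

  isStandard-ascent : ∀ k T → nth (map length T) k < nth (map length T) (suc k) → isStandard T ≡ false
  isStandard-ascent zero    (r ∷ s ∷ T) lt =
    trans (cong (λ b → strictIncr r ∧ b ∧ isStandard (s ∷ T)) (colIncr-short r s lt)) (∧-zeroʳ (strictIncr r))
  isStandard-ascent (suc k) (r ∷ T)     lt = isStandard-∷-false r T (isStandard-ascent k T lt)

  isStandard-∷ʳ-[] : ∀ T → isStandard (T ++ [] ∷ []) ≡ isStandard T
  isStandard-∷ʳ-[] []          = refl
  isStandard-∷ʳ-[] (r ∷ [])    = trans (∧-comm (strictIncr r) true) refl
  isStandard-∷ʳ-[] (r ∷ s ∷ T) = cong (λ b → strictIncr r ∧ colIncr r s ∧ b) (isStandard-∷ʳ-[] (s ∷ T))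

  module Tableaux (q : ℕ) where

    standardWeight : List (List ℕ) → ℕ
    standardWeight T = if isStandard T then cq q T else 0

    words : ℕ → List (List ℕ)
    words N = perms (map suc (upTo N))

    words-< : ∀ N → All (All (_< suc N)) (words N)
    words-< N = perms-All (All.map⁺ (All.map s<s (All.applyUpTo⁺₁ _ N (λ p → p))))

    words-length : ∀ N → All (λ zs → length zs ≡ N) (words N)
    words-length N = All.map (λ e → trans e (trans (length-map suc (upTo N)) (length-upTo N)))
      (perms-length (map suc (upTo N)))

    ΣL-words-suc : ∀ f N → ΣL f (words (suc N)) ≡ ΣL (Ins (suc N) f) (words N)
    ΣL-words-suc f N = trans
      (cong (λ xs → ΣL f (perms xs)) (trans (cong (map suc) (sym (upTo-∷ʳ N))) (map-++ suc (upTo N) (N ∷ []))))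
      (ΣL-perms-∷ʳ f (map suc (upTo N)) (suc N))

    b-unfold : ∀ sh → b sh q ≡ ΣL (standardWeight ∘ layout sh) (words (sum sh))
    b-unfold sh = trans (ΣL-filterᵇ (cq q) isStandard (map (layout sh) (words (sum sh))))
                        (ΣL-map standardWeight (layout sh) (words (sum sh)))

    standardWeight-offIncr : VanishesOffIncr standardWeight
    standardWeight-offIncr T r T′ eq = cong (if_then cq q (T ++ r ∷ T′) else 0) (isStandard-offIncr T r T′ eq)

    standardWeight-snocAt : ∀ {M} i T → i < length T → All (All (_< M)) T →
      (∀ k → i ≡ suc k → nth (map length T) i < nth (map length T) k) →
      standardWeight (snocAt i M T) ≡ cellWeight q i (map length T) * standardWeight T
    standardWeight-snocAt {M} i T lt ps h
      rewrite isStandard-snocAt i T ps h with isStandard T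
    ... | true  = cq-snocAt q i T lt ps
    ... | false = sym (*-zeroʳ (cellWeight q i (map length T)))

    -- The largest letter of a standard tableau ends a row, and deleting it leaves a standard
    -- tableau of the shortened shape. The sum runs over all rows, not just those ending in a
    -- corner: where the shortened shape is not a partition, `b` vanishes by `b-ascent`.
    b-rec : ∀ {sh} → Linked _≥_ sh → ∀ {N} → sum sh ≡ suc N →
      b sh q ≡ ∑ (length sh) (λ i → ifPos (nth sh i) (cellWeight q i (decAt i sh) * b (decAt i sh) q))
    b-rec {sh} desc {N} eq = begin
      b sh q                                                            ≡⟨ b-unfold sh ⟩
      ΣL (standardWeight ∘ layout sh) (words (sum sh))                  ≡⟨ cong (ΣL (standardWeight ∘ layout sh) ∘ words) eq ⟩
      ΣL (standardWeight ∘ layout sh) (words (suc N))                   ≡⟨ ΣL-words-suc _ N ⟩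
      ΣL (Ins (suc N) (standardWeight ∘ layout sh)) (words N)           ≡⟨ ΣL-cong-All insert (All.zip (words-< N , words-length N)) ⟩
      ΣL (λ zs → ∑ (length sh) (λ i → summand i zs)) (words N)          ≡⟨ ΣL-∑ (length sh) summand (words N) ⟩
      ∑ (length sh) (λ i → ΣL (summand i) (words N))                    ≡⟨ ∑-cong (length sh) remove ⟩
      ∑ (length sh) (λ i → ifPos (nth sh i) (cellWeight q i (decAt i sh) * b (decAt i sh) q)) ∎
      where
      open ≡-Reasoning
      summand : ℕ → List ℕ → ℕ
      summand i zs = ifPos (nth sh i) (standardWeight (snocAt i (suc N) (layout (decAt i sh) zs)))
      insert : ∀ {zs} → All (_< suc N) zs × length zs ≡ N →
        Ins (suc N) (standardWeight ∘ layout sh) zs ≡ ∑ (length sh) (λ i → summand i zs)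
      insert {zs} (ps , len) =
        Ins-layout sh standardWeight standardWeight-offIncr zs ps (trans (cong suc len) (sym eq))
      remove : ∀ i → i < length sh →
        ΣL (summand i) (words N) ≡ ifPos (nth sh i) (cellWeight q i (decAt i sh) * b (decAt i sh) q)
      remove i i< with nth sh i in eqᵢ
      ... | zero  = ΣL-zero (words N)
      ... | suc l = begin
        ΣL (λ zs → standardWeight (snocAt i (suc N) (layout (decAt i sh) zs))) (words N)
          ≡⟨ ΣL-cong-All append (All.zip (words-< N , words-length N)) ⟩
        ΣL (λ zs → cellWeight q i (decAt i sh) * standardWeight (layout (decAt i sh) zs)) (words N)
          ≡⟨ ΣL-*ˡ (cellWeight q i (decAt i sh)) _ (words N) ⟩
        cellWeight q i (decAt i sh) * ΣL (standardWeight ∘ layout (decAt i sh)) (words N)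
          ≡⟨ cong (λ k → cellWeight q i (decAt i sh) * ΣL (standardWeight ∘ layout (decAt i sh)) (words k)) N≡ ⟩
        cellWeight q i (decAt i sh) * ΣL (standardWeight ∘ layout (decAt i sh)) (words (sum (decAt i sh)))
          ≡⟨ cong (cellWeight q i (decAt i sh) *_) (b-unfold (decAt i sh)) ⟨
        cellWeight q i (decAt i sh) * b (decAt i sh) q ∎
        where
        N≡ : N ≡ sum (decAt i sh)
        N≡ = suc-injective (trans (sym eq) (sum-decAt i sh eqᵢ))
        fits : ∀ k → i ≡ suc k → nth (decAt i sh) i < nth (decAt i sh) k
        fits k refl = subst₂ _<_
          (sym (trans (nth-decAt (suc k) sh) (cong pred eqᵢ))) (sym (nth-decAt-≢ (suc k) k sh 1+n≢n))
          (subst (_≤ nth sh k) eqᵢ (nth-antitone desc k))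
        append : ∀ {zs} → All (_< suc N) zs × length zs ≡ N →
          standardWeight (snocAt i (suc N) (layout (decAt i sh) zs)) ≡
          cellWeight q i (decAt i sh) * standardWeight (layout (decAt i sh) zs)
        append {zs} (ps , len) = subst
          (λ ls → i < length ls → (∀ k → i ≡ suc k → nth ls i < nth ls k) →
            standardWeight (snocAt i (suc N) rows) ≡ cellWeight q i ls * standardWeight rows)
          (layout-lengths (decAt i sh) zs (trans len N≡))
          (λ i<rows → standardWeight-snocAt i rows (subst (i <_) (length-map length rows) i<rows) (layout-All (decAt i sh) zs ps))
          (subst (i <_) (sym (length-decAt i sh)) i<) fits
          where rows = layout (decAt i sh) zs

    b-ascent : ∀ k sh → nth sh k < nth sh (suc k) → b sh q ≡ 0
    b-ascent k sh lt = trans (b-unfold sh) (trans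
      (ΣL-cong-All (λ {zs} len → cong (if_then cq q (layout sh zs) else 0) (isStandard-ascent k (layout sh zs)
          (subst (λ ls → nth ls k < nth ls (suc k)) (sym (layout-lengths sh zs len)) lt)))
        (words-length (sum sh)))
      (ΣL-zero (words (sum sh))))

    countBelow-∷ʳ-[] : ∀ T c v → countBelow (T ++ [] ∷ []) c v ≡ countBelow T c v
    countBelow-∷ʳ-[] []      c v = refl
    countBelow-∷ʳ-[] (r ∷ T) c v = trans (countBelow-∷ r (T ++ [] ∷ []) c v)
      (trans (cong (cellBelow (at r c) v +_) (countBelow-∷ʳ-[] T c v)) (sym (countBelow-∷ r T c v)))

    cq-∷ʳ-[] : ∀ T → cq q (T ++ [] ∷ []) ≡ cq q T
    cq-∷ʳ-[] []      = refl
    cq-∷ʳ-[] (r ∷ T) = cong₂ _*_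
      (rowFactor-cong q (r ∷ T ++ [] ∷ []) (r ∷ T) (λ c {v} _ → countBelow-∷ʳ-[] (r ∷ T) c v) 0
        (All.universal (λ _ → tt) (drop 1 r)))
      (cq-∷ʳ-[] T)

    layout-∷ʳ-0 : ∀ sh zs → layout (sh ++ 0 ∷ []) zs ≡ layout sh zs ++ [] ∷ []
    layout-∷ʳ-0 []       zs = refl
    layout-∷ʳ-0 (l ∷ sh) zs = cong (take l zs ∷_) (layout-∷ʳ-0 sh (drop l zs))

    b-∷ʳ-0 : ∀ sh → b (sh ++ 0 ∷ []) q ≡ b sh q
    b-∷ʳ-0 sh = begin
      b (sh ++ 0 ∷ []) q                                                        ≡⟨ b-unfold (sh ++ 0 ∷ []) ⟩
      ΣL (standardWeight ∘ layout (sh ++ 0 ∷ [])) (words (sum (sh ++ 0 ∷ [])))  ≡⟨ cong (ΣL (standardWeight ∘ layout (sh ++ 0 ∷ [])) ∘ words) (trans (sum-++ sh (0 ∷ [])) (+-identityʳ (sum sh))) ⟩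
      ΣL (standardWeight ∘ layout (sh ++ 0 ∷ [])) (words (sum sh))              ≡⟨ ΣL-cong (λ zs → trans (cong standardWeight (layout-∷ʳ-0 sh zs)) (extend (layout sh zs))) (words (sum sh)) ⟩
      ΣL (standardWeight ∘ layout sh) (words (sum sh))                          ≡⟨ b-unfold sh ⟨
      b sh q                                                                    ∎
      where
      open ≡-Reasoning
      extend : ∀ T → standardWeight (T ++ [] ∷ []) ≡ standardWeight T
      extend T = cong₂ (if_then_else 0) (isStandard-∷ʳ-[] T) (cq-∷ʳ-[] T)

  -- Conjugate partitions

  nth-≤-head0 : ∀ {μ} → Linked _≥_ μ → ∀ j → nth μ j ≤ head0 μ
  nth-≤-head0 {[]}    _    j       = z≤n
  nth-≤-head0 {_ ∷ _} desc zero    = ≤-refl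
  nth-≤-head0 {_ ∷ _} desc (suc j) = ≤-trans (nth-antitone desc j) (nth-≤-head0 desc j)

  -- With its converse below, this is the transposition of cells: (j, i) lies in the diagram of `μ`
  -- exactly when (i, j) lies in that of the conjugate.
  <nth⇒<countGe : ∀ {μ} → Linked _≥_ μ → ∀ {i} j → i < nth μ j → j < countGe (suc i) μ
  <nth⇒<countGe {x ∷ μ} desc zero    i< rewrite <ᵇ-false i< = z<s
  <nth⇒<countGe {x ∷ μ} desc (suc j) i<
    rewrite <ᵇ-false (<-≤-trans i< (nth-≤-head0 desc (suc j))) = s<s (<nth⇒<countGe (tail desc) j i<)

  <countGe⇒<nth : ∀ {μ} → Linked _≥_ μ → ∀ {i} j → j < countGe (suc i) μ → i < nth μ j
  <countGe⇒<nth {x ∷ μ} desc {i} j j< with x <? suc i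
  ... | yes x≤i rewrite <ᵇ-true x≤i =
    ⊥-elim (<⇒≱ (<countGe⇒<nth (tail desc) j j<) (≤-trans (nth-≤-head0 desc (suc j)) (s≤s⁻¹ x≤i)))
  ... | no x>i with j
  ...   | zero  = ≮⇒≥ x>i
  ...   | suc j rewrite <ᵇ-false (≮⇒≥ x>i) = <countGe⇒<nth (tail desc) j (s<s⁻¹ j<)

  countGe-antitone : ∀ i μ → countGe (suc i) μ ≤ countGe i μ
  countGe-antitone i []      = z≤n
  countGe-antitone i (x ∷ μ) with x <? i
  ... | yes x<i rewrite <ᵇ-true x<i | <ᵇ-true (m<n⇒m<1+n x<i) = countGe-antitone i μ
  ... | no x≮i rewrite <ᵇ-false (≮⇒≥ x≮i) = +-mono-≤ (if≤1 (x <ᵇ suc i)) (countGe-antitone i μ)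
    where
    if≤1 : ∀ c → (if c then 0 else 1) ≤ 1
    if≤1 true  = z≤n
    if≤1 false = ≤-refl

  countGe-decAt : ∀ {i} j μ → nth μ j ≡ suc i →
    countGe (suc i) μ ≡ suc (countGe (suc i) (decAt j μ))
  countGe-decAt {i} zero (.(suc i) ∷ μ) refl
    rewrite <ᵇ-false (≤-refl {suc i}) | <ᵇ-true (n<1+n i) = refl
  countGe-decAt {i} (suc j) (x ∷ μ) eq =
    trans (cong ((if x <ᵇ suc i then 0 else 1) +_) (countGe-decAt j μ eq)) (+-suc (if x <ᵇ suc i then 0 else 1) _)

  countGe-decAt-≢ : ∀ {i k} j μ → nth μ j ≡ suc i → i ≢ k →
    countGe (suc k) μ ≡ countGe (suc k) (decAt j μ)
  countGe-decAt-≢ {i} {k} zero (.(suc i) ∷ μ) refl i≢k with i <? k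
  ... | yes i<k rewrite <ᵇ-true (s<s i<k) | <ᵇ-true (m<n⇒m<1+n i<k) = refl
  ... | no i≮k rewrite <ᵇ-false (s≤s (≮⇒≥ i≮k)) | <ᵇ-false (≤∧≢⇒< (≮⇒≥ i≮k) (i≢k ∘ sym)) = refl
  countGe-decAt-≢ {k = k} (suc j) (x ∷ μ) eq i≢k =
    cong ((if x <ᵇ suc k then 0 else 1) +_) (countGe-decAt-≢ j μ eq i≢k)

  -- Evaluates the q-integer in `cellWeight`. The rows longer than `j` are the first `m`, where `m`
  -- is the length of column `j`, so `m ∸ i` of them lie at or below row `i`.
  countGe-drop : ∀ {j i m} M (f : ℕ → ℕ) → i ≤ m → m ≤ M →
    (∀ k → k < m → j < f k) → (∀ k → m ≤ k → f k ≤ j) →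
    countGe (suc j) (drop i (applyUpTo f M)) ≡ m ∸ i
  countGe-drop zero f z≤n z≤n lt ge = refl
  countGe-drop {m = zero}  (suc M) f z≤n z≤n lt ge
    rewrite <ᵇ-true (s≤s (ge 0 z≤n)) = countGe-drop M (f ∘ suc) z≤n z≤n (λ _ ()) (λ k _ → ge (suc k) z≤n)
  countGe-drop {m = suc m} (suc M) f z≤n (s≤s m≤M) lt ge
    rewrite <ᵇ-false (lt 0 z<s) =
    cong suc (countGe-drop M (f ∘ suc) z≤n m≤M (λ k p → lt (suc k) (s<s p)) (λ k p → ge (suc k) (s≤s p)))
  countGe-drop (suc M) f (s≤s i≤m) (s≤s m≤M) lt ge =
    countGe-drop M (f ∘ suc) i≤m m≤M (λ k p → lt (suc k) (s<s p)) (λ k p → ge (suc k) (s≤s p))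

  decAt-Linked : ∀ j {μ} → Linked _≥_ μ → nth μ (suc j) ≤ pred (nth μ j) → Linked _≥_ (decAt j μ)
  decAt-Linked j             []       _  = []
  decAt-Linked zero          [-]      _  = [-]
  decAt-Linked (suc j)       [-]      _  = [-]
  decAt-Linked zero          (p ∷ ps) le = le ∷ ps
  decAt-Linked (suc zero)    {x ∷ y ∷ []}     (p ∷ ps) le = ≤-trans pred[n]≤n p ∷ [-]
  decAt-Linked (suc zero)    {x ∷ y ∷ z ∷ μ}  (p ∷ ps) le = ≤-trans pred[n]≤n p ∷ decAt-Linked zero ps le
  decAt-Linked (suc (suc j)) (p ∷ ps) le = p ∷ decAt-Linked (suc j) ps le

  nth-applyUpTo : ∀ (f : ℕ → ℕ) {M i} → i < M → nth (applyUpTo f M) i ≡ f i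
  nth-applyUpTo f {suc M} {zero}  _        = refl
  nth-applyUpTo f {suc M} {suc i} (s≤s i<) = nth-applyUpTo (f ∘ suc) i<

  decAt-applyUpTo : ∀ (f g : ℕ → ℕ) M i → g i ≡ pred (f i) → (∀ k → i ≢ k → f k ≡ g k) →
    decAt i (applyUpTo f M) ≡ applyUpTo g M
  decAt-applyUpTo f g zero    i       eq h = refl
  decAt-applyUpTo f g (suc M) zero    eq h = cong₂ _∷_ (sym eq) (applyUpTo-cong M (λ k → h (suc k) (λ ())))
    where
    applyUpTo-cong : ∀ {f g : ℕ → ℕ} M → (∀ k → f k ≡ g k) → applyUpTo f M ≡ applyUpTo g M
    applyUpTo-cong zero    h = refl
    applyUpTo-cong (suc M) h = cong₂ _∷_ (h 0) (applyUpTo-cong M (h ∘ suc))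
  decAt-applyUpTo f g (suc M) (suc i) eq h = cong₂ _∷_ (h 0 (λ ()))
    (decAt-applyUpTo (f ∘ suc) (g ∘ suc) M i eq (λ k ne → h (suc k) (ne ∘ suc-injective)))

  -- The conjugate with a fixed number of rows, empty ones allowed. Lowering the first part of `μ`
  -- removes a row from `conj μ`, whereas `decAt` on the shape only empties it; `b-rows` reconciles
  -- the two.
  rows : ℕ → List ℕ → List ℕ
  rows M μ = applyUpTo (λ i → countGe (suc i) μ) M

  rows-Linked : ∀ M μ → Linked _≥_ (rows M μ)
  rows-Linked M μ = Linked.applyUpTo⁺₂ _ M (λ i → countGe-antitone (suc i) μ)

  conj≡rows : ∀ μ → conj μ ≡ rows (head0 μ) μ
  conj≡rows μ = map-upTo (λ i → countGe (suc i) μ) (head0 μ)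

  countGe-large : ∀ {i} μ → Linked _≥_ μ → head0 μ < i → countGe i μ ≡ 0
  countGe-large []      desc lt = refl
  countGe-large {i} (x ∷ μ) desc lt rewrite <ᵇ-true lt =
    countGe-large μ (tail desc) (≤-<-trans (head-tail desc) lt)
    where
    head-tail : ∀ {x μ} → Linked _≥_ (x ∷ μ) → head0 μ ≤ x
    head-tail [-]     = z≤n
    head-tail (p ∷ _) = p

  head0≤sum : ∀ μ → head0 μ ≤ sum μ
  head0≤sum []      = z≤n
  head0≤sum (x ∷ μ) = m≤m+n x (sum μ)

  head0-decAt : ∀ j μ → head0 (decAt j μ) ≤ head0 μ
  head0-decAt j       []      = z≤n
  head0-decAt zero    (x ∷ μ) = pred[n]≤n
  head0-decAt (suc j) (x ∷ μ) = ≤-refl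

  b-rows : ∀ q {μ} → Linked _≥_ μ → ∀ {M} → head0 μ ≤ M → b (rows M μ) q ≡ b (conj μ) q
  b-rows q {μ} desc {M} le with m≤n⇒∃[o]m+o≡n le
  ... | d , refl = go d
    where
    open Tableaux q
    go : ∀ d → b (rows (head0 μ + d) μ) q ≡ b (conj μ) q
    go zero    = cong (λ r → b r q) (trans (cong (λ k → rows k μ) (+-identityʳ (head0 μ))) (sym (conj≡rows μ)))
    go (suc d) = begin
      b (rows (head0 μ + suc d) μ) q ≡⟨ cong (λ k → b (rows k μ) q) (+-suc (head0 μ) d) ⟩
      b (rows (suc M′) μ) q          ≡⟨ cong (λ r → b r q) (applyUpTo-∷ʳ (λ i → countGe (suc i) μ) M′) ⟨
      b (rows M′ μ ++ countGe (suc M′) μ ∷ []) q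
        ≡⟨ cong (λ k → b (rows M′ μ ++ k ∷ []) q) (countGe-large μ desc (s≤s (m≤m+n (head0 μ) d))) ⟩
      b (rows M′ μ ++ 0 ∷ []) q      ≡⟨ b-∷ʳ-0 (rows M′ μ) ⟩
      b (rows M′ μ) q                ≡⟨ go d ⟩
      b (conj μ) q                   ∎
      where
      open ≡-Reasoning
      M′ = head0 μ + d

  -- The recursion satisfied by the formula

  -- The number of subspaces over a fixed U of profile `decAt j μ` that acquire e₀ in passing from
  -- step `j` to step `suc j`. The value `i` is the lowered part; the part before it is the same as
  -- in `μ`.
  stepWeight : ℕ → ℕ → ℕ → List ℕ → ℕ
  stepWeight q i zero    μ = 1
  stepWeight q i (suc j) μ = q ^ nth μ j ∸ q ^ i

  cellCount : ℕ → ℕ → List ℕ → ℕ → ℕ → ℕ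
  cellCount q n μ i j =
    if does (nth μ j ≟ suc i) then sigmaFormula q n (decAt j μ) * stepWeight q i j μ else 0

  -- Row i of conj μ ends in column j (both counted from 0); it contributes when
  -- that cell is a corner, that is, when column j has length i + 1.
  rowCount : ℕ → ℕ → List ℕ → ℕ → ℕ
  rowCount q n μ i = cellCount q n μ i (pred (countGe (suc i) μ))

  module _ (q n : ℕ) (μ : List ℕ) {i j : ℕ} (l≡ : countGe (suc i) μ ≡ suc j) where

    rowCount-corner : nth μ j ≡ suc i →
      rowCount q n μ i ≡ sigmaFormula q n (decAt j μ) * stepWeight q i j μ
    rowCount-corner m≡ = trans (cong (cellCount q n μ i ∘ pred) l≡)
      (cong (if_then sigmaFormula q n (decAt j μ) * stepWeight q i j μ else 0) (dec-true (nth μ j ≟ suc i) m≡))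

    rowCount-noncorner : nth μ j ≢ suc i → rowCount q n μ i ≡ 0
    rowCount-noncorner m≢ = trans (cong (cellCount q n μ i ∘ pred) l≡)
      (cong (if_then sigmaFormula q n (decAt j μ) * stepWeight q i j μ else 0) (dec-false (nth μ j ≟ suc i) m≢))

  qint-suc : ∀ q a → qint q (suc a) ≡ qint q a + q ^ a
  qint-suc q a = trans (cong (ΣL (q ^_)) (sym (upTo-∷ʳ a)))
    (trans (ΣL-++ (q ^_) (upTo a) (a ∷ [])) (cong (qint q a +_) (+-identityʳ (q ^ a))))

  geometric : ∀ p a → suc (p * qint (suc p) a) ≡ suc p ^ a
  geometric p zero    = cong suc (*-zeroʳ p)
  geometric p (suc a) = begin
    suc (p * qint (suc p) (suc a))           ≡⟨ cong (λ k → suc (p * k)) (qint-suc (suc p) a) ⟩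
    suc (p * (qint (suc p) a + suc p ^ a))   ≡⟨ cong suc (*-distribˡ-+ p (qint (suc p) a) _) ⟩
    suc (p * qint (suc p) a) + p * suc p ^ a ≡⟨ cong (_+ p * suc p ^ a) (geometric p a) ⟩
    suc p ^ suc a                            ∎
    where open ≡-Reasoning

  ^-∸-^ : ∀ p {i m} → i ≤ m → suc p ^ m ∸ suc p ^ i ≡ suc p ^ i * (p * qint (suc p) (m ∸ i))
  ^-∸-^ p {i} {m} i≤m = begin
    q ^ m ∸ q ^ i                              ≡⟨ cong (λ k → q ^ k ∸ q ^ i) (m+[n∸m]≡n i≤m) ⟨
    q ^ (i + (m ∸ i)) ∸ q ^ i                  ≡⟨ cong (_∸ q ^ i) (^-distribˡ-+-* q i (m ∸ i)) ⟩
    q ^ i * q ^ (m ∸ i) ∸ q ^ i                ≡⟨ cong (λ k → q ^ i * k ∸ q ^ i) (geometric p (m ∸ i)) ⟨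
    q ^ i * suc (p * qint q (m ∸ i)) ∸ q ^ i   ≡⟨ cong (_∸ q ^ i) (*-suc (q ^ i) _) ⟩
    q ^ i + q ^ i * (p * qint q (m ∸ i)) ∸ q ^ i ≡⟨ m+n∸m≡n (q ^ i) _ ⟩
    q ^ i * (p * qint q (m ∸ i))               ∎
    where
    open ≡-Reasoning
    q = suc p

  sum-C2-decAt : ∀ {i} j μ → nth μ j ≡ suc i →
    sum (map (_C 2) μ) ≡ i + sum (map (_C 2) (decAt j μ))
  sum-C2-decAt {i} zero (.(suc i) ∷ μ) refl = begin
    suc i C 2 + s       ≡⟨ cong (_+ s) (nCk+nC[k+1]≡[n+1]C[k+1] i 1) ⟨
    i C 1 + i C 2 + s   ≡⟨ cong (λ k → k + i C 2 + s) (nC1≡n i) ⟩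
    i + i C 2 + s       ≡⟨ +-assoc i (i C 2) s ⟩
    i + (i C 2 + s)     ∎
    where
    open ≡-Reasoning
    s = sum (map (_C 2) μ)
  sum-C2-decAt {i} (suc j) (x ∷ μ) eq = trans (cong (x C 2 +_) (sum-C2-decAt j μ eq)) (lem (x C 2) i _)
    where
    lem : ∀ x i s → x + (i + s) ≡ i + (x + s)
    lem = solve-∀

  prefactor : ℕ → List ℕ → ℕ
  prefactor q μ = (q ∸ 1) ^ sum (drop 1 μ) * q ^ sum (map (_C 2) (drop 1 μ))

  -- The step weight is `q^i (q - 1) [m - i]`, with `m` the preceding part. Its first two factors
  -- restore the prefactor of `μ`: `sum-C2-decAt` supplies the exponent `i`, and the exponent of
  -- `q - 1` rises by one.
  prefactor-decAt : ∀ p {i} j μ → nth μ (suc j) ≡ suc i → i ≤ nth μ j →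
    prefactor (suc p) (decAt (suc j) μ) * stepWeight (suc p) i (suc j) μ ≡
    prefactor (suc p) μ * qint (suc p) (nth μ j ∸ i)
  prefactor-decAt p {i} j (x ∷ μ) eq i≤m = begin
    p ^ A * q ^ Q * (q ^ m ∸ q ^ i)                ≡⟨ cong (p ^ A * q ^ Q *_) (^-∸-^ p i≤m) ⟩
    p ^ A * q ^ Q * (q ^ i * (p * qint q (m ∸ i))) ≡⟨ lem (p ^ A) (q ^ Q) (q ^ i) p _ ⟩
    p ^ suc A * (q ^ i * q ^ Q) * qint q (m ∸ i)   ≡⟨ cong (λ k → p ^ suc A * k * qint q (m ∸ i)) (^-distribˡ-+-* q i Q) ⟨
    p ^ suc A * q ^ (i + Q) * qint q (m ∸ i)       ≡⟨ cong₂ (λ u v → p ^ u * q ^ v * qint q (m ∸ i)) (sum-decAt j μ eq) (sum-C2-decAt j μ eq) ⟨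
    p ^ sum μ * q ^ sum (map (_C 2) μ) * qint q (m ∸ i) ∎
    where
    open ≡-Reasoning
    q = suc p
    m = nth (x ∷ μ) j
    A = sum (decAt j μ)
    Q = sum (map (_C 2) (decAt j μ))
    lem : ∀ a b c p x → a * b * (c * (p * x)) ≡ p * a * (c * b) * x
    lem = solve-∀

  module _ {μ : List ℕ} (desc : Linked _≥_ μ) where

    corner-≤ : ∀ {i j} → countGe (suc i) μ ≡ suc j → nth μ j ≡ suc i → nth μ (suc j) ≤ i
    corner-≤ {i} {j} l≡ _ = ≮⇒≥ (λ i< → <-irrefl (sym l≡) (<nth⇒<countGe desc (suc j) i<))

    corner-row : ∀ {i} j → nth μ j ≡ suc i → nth μ (suc j) ≤ i → countGe (suc i) μ ≡ suc j
    corner-row {i} j m≡ le = ≤-antisym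
      (≮⇒≥ (λ lt → <⇒≱ (<countGe⇒<nth desc (suc j) lt) le))
      (<nth⇒<countGe desc j (≤-reflexive (sym m≡)))

    row-nonempty : ∀ {i} → i < head0 μ → ∃ λ j → countGe (suc i) μ ≡ suc j
    row-nonempty {i} i<M with countGe (suc i) μ | <nth⇒<countGe desc 0 (subst (i <_) (head0≡nth μ) i<M)
      where
      head0≡nth : ∀ μ → head0 μ ≡ nth μ 0
      head0≡nth []      = refl
      head0≡nth (x ∷ μ) = refl
    ... | suc j | _ = j , refl

    module _ {i j : ℕ} (l≡ : countGe (suc i) μ ≡ suc j) (m≡ : nth μ j ≡ suc i) where

      decAt-corner-Linked : Linked _≥_ (decAt j μ)
      decAt-corner-Linked = decAt-Linked j desc (subst (λ k → nth μ (suc j) ≤ pred k) (sym m≡) (corner-≤ l≡ m≡))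

      decAt-rows : ∀ M → decAt i (rows M μ) ≡ rows M (decAt j μ)
      decAt-rows M = decAt-applyUpTo _ _ M i (sym (cong pred (countGe-decAt j μ m≡))) (λ k → countGe-decAt-≢ j μ m≡)

      b-decAt-conj : ∀ q → b (decAt i (conj μ)) q ≡ b (conj (decAt j μ)) q
      b-decAt-conj q = trans
        (cong (λ r → b r q) (trans (cong (decAt i) (conj≡rows μ)) (decAt-rows (head0 μ))))
        (b-rows q decAt-corner-Linked (head0-decAt j μ))

    -- Here the two recursions meet: the number of subspaces over U on the left, the weight of the
    -- removed tableau cell on the right.
    prefactor-corner : ∀ p {i} j → countGe (suc i) μ ≡ suc j → nth μ j ≡ suc i →
      prefactor (suc p) (decAt j μ) * stepWeight (suc p) i j μ ≡
      prefactor (suc p) μ * cellWeight (suc p) i (decAt i (conj μ))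
    prefactor-corner p {i} j l≡ m≡ = trans (go j l≡ m≡) (cong (prefactor (suc p) μ *_) (sym cell))
      where
      M = head0 μ
      ν = decAt j μ
      i<M : i < M
      i<M = subst (_≤ M) m≡ (nth-≤-head0 desc j)
      νᵢ≡j : countGe (suc i) ν ≡ j
      νᵢ≡j = suc-injective (trans (sym (countGe-decAt j μ m≡)) l≡)
      cell : cellWeight (suc p) i (decAt i (conj μ)) ≡ weight (suc p) j (drop i (rows M ν))
      cell = trans
        (cong (cellWeight (suc p) i) (trans (cong (decAt i) (conj≡rows μ)) (decAt-rows l≡ m≡ M)))
        (cong (λ k → weight (suc p) k (drop i (rows M ν)))
          (trans (nth-applyUpTo (λ k → countGe (suc k) ν) i<M) νᵢ≡j))
      go : ∀ j → countGe (suc i) μ ≡ suc j → nth μ j ≡ suc i →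
        prefactor (suc p) (decAt j μ) * stepWeight (suc p) i j μ ≡
        prefactor (suc p) μ * weight (suc p) j (drop i (rows M (decAt j μ)))
      -- The prefactor ignores the first part of `μ`, and both weights are 1 in the first column.
      go zero    l≡ m≡ = cong (_* 1) (prefactor-head μ)
        where
        prefactor-head : ∀ μ → prefactor (suc p) (decAt 0 μ) ≡ prefactor (suc p) μ
        prefactor-head []      = refl
        prefactor-head (x ∷ μ) = refl
      go (suc j) l≡ m≡ = trans (prefactor-decAt p j μ m≡ i≤m)
        (cong (λ k → prefactor (suc p) μ * qint (suc p) k) (sym (trans
          (countGe-drop M (λ k → countGe (suc k) ν′) (subst (i ≤_) (sym m′≡m) i≤m)
            (subst (_≤ M) (sym m′≡m) (nth-≤-head0 desc j))
            (λ k → <nth⇒<countGe desc′ j)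
            (λ k le → ≮⇒≥ (λ lt → <⇒≱ (<countGe⇒<nth desc′ j lt) le)))
          (cong (_∸ i) m′≡m))))
        where
        ν′ = decAt (suc j) μ
        desc′ = decAt-corner-Linked l≡ m≡
        i≤m : i ≤ nth μ j
        i≤m = ≤-trans (n≤1+n i) (subst (_≤ nth μ j) m≡ (nth-antitone desc j))
        m′≡m : nth ν′ j ≡ nth μ j
        m′≡m = nth-decAt-≢ (suc j) j μ 1+n≢n

    -- Pascal's rule splits the binomial coefficient. One summand is the formula for `n`; in the
    -- other, `b-rec` expands `b (conj μ)`, and `prefactor-corner` turns each corner into its
    -- `rowCount`.
    sigmaFormula-suc : ∀ p n →
      sigmaFormula (suc p) (suc n) μ ≡ sigmaFormula (suc p) n μ + ∑ (head0 μ) (rowCount (suc p) n μ)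
    sigmaFormula-suc p n with sum μ in eq
    -- The empty diagram has no largest letter to remove; here `head0 μ` is 0 and the sum on the
    -- right is empty.
    ... | zero  = sym (trans (cong (λ M → sigmaFormula-0 + ∑ M (rowCount (suc p) n μ))
                    (n≤0⇒n≡0 (subst (head0 μ ≤_) eq (head0≤sum μ)))) (+-identityʳ sigmaFormula-0))
      where sigmaFormula-0 = 1 * ((suc p ∸ 1) ^ sum (drop 1 μ)) * (suc p ^ sum (map (_C 2) (drop 1 μ))) * b (conj μ) (suc p)
    ... | suc N = begin
      (suc n C suc N) * P * Q * B               ≡⟨ cong (λ k → k * P * Q * B) (nCk+nC[k+1]≡[n+1]C[k+1] n N) ⟨
      (n C N + n C suc N) * P * Q * B           ≡⟨ lem (n C N) (n C suc N) P Q B ⟩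
      (n C suc N) * P * Q * B + (n C N) * (P * Q) * B ≡⟨ cong (((n C suc N) * P * Q * B) +_) expand ⟩
      (n C suc N) * P * Q * B + ∑ M (rowCount q n μ) ∎
      where
      open ≡-Reasoning
      open Tableaux (suc p)
      q = suc p
      M = head0 μ
      P = (q ∸ 1) ^ sum (drop 1 μ)
      Q = q ^ sum (map (_C 2) (drop 1 μ))
      B = b (conj μ) q
      lem : ∀ x y P Q B → (x + y) * P * Q * B ≡ y * P * Q * B + x * (P * Q) * B
      lem = solve-∀
      conj-Linked : Linked _≥_ (conj μ)
      conj-Linked = subst (Linked _≥_) (sym (conj≡rows μ)) (rows-Linked M μ)
      nth-conj : ∀ {i} → i < M → nth (conj μ) i ≡ countGe (suc i) μ
      nth-conj {i} i<M = trans (cong (λ r → nth r i) (conj≡rows μ)) (nth-applyUpTo (λ k → countGe (suc k) μ) i<M)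
      length-conj : length (conj μ) ≡ M
      length-conj = trans (cong length (conj≡rows μ)) (length-applyUpTo _ M)
      M>0 : 0 < M
      M>0 = positive μ desc (subst (0 <_) (sym eq) z<s)
        where
        positive : ∀ μ → Linked _≥_ μ → 0 < sum μ → 0 < head0 μ
        positive (suc x ∷ μ)    _       _  = z<s
        positive (zero ∷ zero ∷ μ) (_ ∷ d) lt = positive (0 ∷ μ) d lt
      sum-conj>0 : ∃ λ K → sum (conj μ) ≡ suc K
      sum-conj>0 with sum (conj μ) in e
      ... | suc K = K , refl
      ... | zero  = ⊥-elim (0≢1+n (trans (sym (nth-sum≡0 (conj μ) e 0)) (trans (nth-conj M>0) (proj₂ (row-nonempty M>0)))))
      row : ∀ i → i < M →
        (n C N) * (P * Q) * ifPos (nth (conj μ) i) (cellWeight q i (decAt i (conj μ)) * b (decAt i (conj μ)) q)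
        ≡ rowCount q n μ i
      row i i<M with row-nonempty i<M
      ... | j , l≡ with nth μ j ≟ suc i
      ...   | yes m≡ = begin
        c * ifPos (nth (conj μ) i) (w * b (decAt i (conj μ)) q)
          ≡⟨ cong₂ (λ l z → c * ifPos l (w * z)) (trans (nth-conj i<M) l≡) (b-decAt-conj l≡ m≡ q) ⟩
        (n C N) * (P * Q) * (w * b (conj ν) q)
          ≡⟨ cong (λ k → (n C k) * (P * Q) * (w * b (conj ν) q)) (suc-injective (trans (sym eq) (sum-decAt j μ m≡))) ⟩
        (n C sum ν) * (P * Q) * (w * b (conj ν) q)       ≡⟨ lem₁ (n C sum ν) (P * Q) w (b (conj ν) q) ⟩
        (n C sum ν) * (P * Q * w) * b (conj ν) q         ≡⟨ cong (λ k → (n C sum ν) * k * b (conj ν) q) (prefactor-corner p j l≡ m≡) ⟨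
        (n C sum ν) * (prefactor q ν * s) * b (conj ν) q ≡⟨ lem₂ (n C sum ν) ((q ∸ 1) ^ sum (drop 1 ν)) (q ^ sum (map (_C 2) (drop 1 ν))) s (b (conj ν) q) ⟩
        sigmaFormula q n ν * s                         ≡⟨ rowCount-corner q n μ l≡ m≡ ⟨
        rowCount q n μ i                               ∎
        where
        ν = decAt j μ
        s = stepWeight q i j μ
        w = cellWeight q i (decAt i (conj μ))
        c = (n C N) * (P * Q)
        lem₁ : ∀ a k w z → a * k * (w * z) ≡ a * (k * w) * z
        lem₁ = solve-∀
        lem₂ : ∀ a x y s z → a * (x * y * s) * z ≡ a * x * y * z * s
        lem₂ = solve-∀
      -- Column `j` continues below row `i`, so the shortened row is shorter than the next one, and
      -- `b` vanishes there.
      ...   | no m≢ = begin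
        c * ifPos (nth (conj μ) i) (w * b (decAt i (conj μ)) q)
          ≡⟨ cong₂ (λ l z → c * ifPos l (w * z)) (trans (nth-conj i<M) l≡) (b-ascent i (decAt i (conj μ)) ascent) ⟩
        c * (w * 0)      ≡⟨ cong (c *_) (*-zeroʳ w) ⟩
        c * 0            ≡⟨ *-zeroʳ c ⟩
        0                ≡⟨ rowCount-noncorner q n μ l≡ m≢ ⟨
        rowCount q n μ i ∎
        where
        w = cellWeight q i (decAt i (conj μ))
        c = (n C N) * (P * Q)
        1+i<m : suc i < nth μ j
        1+i<m = ≤∧≢⇒< (<countGe⇒<nth desc j (≤-reflexive (sym l≡))) (m≢ ∘ sym)
        ascent : nth (decAt i (conj μ)) i < nth (decAt i (conj μ)) (suc i)
        ascent = subst₂ _<_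
          (sym (trans (nth-decAt i (conj μ)) (cong pred (trans (nth-conj i<M) l≡))))
          (sym (trans (nth-decAt-≢ i (suc i) (conj μ) (1+n≢n ∘ sym)) (nth-conj (<-≤-trans 1+i<m (nth-≤-head0 desc j)))))
          (<nth⇒<countGe desc j 1+i<m)
      expand : (n C N) * (P * Q) * B ≡ ∑ M (rowCount q n μ)
      expand = begin
        (n C N) * (P * Q) * B
          ≡⟨ cong ((n C N) * (P * Q) *_) (b-rec conj-Linked (proj₂ sum-conj>0)) ⟩
        (n C N) * (P * Q) * ∑ (length (conj μ)) term
          ≡⟨ cong (λ k → (n C N) * (P * Q) * ∑ k term) length-conj ⟩
        (n C N) * (P * Q) * ∑ M term
          ≡⟨ ∑-*ˡ ((n C N) * (P * Q)) M term ⟩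
        ∑ M (λ i → (n C N) * (P * Q) * term i)
          ≡⟨ ∑-cong M row ⟩
        ∑ M (rowCount q n μ) ∎
        where
        term : ℕ → ℕ
        term i = ifPos (nth (conj μ) i) (cellWeight q i (decAt i (conj μ)) * b (decAt i (conj μ)) q)

    sigmaFormula-rec : ∀ {q} → 0 < q → ∀ n →
      sigmaFormula q (suc n) μ ≡ sigmaFormula q n μ + ∑ (head0 μ) (rowCount q n μ)
    sigmaFormula-rec {suc p} _ = sigmaFormula-suc p

  sum-C2-zero : ∀ μ → sum μ ≡ 0 → sum (map (_C 2) μ) ≡ 0
  sum-C2-zero []         _ = refl
  sum-C2-zero (zero ∷ μ) e = sum-C2-zero μ e

  sigmaFormula-0-zero : ∀ q μ → sum μ ≡ 0 → sigmaFormula q 0 μ ≡ 1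
  sigmaFormula-0-zero q []         e = refl
  sigmaFormula-0-zero q (zero ∷ μ) e rewrite e | sum-C2-zero μ e = refl

  sigmaFormula-0-suc : ∀ q μ {N} → sum μ ≡ suc N → sigmaFormula q 0 μ ≡ 0
  sigmaFormula-0-suc q μ e rewrite e = refl

  nth>0⇒<length : ∀ μ {i j} → nth μ j ≡ suc i → j < length μ
  nth>0⇒<length (x ∷ μ) {j = zero}  e = z<s
  nth>0⇒<length (x ∷ μ) {j = suc j} e = s<s (nth>0⇒<length μ e)

  nth-length : ∀ μ → nth μ (length μ) ≡ 0
  nth-length []      = refl
  nth-length (x ∷ μ) = nth-length μ

open TableauSums

-- Counting up to an equivalence relation

module SetoidCounting where

  open import Data.Nat using (ℕ; zero; suc; _+_; _*_; _∸_; _≤_; _<_; z≤n; s≤s; z<s; s<s)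
  open import Data.Nat.Properties
  open import Data.Fin as Fin using (Fin)
  open import Data.Fin.Properties using (injective⇒≤)
  open import Data.List using (List; []; _∷_; _++_; map; length; lookup)
  open import Data.List.Properties using (length-++; length-map)
  open import Data.List.Relation.Unary.Any as Any using (Any; here; there; index)
  open import Data.List.Relation.Unary.AllPairs as AllPairs using (AllPairs; []; _∷_)
  open import Data.Product using (∃; _×_; _,_; proj₁; proj₂)
  open import Function using (_∘_; _⇔_; mk⇔; Equivalence)
  open import Relation.Nullary using (¬_; Dec; yes; no; ¬?)
  open import Relation.Binary.PropositionalEquality

  module Counting (S : Setoid 0ℓ 0ℓ) where

    open Setoid S renaming (Carrier to A; refl to ≈-refl; sym to ≈-sym; trans to ≈-trans)

    -- Over the setoid of Boolean subsets this unfolds to `Counts`. A general setoid lets the same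
    -- tools count vectors, which parametrize the subspaces over U.
    Counted : (A → Set) → ℕ → Set
    Counted P s = ∃ λ (L : List A) →
      length L ≡ s ×
      AllPairs (λ x y → ¬ (x ≈ y)) L ×
      (∀ x → P x ⇔ Any (x ≈_) L)

    private variable
      P Q : A → Set
      s t : ℕ

    Counted-cong : Counted P s → (∀ x → P x → Q x) → (∀ x → Q x → P x) → Counted Q s
    Counted-cong (L , len , distinct , iff) f g =
      L , len , distinct , λ x → mk⇔ (Equivalence.to (iff x) ∘ g x) (f x ∘ Equivalence.from (iff x))

    Counted-resp : Counted P s → ∀ {x y} → x ≈ y → P x → P y
    Counted-resp (L , _ , _ , iff) {x} {y} x≈y px =
      Equivalence.from (iff y) (Any.map (≈-trans (≈-sym x≈y)) (Equivalence.to (iff x) px))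

    Counted-∅ : (∀ x → ¬ P x) → Counted P 0
    Counted-∅ h = [] , refl , [] , λ x → mk⇔ (⊥-elim ∘ h x) (λ ())

    Counted-All : ((L , _) : Counted P s) → All P L
    Counted-All (L , _ , _ , iff) = All.tabulate (λ {x} x∈ → Equivalence.from (iff x) (Any.map (λ { refl → ≈-refl }) x∈))

    Counted-⊎ : Counted P s → Counted Q t → (∀ x → P x → ¬ Q x) → Counted (λ x → P x ⊎ Q x) (s + t)
    Counted-⊎ {P} {s} {Q} cp@(L , len , distinct , iff) cq@(L′ , len′ , distinct′ , iff′) disj =
      L ++ L′ , trans (length-++ L) (cong₂ _+_ len len′) ,
      AllPairs.++⁺ distinct distinct′
        (All.map (λ px → All.map (λ qy x≈y → disj _ (Counted-resp cp x≈y px) qy) (Counted-All cq)) (Counted-All cp)) ,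
      λ x → mk⇔
        (λ { (inj₁ px) → Any.++⁺ˡ (Equivalence.to (iff x) px)
           ; (inj₂ qx) → Any.++⁺ʳ L (Equivalence.to (iff′ x) qx) })
        (λ m → split x (Any.++⁻ L m))
      where
      split : ∀ x → Any (x ≈_) L ⊎ Any (x ≈_) L′ → P x ⊎ Q x
      split x (inj₁ m) = inj₁ (Equivalence.from (iff x) m)
      split x (inj₂ m) = inj₂ (Equivalence.from (iff′ x) m)

    Counted-∑ : ∀ M (P : ℕ → A → Set) (f : ℕ → ℕ) → (∀ i → i < M → Counted (P i) (f i)) →
      (∀ i j x → i < M → j < M → P i x → P j x → i ≡ j) →
      Counted (λ x → ∃ λ i → i < M × P i x) (∑ M f)
    Counted-∑ zero    P f c disj = Counted-∅ (λ { x (i , () , _) })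
    Counted-∑ (suc M) P f c disj = Counted-cong
      (Counted-⊎ (c 0 z<s)
        (Counted-∑ M (P ∘ suc) (f ∘ suc) (λ i i< → c (suc i) (s<s i<))
          (λ i j x i< j< p p′ → suc-injective (disj (suc i) (suc j) x (s<s i<) (s<s j<) p p′)))
        (λ { x p (i , i< , p′) → 0≢1+n (disj 0 (suc i) x z<s (s<s i<) p p′) }))
      (λ { x (inj₁ p) → 0 , z<s , p ; x (inj₂ (i , i< , p)) → suc i , s<s i< , p })
      (λ { x (zero , _ , p) → inj₁ p ; x (suc i , s≤s i< , p) → inj₂ (i , i< , p) })

    lookup-injective : ∀ {L} → AllPairs (λ x y → ¬ (x ≈ y)) L → ∀ i j → lookup L i ≈ lookup L j → i ≡ j
    lookup-injective {_ ∷ _} (ps ∷ d) Fin.zero    Fin.zero    e = refl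
    lookup-injective {_ ∷ L} (ps ∷ d) Fin.zero    (Fin.suc j) e = ⊥-elim (All.lookupAny ps (lookup-any L j) .proj₁ e′)
      where
      lookup-any : ∀ L j → Any (_≡ lookup L j) L
      lookup-any (x ∷ L) Fin.zero    = here refl
      lookup-any (x ∷ L) (Fin.suc j) = there (lookup-any L j)
      e′ = subst (_ ≈_) (sym (All.lookupAny ps (lookup-any L j) .proj₂)) e
    lookup-injective {_ ∷ L} (ps ∷ d) (Fin.suc i) Fin.zero    e = sym (lookup-injective (ps ∷ d) Fin.zero (Fin.suc i) (≈-sym e))
    lookup-injective (ps ∷ d) (Fin.suc i) (Fin.suc j) e = cong Fin.suc (lookup-injective d i j e)

    Counted-≤ : Counted P s → Counted Q t → (∀ x → P x → Q x) → s ≤ t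
    Counted-≤ cp@(L , refl , distinct , iff) (L′ , refl , _ , iff′) P⊆Q = injective⇒≤ {f = pos} pos-injective
      where
      member : ∀ i → Any (lookup L i ≈_) L′
      member i = Equivalence.to (iff′ _) (P⊆Q _ (All.lookup (Counted-All cp) (∈-lookup i)))
        where open import Data.List.Membership.Propositional.Properties using (∈-lookup)
      pos : Fin (length L) → Fin (length L′)
      pos i = index (member i)
      pos-injective : ∀ {i j} → pos i ≡ pos j → i ≡ j
      pos-injective {i} {j} eq = lookup-injective distinct i j
        (≈-trans (Any.lookup-index (member i))
          (≈-sym (subst (λ k → lookup L j ≈ lookup L′ k) (sym eq) (Any.lookup-index (member j)))))

    Counted-unique : Counted P s → Counted P t → s ≡ t
    Counted-unique cp cp′ = ≤-antisym (Counted-≤ cp cp′ (λ _ p → p)) (Counted-≤ cp′ cp (λ _ p → p))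

    module _ {P Q : A → Set} where

      -- A filter whose predicate is decidable only on P.
      refine : (∀ {x} → P x → Dec (Q x)) → ∀ {L} → All P L → List A
      refine Q? []             = []
      refine Q? (_∷_ {x} p ps) with Q? p
      ... | yes _ = x ∷ refine Q? ps
      ... | no  _ = refine Q? ps

      refine-All : ∀ {R : A → Set} (Q? : ∀ {x} → P x → Dec (Q x)) {L} (ps : All P L) → All R L → All R (refine Q? ps)
      refine-All Q? []       []       = []
      refine-All Q? (p ∷ ps) (r ∷ rs) with Q? p
      ... | yes _ = r ∷ refine-All Q? ps rs
      ... | no  _ = refine-All Q? ps rs

      refine-AllPairs : (Q? : ∀ {x} → P x → Dec (Q x)) → ∀ {L} (ps : All P L) →
        AllPairs (λ x y → ¬ (x ≈ y)) L → AllPairs (λ x y → ¬ (x ≈ y)) (refine Q? ps)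
      refine-AllPairs Q? []       []       = []
      refine-AllPairs Q? (p ∷ ps) (d ∷ ds) with Q? p
      ... | yes _ = refine-All Q? ps d ∷ refine-AllPairs Q? ps ds
      ... | no  _ = refine-AllPairs Q? ps ds

      module _ (Q? : ∀ {x} → P x → Dec (Q x)) (resp : ∀ {x y} → x ≈ y → Q x → Q y) where

        refine⁺ : ∀ {x L} (ps : All P L) → Q x → Any (x ≈_) L → Any (x ≈_) (refine Q? ps)
        refine⁺ (p ∷ ps) q m with Q? p
        refine⁺ (p ∷ ps) q (here e)  | yes _ = here e
        refine⁺ (p ∷ ps) q (there m) | yes _ = there (refine⁺ ps q m)
        refine⁺ (p ∷ ps) q (here e)  | no ¬q = ⊥-elim (¬q (resp e q))
        refine⁺ (p ∷ ps) q (there m) | no _  = refine⁺ ps q m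

        refine⁻ : ∀ {x L} (ps : All P L) → Any (x ≈_) (refine Q? ps) → Any (x ≈_) L × Q x
        refine⁻ (p ∷ ps) m with Q? p
        refine⁻ (p ∷ ps) (here e)  | yes q = here e , resp (≈-sym e) q
        refine⁻ (p ∷ ps) (there m) | yes _ = let (m′ , q) = refine⁻ ps m in there m′ , q
        refine⁻ (p ∷ ps) m         | no _  = let (m′ , q) = refine⁻ ps m in there m′ , q

        Counted-refine : (cp : Counted P s) → Counted (λ x → P x × Q x) (length (refine Q? (Counted-All cp)))
        Counted-refine cp@(L , len , distinct , iff) =
          refine Q? ps , refl , refine-AllPairs Q? ps distinct , λ x → mk⇔
            (λ { (p , q) → refine⁺ ps q (Equivalence.to (iff x) p) })
            (λ m → let (m′ , q) = refine⁻ ps m in Equivalence.from (iff x) m′ , q)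
          where ps = Counted-All cp

    length-refine-¬ : ∀ {P Q : A → Set} (Q? : ∀ {x} → P x → Dec (Q x)) {L} (ps : All P L) →
      length (refine Q? ps) + length (refine (λ p → ¬? (Q? p)) ps) ≡ length L
    length-refine-¬ Q? []       = refl
    length-refine-¬ Q? (p ∷ ps) with Q? p
    ... | yes _ = cong suc (length-refine-¬ Q? ps)
    ... | no  _ = trans (+-suc _ _) (cong suc (length-refine-¬ Q? ps))

    -- `Q` is decided only on `P` because the search deciding whether e₀ lies in a Krylov space
    -- relies on `W` being a subspace. Uniqueness of counts identifies the number of kept elements
    -- with `t`.
    Counted-∸ : Counted P s → Counted Q t → (∀ x → Q x → P x) → (∀ {x} → P x → Dec (Q x)) →
      Counted (λ x → P x × ¬ Q x) (s ∸ t)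
    Counted-∸ {P} {s} {Q} {t} cp@(L , len , _) cq Q⊆P Q? = subst (Counted (λ x → P x × ¬ Q x)) count
      (Counted-refine (λ p → ¬? (Q? p)) (λ x≈y ¬q q → ¬q (Counted-resp cq (≈-sym x≈y) q)) cp)
      where
      kept : length (refine Q? (Counted-All cp)) ≡ t
      kept = Counted-unique (Counted-refine Q? (Counted-resp cq) cp)
        (Counted-cong cq (λ x q → Q⊆P x q , q) (λ _ → proj₂))
      count : length (refine (λ p → ¬? (Q? p)) (Counted-All cp)) ≡ s ∸ t
      count = trans (sym (m+n∸m≡n t _))
        (cong (_∸ t) (trans (cong (_+ _) (sym kept)) (trans (length-refine-¬ Q? (Counted-All cp)) len)))

  module _ (S₁ S₂ : Setoid 0ℓ 0ℓ) where

    private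
      module S₁ = Setoid S₁
      module S₂ = Setoid S₂
      module C₁ = Counting S₁
      module C₂ = Counting S₂

    Counted-image : ∀ {P Q s} (f : S₁.Carrier → S₂.Carrier) → C₁.Counted P s →
      (∀ {x y} → x S₁.≈ y → f x S₂.≈ f y) →
      (∀ {x y} → P x → P y → f x S₂.≈ f y → x S₁.≈ y) →
      (∀ {x y} → x S₂.≈ y → Q x → Q y) →
      (∀ x → P x → Q (f x)) → (∀ y → Q y → ∃ λ x → P x × y S₂.≈ f x) →
      C₂.Counted Q s
    Counted-image {P} {Q} f cp@(L , len , distinct , iff) resp inj Qresp into onto =
      map f L , trans (length-map f L) len , distinct-map L distinct (C₁.Counted-All cp) ,
      λ y → mk⇔
        (λ q → let (x , p , e) = onto y q in
          Any.map⁺ (Any.map (λ x≈ → S₂.trans e (resp x≈)) (Equivalence.to (iff x) p)))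
        (λ m → back L (C₁.Counted-All cp) (Any.map⁻ m))
      where
      distinct-map : ∀ L → AllPairs (λ x y → ¬ (x S₁.≈ y)) L → All P L → AllPairs (λ x y → ¬ (x S₂.≈ y)) (map f L)
      distinct-map []      []       []       = []
      distinct-map (x ∷ L) (ne ∷ d) (p ∷ ps) =
        All.map⁺ (All.map (λ { (ne , p′) e → ne (inj p p′ e) }) (All.zip (ne , ps))) ∷ distinct-map L d ps
      back : ∀ {y} L → All P L → Any (λ x → y S₂.≈ f x) L → Q y
      back (x ∷ L) (p ∷ ps) (here e)  = Qresp (S₂.sym e) (into x p)
      back (x ∷ L) (p ∷ ps) (there m) = back L ps m

    -- `C` carries what `f` forgets about `y`. With `f` the projection `π`, it holds the condition
    -- on when e₀ enters, while `P` is the profile of the image.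
    Counted-fibre : ∀ {P} {C : S₂.Carrier → Set} {s m} (f : S₂.Carrier → S₁.Carrier) → C₁.Counted P s →
      (∀ a → P a → C₂.Counted (λ y → C y × f y S₁.≈ a) m) →
      C₂.Counted (λ y → C y × P (f y)) (s * m)
    Counted-fibre {P} {C} {s} {m} f cp@(L , len , distinct , iff) fibre =
      C₂.Counted-cong (subst (C₂.Counted (λ y → C y × Any (f y S₁.≈_) L)) (cong (_* m) len) (go L distinct (C₁.Counted-All cp)))
        (λ { y (c , any) → c , Equivalence.from (iff (f y)) any })
        (λ { y (c , p) → c , Equivalence.to (iff (f y)) p })
      where
      go : ∀ L → AllPairs (λ x y → ¬ (x S₁.≈ y)) L → All P L →
        C₂.Counted (λ y → C y × Any (f y S₁.≈_) L) (length L * m)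
      go []      _        _        = C₂.Counted-∅ (λ _ → λ ())
      go (a ∷ L) (ne ∷ d) (p ∷ ps) = C₂.Counted-cong
        (C₂.Counted-⊎ (fibre a p) (go L d ps)
          (λ { y (_ , e) (_ , any) → clash e any ne }))
        (λ { y (inj₁ (c , e)) → c , here e ; y (inj₂ (c , any)) → c , there any })
        (λ { y (c , here e) → inj₁ (c , e) ; y (c , there any) → inj₂ (c , any) })
        where
        clash : ∀ {y L} → f y S₁.≈ a → Any (f y S₁.≈_) L → All (λ x → ¬ (a S₁.≈ x)) L → ⊥
        clash e (here e′)   (ne ∷ _)  = ne (S₁.trans (S₁.sym e) e′)
        clash e (there any) (_ ∷ nes) = clash e any nes

open SetoidCounting

does-sound : ∀ {P : Set} (P? : Dec P) → does P? ≡ true → P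
does-sound (yes p) _ = p

-- Linear algebra over the finite field, Krylov spaces, and the count of subspaces

module Linear {q : ℕ} (𝔽 : FiniteField q) where

  open FiniteField 𝔽 using (inverse; 𝟘≢𝟙; enum)

  R : CommutativeRing 0ℓ 0ℓ
  R = record { isCommutativeRing = FiniteField.isCommutativeRing 𝔽 }

  open CommutativeRing R using
    ( _+_; _*_; -_; _-_; 0#; 1#; +-assoc; +-comm; +-identityˡ; +-identityʳ; -‿inverseˡ; -‿inverseʳ
    ; *-assoc; *-comm; *-identityˡ; zeroˡ; zeroʳ; distribˡ; distribʳ; ring; semiring; +-commutativeMonoid)
    renaming (Carrier to F) public
  open Algebra.Properties.Ring ring using (+-cancelˡ; +-cancelʳ; -‿distribˡ-*; -1*x≈-x) public
  open Algebra.Properties.CommutativeMonoid.Sum +-commutativeMonoid using (sum; sum-cong-≗; ∑-distrib-+; sum-replicate-zero)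
  open Algebra.Properties.Semiring.Sum semiring using (*-distribˡ-sum)

  almostRing : AlmostCommutativeRing 0ℓ 0ℓ
  almostRing = fromCommutativeRing R (λ _ → nothing)

  open RingSolver almostRing using (solve; _⊕_; _⊗_; _⊜_)

  interchange : ∀ a b c d → (a + b) + (c + d) ≡ (a + c) + (b + d)
  interchange = solve 4 (λ a b c d → ((a ⊕ b) ⊕ (c ⊕ d)) ⊜ ((a ⊕ c) ⊕ (b ⊕ d))) refl

  +-swap : ∀ a b c → a + (b + c) ≡ b + (a + c)
  +-swap = solve 3 (λ a b c → (a ⊕ (b ⊕ c)) ⊜ (b ⊕ (a ⊕ c))) refl

  -- Isolates one term of an equality of expansions. The solver regroups with the negatives as
  -- atoms, and the cancellations are made by hand, since `almostRing` recognizes no coefficient as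
  -- zero.
  difference : ∀ {x x′ p p′ y y′} → x + (p + y) ≡ x′ + (p′ + y′) → p - p′ ≡ (x′ - x) + (y′ - y)
  difference {x} {x′} {p} {p′} {y} {y′} eq = begin
    p - p′                                    ≡⟨ move x x′ p p′ y y′ ⟩
    (x + (p + y)) + (- x + (- p′ + - y))      ≡⟨ cong (_+ (- x + (- p′ + - y))) eq ⟩
    (x′ + (p′ + y′)) + (- x + (- p′ + - y))   ≡⟨ lem x′ p′ y′ (- x) (- p′) (- y) ⟩
    (x′ - x) + ((p′ - p′) + (y′ - y))         ≡⟨ cong (λ z → (x′ - x) + (z + (y′ - y))) (-‿inverseʳ p′) ⟩
    (x′ - x) + (0# + (y′ - y))                ≡⟨ cong ((x′ - x) +_) (+-identityˡ _) ⟩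
    (x′ - x) + (y′ - y)                       ∎
    where
    open ≡-Reasoning
    lem : ∀ a b c d e f → (a + (b + c)) + (d + (e + f)) ≡ (a + d) + ((b + e) + (c + f))
    lem = solve 6 (λ a b c d e f → ((a ⊕ (b ⊕ c)) ⊕ (d ⊕ (e ⊕ f))) ⊜ ((a ⊕ d) ⊕ ((b ⊕ e) ⊕ (c ⊕ f)))) refl
    move : ∀ x x′ p p′ y y′ → p - p′ ≡ (x + (p + y)) + (- x + (- p′ + - y))
    move x x′ p p′ y y′ = sym (trans (lem x p y (- x) (- p′) (- y)) (trans
      (cong₂ (λ u v → u + ((p - p′) + v)) (-‿inverseʳ x) (-‿inverseʳ y))
      (trans (+-identityˡ _) (+-identityʳ _))))

  -- Vectors

  V : ℕ → Set
  V n = Fin n → F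

  infix 4 _≈ᵥ_
  _≈ᵥ_ : ∀ {n} → V n → V n → Set
  u ≈ᵥ v = ∀ k → u k ≡ v k

  0ᵥ : ∀ {n} → V n
  0ᵥ _ = 0#

  infixl 6 _+ᵥ_
  _+ᵥ_ : ∀ {n} → V n → V n → V n
  (u +ᵥ v) k = u k + v k

  infixr 7 _·ᵥ_
  _·ᵥ_ : ∀ {n} → F → V n → V n
  (c ·ᵥ v) k = c * v k

  infixr 7 _⊛_
  _⊛_ : ∀ {n} → V n → V n → V n
  (ε ⊛ v) k = ε k * v k

  vectors : ℕ → Setoid 0ℓ 0ℓ
  vectors n = record
    { Carrier = V n ; _≈_ = _≈ᵥ_
    ; isEquivalence = record
        { refl = λ _ → refl ; sym = λ e k → sym (e k) ; trans = λ e e′ k → trans (e k) (e′ k) } }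

  module ≈ {n} = Setoid (vectors n) using (refl; sym; trans)

  lc : ∀ {d n} → V d → (Fin d → V n) → V n
  lc c t k = sum (λ i → c i * t i k)

  lc-cong : ∀ {d n} {c c′ : V d} (t : Fin d → V n) → c ≈ᵥ c′ → lc c t ≈ᵥ lc c′ t
  lc-cong t e k = sum-cong-≗ (λ i → cong (_* t i k) (e i))

  lc-+ : ∀ {d n} (c c′ : V d) (t : Fin d → V n) → lc (c +ᵥ c′) t ≈ᵥ lc c t +ᵥ lc c′ t
  lc-+ c c′ t k = trans (sum-cong-≗ (λ i → distribʳ (t i k) (c i) (c′ i)))
    (∑-distrib-+ (λ i → c i * t i k) (λ i → c′ i * t i k))

  lc-· : ∀ {d n} a (c : V d) (t : Fin d → V n) → lc (a ·ᵥ c) t ≈ᵥ a ·ᵥ lc c t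
  lc-· a c t k = trans (sum-cong-≗ (λ i → *-assoc a (c i) (t i k)))
    (sym (*-distribˡ-sum a (λ i → c i * t i k)))

  lc-0 : ∀ {d n} (t : Fin d → V n) → lc 0ᵥ t ≈ᵥ 0ᵥ
  lc-0 {d} t k = trans (sum-cong-≗ (λ i → zeroˡ (t i k))) (sum-replicate-zero d)

  lc-⊛ : ∀ {d n} ε (c : V d) (t : Fin d → V n) → lc c (λ i → ε ⊛ t i) ≈ᵥ ε ⊛ lc c t
  lc-⊛ ε c t k = trans (sum-cong-≗ (λ i → lem (c i) (ε k) (t i k)))
    (sym (*-distribˡ-sum (ε k) (λ i → c i * t i k)))
    where
    lem : ∀ a b c → a * (b * c) ≡ b * (a * c)
    lem = solve 3 (λ a b c → (a ⊗ (b ⊗ c)) ⊜ (b ⊗ (a ⊗ c))) refl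

  sum-++ : ∀ m {d} (f : V (m ℕ.+ d)) → sum f ≡ sum (λ i → f (i ↑ˡ d)) + sum (λ j → f (m ↑ʳ j))
  sum-++ zero    f = sym (+-identityˡ _)
  sum-++ (suc m) f = trans (cong (f zero +_) (sum-++ m (f ∘ suc))) (sym (+-assoc _ _ _))

  lc-++ : ∀ {m d n} (c : V (m ℕ.+ d)) (t : Fin m → V n) (s : Fin d → V n) →
    lc c (t ++ᵥ s) ≈ᵥ lc (c ∘ (_↑ˡ d)) t +ᵥ lc (c ∘ (m ↑ʳ_)) s
  lc-++ {m} {d} c t s k = trans (sum-++ m (λ i → c i * (t ++ᵥ s) i k)) (cong₂ _+_
    (sum-cong-≗ (λ i → cong (λ u → c (i ↑ˡ d) * u k) (Vec.lookup-++ˡ t s i)))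
    (sum-cong-≗ (λ j → cong (λ u → c (m ↑ʳ j) * u k) (Vec.lookup-++ʳ t s j))))

  unit : ∀ {d} → Fin d → V d
  unit zero    = 1# ∷ᵥ 0ᵥ
  unit (suc i) = 0# ∷ᵥ unit i

  sum-unit : ∀ {d} (i : Fin d) (f : V d) → sum (λ j → unit i j * f j) ≡ f i
  sum-unit {suc d} zero f = trans (cong₂ _+_ (*-identityˡ (f zero))
    (trans (sum-cong-≗ (λ j → zeroˡ (f (suc j)))) (sum-replicate-zero d))) (+-identityʳ _)
  sum-unit (suc i) f = trans (cong₂ _+_ (zeroˡ (f zero)) (sum-unit i (f ∘ suc))) (+-identityˡ _)

  lc-unit : ∀ {d n} (i : Fin d) (t : Fin d → V n) → lc (unit i) t ≈ᵥ t i
  lc-unit i t k = sum-unit i (λ j → t j k)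

  ⊛-+ : ∀ {n} (ε u v : V n) → ε ⊛ (u +ᵥ v) ≈ᵥ ε ⊛ u +ᵥ ε ⊛ v
  ⊛-+ ε u v k = distribˡ (ε k) (u k) (v k)

  ⊛-· : ∀ {n} a (ε v : V n) → ε ⊛ (a ·ᵥ v) ≈ᵥ a ·ᵥ (ε ⊛ v)
  ⊛-· a ε v k = lem (ε k) a (v k)
    where
    lem : ∀ a b c → a * (b * c) ≡ b * (a * c)
    lem = solve 3 (λ a b c → (a ⊗ (b ⊗ c)) ⊜ (b ⊗ (a ⊗ c))) refl

  ≈0-+ : ∀ {n} {z : V n} v → z ≈ᵥ 0ᵥ → z +ᵥ v ≈ᵥ v
  ≈0-+ v z≈0 k = trans (cong (_+ v k) (z≈0 k)) (+-identityˡ (v k))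

  -- Finiteness

  module enum = Inverse enum

  infix 4 _≟F_
  _≟F_ : (x y : F) → Dec (x ≡ y)
  x ≟F y = map′ (λ e → trans (sym (enum.inverseˡ refl)) (trans (cong enum.to e) (enum.inverseˡ refl)))
                (cong enum.from) (enum.from x Fin.≟ enum.from y)

  _≟ᵥ_ : ∀ {n} (u v : V n) → Dec (u ≈ᵥ v)
  u ≟ᵥ v = Fin.all? (λ k → u k ≟F v k)

  ∃F? : ∀ {P : F → Set} → Decidable P → Dec (∃ P)
  ∃F? {P} P? = map′ (λ { (i , p) → enum.to i , p })
                (λ { (x , p) → enum.from x , subst P (sym (enum.inverseˡ refl)) p })
                (Fin.any? (P? ∘ enum.to))

  ∷-η : ∀ {n} (v : V (suc n)) → v ≈ᵥ (v zero ∷ᵥ (v ∘ suc))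
  ∷-η v zero    = refl
  ∷-η v (suc k) = refl

  ∷-cong : ∀ {n} {x y} {u v : V n} → x ≡ y → u ≈ᵥ v → (x ∷ᵥ u) ≈ᵥ (y ∷ᵥ v)
  ∷-cong e e′ zero    = e
  ∷-cong e e′ (suc k) = e′ k

  -- Vectors are functions, so the search meets each one only up to pointwise equality, which `P`
  -- has to respect.
  ∃V? : ∀ n {P : V n → Set} → (∀ {u v} → u ≈ᵥ v → P u → P v) → Decidable P → Dec (∃ P)
  ∃V? zero    resp P? = map′ (λ p → _ , p) (λ { (v , p) → resp (λ ()) p }) (P? (λ ()))
  ∃V? (suc n) resp P? = map′ (λ { (x , v , p) → (x ∷ᵥ v) , p })
    (λ { (v , p) → v zero , v ∘ suc , resp (∷-η v) p })
    (∃F? (λ x → ∃V? n (λ e → resp (∷-cong refl e)) (λ v → P? (x ∷ᵥ v))))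

  encode : ∀ {n} → V n → Fin (q ℕ.^ n)
  encode v = funToFin (enum.from ∘ v)

  decode : ∀ {n} → Fin (q ℕ.^ n) → V n
  decode i = enum.to ∘ finToFun i

  decode-encode : ∀ {n} (v : V n) → decode (encode v) ≈ᵥ v
  decode-encode v k = trans (cong enum.to (Fin.finToFun-funToFin (enum.from ∘ v) k)) (enum.inverseˡ refl)

  funToFin-cong : ∀ {m d} {f g : Fin d → Fin m} → f ≗ g → funToFin f ≡ funToFin g
  funToFin-cong {d = zero}  e = refl
  funToFin-cong {d = suc d} e = cong₂ Fin.combine (e zero) (funToFin-cong (e ∘ suc))

  encode-cong : ∀ {n} {u v : V n} → u ≈ᵥ v → encode u ≡ encode v
  encode-cong e = funToFin-cong (λ k → cong enum.from (e k))

  encode-decode : ∀ {n} (i : Fin (q ℕ.^ n)) → encode {n} (decode i) ≡ i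
  encode-decode {n} i = trans (funToFin-cong (λ k → enum.inverseʳ {finToFun {n = n} i k} refl)) (Fin.funToFin-finToFin {n} i)

  decode-injective : ∀ {n} {i j : Fin (q ℕ.^ n)} → decode {n} i ≈ᵥ decode j → i ≡ j
  decode-injective {n} {i} {j} e = trans (sym (encode-decode {n} i)) (trans (encode-cong e) (encode-decode {n} j))

  Counted-V : ∀ n → Counting.Counted (vectors n) (λ _ → ⊤) (q ℕ.^ n)
  Counted-V n = List.tabulate decode , length-tabulate (decode {n}) ,
    AllPairs.tabulate⁺ (λ i≢j e → i≢j (decode-injective e)) ,
    λ v → mk⇔ (λ _ → Any.tabulate⁺ (encode v) (≈.sym (decode-encode v))) _

  1<q : 1 ℕ.< q
  1<q = Fin.injective⇒≤ {f = f} f-injective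
    where
    f : Fin 2 → Fin q
    f zero    = enum.from 0#
    f (suc _) = enum.from 1#
    from-injective : ∀ {x y} → enum.from x ≡ enum.from y → x ≡ y
    from-injective e = trans (sym (enum.inverseˡ refl)) (trans (cong enum.to e) (enum.inverseˡ refl))
    f-injective : ∀ {i j} → f i ≡ f j → i ≡ j
    f-injective {zero}     {zero}     e = refl
    f-injective {zero}     {suc zero} e = ⊥-elim (𝟘≢𝟙 (from-injective e))
    f-injective {suc zero} {zero}     e = ⊥-elim (𝟘≢𝟙 (from-injective (sym e)))
    f-injective {suc zero} {suc zero} e = refl

  -- Counting takes the place of the exchange lemma: q^m ≤ q^n with q > 1. Mere injectivity of `g`
  -- suits coordinates that are read off from the witnesses of `span`.
  V-injective⇒≤ : ∀ {m n} (g : V m → V n) → (∀ {c c′} → g c ≈ᵥ g c′ → c ≈ᵥ c′) → m ℕ.≤ n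
  V-injective⇒≤ {m} {n} g g-inj = ℕ.≮⇒≥ (λ n<m → ℕ.<⇒≱ (ℕ.^-monoʳ-< q 1<q n<m)
    (Fin.injective⇒≤ {f = encode ∘ g ∘ decode} (λ {i} {j} e → decode-injective {m} (g-inj
      (≈.trans (≈.sym (decode-encode (g (decode i)))) (≈.trans (λ k → cong (λ x → decode x k) e) (decode-encode (g (decode j)))))))))

  -- Subspaces and relative bases

  IsSub : ∀ {n} → (V n → Set) → Set
  IsSub U =
    (∀ u v → u ≈ᵥ v → U u → U v) ×
    U 0ᵥ ×
    (∀ u v → U u → U v → U (u +ᵥ v)) ×
    (∀ c v → U v → U (c ·ᵥ v))

  module Sub {n} {U : V n → Set} (U-sub : IsSub U) where

    resp : ∀ {u v} → u ≈ᵥ v → U u → U v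
    resp = proj₁ U-sub _ _

    0∈ : U 0ᵥ
    0∈ = proj₁ (proj₂ U-sub)

    +∈ : ∀ {u v} → U u → U v → U (u +ᵥ v)
    +∈ = proj₁ (proj₂ (proj₂ U-sub)) _ _

    ·∈ : ∀ c {v} → U v → U (c ·ᵥ v)
    ·∈ c = proj₂ (proj₂ (proj₂ U-sub)) c _

    -∈ : ∀ {v} → U v → U (λ k → - v k)
    -∈ {v} v∈ = resp (λ k → -1*x≈-x (v k)) (·∈ (- 1#) v∈)

    lc∈ : ∀ {d} (c : V d) {t : Fin d → V n} → (∀ i → U (t i)) → U (lc c t)
    lc∈ {zero}  c t∈ = 0∈
    lc∈ {suc d} c t∈ = +∈ (·∈ (c zero) (t∈ zero)) (lc∈ (c ∘ suc) (t∈ ∘ suc))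

  -- For S inside U, a basis of U / S expressed without the quotient. Independence compares two
  -- expansions with different remainders in S, the form in which injectivity arguments use it.
  record RelBasis {n} (U S : V n → Set) (r : ℕ) : Set where
    field
      basis  : Fin r → V n
      basis∈ : ∀ i → U (basis i)
      unique : ∀ {s s′} c c′ → S s → S s′ → s +ᵥ lc c basis ≈ᵥ s′ +ᵥ lc c′ basis → c ≈ᵥ c′
      span   : ∀ v → U v → ∃₂ λ s c → S s × v ≈ᵥ s +ᵥ lc c basis

  open RelBasis

  Zero : ∀ {n} → V n → Set
  Zero v = v ≈ᵥ 0ᵥ

  Zero-sub : ∀ {n} → IsSub (Zero {n})
  Zero-sub = (λ u v e z k → trans (sym (e k)) (z k)) , (λ _ → refl) ,
    (λ u v z z′ k → trans (cong₂ _+_ (z k) (z′ k)) (+-identityˡ _)) ,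
    (λ c v z k → trans (cong (c *_) (z k)) (zeroʳ c))

  Dim : ∀ {n} → (V n → Set) → ℕ → Set
  Dim U = RelBasis U Zero

  RelBasis-cong : ∀ {n r} {U U′ S S′ : V n → Set} →
    (∀ v → U v → U′ v) → (∀ v → U′ v → U v) → (∀ v → S v → S′ v) → (∀ v → S′ v → S v) →
    RelBasis U S r → RelBasis U′ S′ r
  RelBasis-cong f g h k B = record
    { basis  = basis B
    ; basis∈ = λ i → f _ (basis∈ B i)
    ; unique = λ c c′ s∈ s′∈ → unique B c c′ (k _ s∈) (k _ s′∈)
    ; span   = λ v v∈ → let (s , c , s∈ , e) = span B v (g v v∈) in s , c , h s s∈ , e
    }

  RelBasis-≤ : ∀ {n r r′} {U S U′ S′ : V n → Set} → IsSub U′ → IsSub S′ →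
    (∀ v → U′ v → U v) → (∀ v → S v → S′ v) →
    RelBasis U S r → RelBasis U′ S′ r′ → r′ ℕ.≤ r
  RelBasis-≤ {n} {r} {r′} {S = S} U′-sub S′-sub U′⊆U S⊆S′ B B′ = V-injective⇒≤ coords coords-injective
    where
    decomposition : ∀ c → ∃₂ λ s c₁ → S s × lc c (basis B′) ≈ᵥ s +ᵥ lc c₁ (basis B)
    decomposition c = span B _ (U′⊆U _ (Sub.lc∈ U′-sub c (basis∈ B′)))
    coords : V r′ → V r
    coords c = proj₁ (proj₂ (decomposition c))
    coords-injective : ∀ {c c′} → coords c ≈ᵥ coords c′ → c ≈ᵥ c′
    coords-injective {c} {c′} e with decomposition c | decomposition c′
    -- Each side receives the remainder of the other; both then equal `s + s′` plus the common
    -- combination of the basis of `B`.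
    ... | s , c₁ , s∈ , eq | s′ , c₁′ , s′∈ , eq′ = unique B′ c c′ (S⊆S′ _ s′∈) (S⊆S′ _ s∈) λ k → begin
      s′ k + lc c (basis B′) k           ≡⟨ cong (s′ k +_) (eq k) ⟩
      s′ k + (s k + lc c₁ (basis B) k)   ≡⟨ cong (λ z → s′ k + (s k + z)) (lc-cong (basis B) e k) ⟩
      s′ k + (s k + lc c₁′ (basis B) k)  ≡⟨ +-swap (s′ k) (s k) _ ⟩
      s k + (s′ k + lc c₁′ (basis B) k)  ≡⟨ cong (s k +_) (eq′ k) ⟨
      s k + lc c′ (basis B′) k           ∎
      where open ≡-Reasoning

  Dim-unique : ∀ {n d d′} {U : V n → Set} → IsSub U → Dim U d → Dim U d′ → d ≡ d′
  Dim-unique U-sub B B′ = ℕ.≤-antisym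
    (RelBasis-≤ U-sub Zero-sub (λ _ → id) (λ _ → id) B′ B)
    (RelBasis-≤ U-sub Zero-sub (λ _ → id) (λ _ → id) B B′)

  RelBasis-+ : ∀ {n r d} {Z X : V n → Set} → IsSub Z → IsSub X → (∀ v → X v → Z v) →
    RelBasis Z X r → Dim X d → Dim Z (r ℕ.+ d)
  RelBasis-+ {n} {r} {d} {Z} {X} Z-sub X-sub X⊆Z B C = record
    { basis  = t ++ᵥ s
    ; basis∈ = member
    ; unique = uniq
    ; span   = spanning
    }
    where
    t = basis B
    s = basis C
    member : ∀ i → Z ((t ++ᵥ s) i)
    member i with splitAt r i
    ... | inj₁ j = basis∈ B j
    ... | inj₂ j = X⊆Z _ (basis∈ C j)
    regroup : ∀ (z : V n) c → z +ᵥ lc c (t ++ᵥ s) ≈ᵥ (z +ᵥ lc (c ∘ (r ↑ʳ_)) s) +ᵥ lc (c ∘ (_↑ˡ d)) t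
    regroup z c k = trans (cong (z k +_) (lc-++ c t s k)) (lem (z k) _ _)
      where
      lem : ∀ a b c → a + (b + c) ≡ (a + c) + b
      lem = solve 3 (λ a b c → (a ⊕ (b ⊕ c)) ⊜ ((a ⊕ c) ⊕ b)) refl
    uniq : ∀ {z z′} c c′ → Zero z → Zero z′ → z +ᵥ lc c (t ++ᵥ s) ≈ᵥ z′ +ᵥ lc c′ (t ++ᵥ s) → c ≈ᵥ c′
    uniq {z} {z′} c c′ z≈0 z′≈0 e i = subst (λ i → c i ≡ c′ i) (Fin.join-splitAt r d i) (cases (splitAt r i))
      where
      in-X : ∀ {z} c → Zero z → X (z +ᵥ lc (c ∘ (r ↑ʳ_)) s)
      in-X c z≈0 = Sub.+∈ X-sub (Sub.resp X-sub (≈.sym z≈0) (Sub.0∈ X-sub)) (Sub.lc∈ X-sub _ (basis∈ C))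
      e′ : (z +ᵥ lc (c ∘ (r ↑ʳ_)) s) +ᵥ lc (c ∘ (_↑ˡ d)) t ≈ᵥ (z′ +ᵥ lc (c′ ∘ (r ↑ʳ_)) s) +ᵥ lc (c′ ∘ (_↑ˡ d)) t
      e′ = ≈.trans (≈.sym (regroup z c)) (≈.trans e (regroup z′ c′))
      left : (c ∘ (_↑ˡ d)) ≈ᵥ (c′ ∘ (_↑ˡ d))
      left = unique B _ _ (in-X c z≈0) (in-X c′ z′≈0) e′
      right : (c ∘ (r ↑ʳ_)) ≈ᵥ (c′ ∘ (r ↑ʳ_))
      right = unique C _ _ z≈0 z′≈0 (λ k → +-cancelʳ (lc (c ∘ (_↑ˡ d)) t k) _ _
        (trans (e′ k) (cong (_ +_) (sym (lc-cong t left k)))))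
      cases : ∀ x → c (Fin.join r d x) ≡ c′ (Fin.join r d x)
      cases (inj₁ j) = left j
      cases (inj₂ j) = right j
    spanning : ∀ v → Z v → ∃₂ λ z c → Zero z × v ≈ᵥ z +ᵥ lc c (t ++ᵥ s)
    spanning v v∈ with span B v v∈
    ... | x , c₁ , x∈ , e with span C x x∈
    ...   | z , c₂ , z≈0 , e′ = z , c₁ ++ᵥ c₂ , z≈0 , λ k → begin
      v k                                                    ≡⟨ e k ⟩
      x k + lc c₁ t k                                        ≡⟨ cong₂ _+_ (trans (e′ k) (cong (z k +_) (lc-cong s (λ j → sym (Vec.lookup-++ʳ c₁ c₂ j)) k)))
                                                                  (lc-cong t (λ i → sym (Vec.lookup-++ˡ c₁ c₂ i)) k) ⟩
      (z +ᵥ lc ((c₁ ++ᵥ c₂) ∘ (r ↑ʳ_)) s) k + lc ((c₁ ++ᵥ c₂) ∘ (_↑ˡ d)) t k ≡⟨ regroup z (c₁ ++ᵥ c₂) k ⟨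
      z k + lc (c₁ ++ᵥ c₂) (t ++ᵥ s) k                       ∎
      where open ≡-Reasoning

  Spanned : ∀ {n r} → (V n → Set) → (Fin r → V n) → V n → Set
  Spanned S t v = ∃₂ λ s c → S s × v ≈ᵥ s +ᵥ lc c t

  Spanned? : ∀ {n r} {S : V n → Set} → IsSub S → Decidable S → (t : Fin r → V n) → Decidable (Spanned S t)
  Spanned? {n} {r} S-sub S? t v =
    ∃V? n (λ e (c , s∈ , eq) → c , Sub.resp S-sub e s∈ , λ k → trans (eq k) (cong (_+ lc c t k) (e k)))
      (λ s → ∃V? r (λ e (s∈ , eq) → s∈ , λ k → trans (eq k) (cong (s k +_) (lc-cong t e k)))
        (λ c → S? s ×-dec (v ≟ᵥ (s +ᵥ lc c t))))

  Spanned-sub : ∀ {n r} {S : V n → Set} → IsSub S → (t : Fin r → V n) → IsSub (Spanned S t)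
  Spanned-sub S-sub t =
    (λ { u v e (s , c , s∈ , eq) → s , c , s∈ , ≈.trans (≈.sym e) eq }) ,
    (0ᵥ , 0ᵥ , Sub.0∈ S-sub , λ k → sym (trans (+-identityˡ _) (lc-0 t k))) ,
    (λ { u v (s , c , s∈ , eq) (s′ , c′ , s′∈ , eq′) → s +ᵥ s′ , c +ᵥ c′ , Sub.+∈ S-sub s∈ s′∈ , λ k →
         trans (cong₂ _+_ (eq k) (eq′ k)) (trans (interchange (s k) _ (s′ k) _)
           (cong (s k + s′ k +_) (sym (lc-+ c c′ t k)))) }) ,
    (λ { a v (s , c , s∈ , eq) → a ·ᵥ s , a ·ᵥ c , Sub.·∈ S-sub a s∈ , λ k →
         trans (cong (a *_) (eq k)) (trans (distribˡ a _ _) (cong (a * s k +_) (sym (lc-· a c t k)))) })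

  Spanned-∷ : ∀ {n r} {S : V n → Set} (t : Fin r → V n) v {u} → Spanned S t u → Spanned S (v ∷ᵥ t) u
  Spanned-∷ t v (s , c , s∈ , e) = s , (0# ∷ᵥ c) , s∈ , λ k → trans (e k)
    (cong (s k +_) (sym (trans (cong (_+ lc c t k) (zeroˡ (v k))) (+-identityˡ _))))

  Dim-member? : ∀ {n d} {U : V n → Set} → IsSub U → Dim U d → Decidable U
  Dim-member? U-sub B v = map′
    (λ { (s , c , s≈0 , e) → Sub.resp U-sub (≈.sym e)
           (Sub.+∈ U-sub (Sub.resp U-sub (≈.sym s≈0) (Sub.0∈ U-sub)) (Sub.lc∈ U-sub c (basis∈ B))) })
    (span B v) (Spanned? Zero-sub (_≟ᵥ 0ᵥ) (basis B) v)

  module Extend {n r} {S : V n → Set} (S-sub : IsSub S) (t : Fin r → V n)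
    (unique-t : ∀ {s s′} c c′ → S s → S s′ → s +ᵥ lc c t ≈ᵥ s′ +ᵥ lc c′ t → c ≈ᵥ c′)
    (v : V n) (v∉ : ¬ Spanned S t v) where

    unique-∷ : ∀ {s s′} c c′ → S s → S s′ → s +ᵥ lc c (v ∷ᵥ t) ≈ᵥ s′ +ᵥ lc c′ (v ∷ᵥ t) → c ≈ᵥ c′
    unique-∷ {s} {s′} c c′ s∈ s′∈ e with c zero ≟F c′ zero
    ... | yes eq = λ { zero → eq ; (suc i) → rest i }
      where
      rest : (c ∘ suc) ≈ᵥ (c′ ∘ suc)
      rest = unique-t (c ∘ suc) (c′ ∘ suc) s∈ s′∈ (λ k → +-cancelˡ (c zero * v k) _ _ (begin
        c zero * v k + (s k + lc (c ∘ suc) t k)    ≡⟨ +-swap (c zero * v k) (s k) _ ⟩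
        s k + (c zero * v k + lc (c ∘ suc) t k)    ≡⟨ e k ⟩
        s′ k + (c′ zero * v k + lc (c′ ∘ suc) t k) ≡⟨ cong (λ a → s′ k + (a * v k + lc (c′ ∘ suc) t k)) eq ⟨
        s′ k + (c zero * v k + lc (c′ ∘ suc) t k)  ≡⟨ +-swap (s′ k) (c zero * v k) _ ⟩
        c zero * v k + (s′ k + lc (c′ ∘ suc) t k)  ∎))
        where open ≡-Reasoning
    -- Dividing by the nonzero difference of the leading coefficients would express `v` through `t`
    -- modulo `S`.
    ... | no ne = ⊥-elim (v∉ (Sub.resp T-sub scaled (Sub.·∈ T-sub a⁻¹ (Sub.+∈ T-sub (in-T s∈ s′∈) (lc-in-T)))))
      where
      T-sub = Spanned-sub S-sub t
      a = c zero - c′ zero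
      a≢0 : ¬ (a ≡ 0#)
      a≢0 a≡0 = ne (+-cancelʳ (- c′ zero) _ _ (trans a≡0 (sym (-‿inverseʳ (c′ zero)))))
      a⁻¹ = proj₁ (inverse a a≢0)
      S⊆T : ∀ {s} → S s → Spanned S t s
      S⊆T {s} s∈ = s , 0ᵥ , s∈ , λ k → sym (trans (cong (s k +_) (lc-0 t k)) (+-identityʳ _))
      lc⊆T : ∀ c → Spanned S t (lc c t)
      lc⊆T c = 0ᵥ , c , Sub.0∈ S-sub , λ k → sym (+-identityˡ _)
      in-T : S s → S s′ → Spanned S t (λ k → s′ k - s k)
      in-T s∈ s′∈ = Sub.+∈ T-sub (S⊆T s′∈) (Sub.-∈ T-sub (S⊆T s∈))
      lc-in-T : Spanned S t (λ k → lc (c′ ∘ suc) t k - lc (c ∘ suc) t k)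
      lc-in-T = Sub.+∈ T-sub (lc⊆T (c′ ∘ suc)) (Sub.-∈ T-sub (lc⊆T (c ∘ suc)))
      scaled : a⁻¹ ·ᵥ (λ k → (s′ k - s k) + (lc (c′ ∘ suc) t k - lc (c ∘ suc) t k)) ≈ᵥ v
      scaled k = begin
        a⁻¹ * ((s′ k - s k) + (lc (c′ ∘ suc) t k - lc (c ∘ suc) t k)) ≡⟨ cong (a⁻¹ *_) (difference (e k)) ⟨
        a⁻¹ * (c zero * v k - c′ zero * v k)  ≡⟨ cong (λ z → a⁻¹ * (c zero * v k + z)) (-‿distribˡ-* (c′ zero) (v k)) ⟩
        a⁻¹ * (c zero * v k + - c′ zero * v k) ≡⟨ cong (a⁻¹ *_) (distribʳ (v k) (c zero) (- c′ zero)) ⟨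
        a⁻¹ * (a * v k)                       ≡⟨ *-assoc a⁻¹ a (v k) ⟨
        a⁻¹ * a * v k                         ≡⟨ cong (_* v k) (trans (*-comm a⁻¹ a) (proj₂ (inverse a a≢0))) ⟩
        1# * v k                            ≡⟨ *-identityˡ (v k) ⟩
        v k                                 ∎
        where open ≡-Reasoning

  -- A greedy choice along the list of all q^n vectors: a vector of U is kept unless those already
  -- kept span it modulo S, so every vector of U is spanned at the end.
  relBasis : ∀ {n} {U S : V n → Set} → IsSub U → IsSub S → Decidable U → Decidable S → ∃ (RelBasis U S)
  relBasis {n} {U} {S} U-sub S-sub U? S? with greedy (List.tabulate decode)
    where
    greedy : (L : List (V n)) → ∃ λ r → ∃ λ (t : Fin r → V n) → (∀ i → U (t i)) ×
      (∀ {s s′} c c′ → S s → S s′ → s +ᵥ lc c t ≈ᵥ s′ +ᵥ lc c′ t → c ≈ᵥ c′) ×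
      All (λ v → U v → Spanned S t v) L
    greedy [] = 0 , (λ ()) , (λ ()) , (λ _ _ _ _ _ ()) , []
    greedy (v ∷ L) with greedy L
    ... | r , t , t∈ , uniq , spans with U? v | Spanned? S-sub S? t v
    ...   | no v∉U | _      = r , t , t∈ , uniq , (λ v∈U → ⊥-elim (v∉U v∈U)) ∷ spans
    ...   | yes _  | yes v∈ = r , t , t∈ , uniq , (λ _ → v∈) ∷ spans
    ...   | yes v∈U | no v∉ = suc r , v ∷ᵥ t , (λ { zero → v∈U ; (suc i) → t∈ i }) ,
      Extend.unique-∷ S-sub t uniq v v∉ ,
      (λ _ → 0ᵥ , unit zero , Sub.0∈ S-sub , λ k → sym (trans (+-identityˡ _) (lc-unit zero (v ∷ᵥ t) k))) ∷
      All.map (λ sp u∈ → Spanned-∷ {S = S} t v (sp u∈)) spans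
  ... | r , t , t∈ , uniq , spans = r , record
    { basis = t ; basis∈ = t∈ ; unique = uniq
    ; span = λ v v∈ → Sub.resp (Spanned-sub S-sub t) (decode-encode v)
        (All.tabulate⁻ spans (encode v) (Sub.resp U-sub (≈.sym (decode-encode v)) v∈))
    }

  -- Krylov spaces W + εW + … + ε^(j-1)W of a diagonal operator ε

  K : ∀ {n} → V n → (V n → Set) → ℕ → V n → Set
  K ε W zero    v = Zero v
  K ε W (suc j) v = ∃₂ λ w x → W w × K ε W j x × v ≈ᵥ w +ᵥ ε ⊛ x

  ⊛-cong : ∀ {n} (ε : V n) {u v : V n} → u ≈ᵥ v → ε ⊛ u ≈ᵥ ε ⊛ v
  ⊛-cong ε e k = cong (ε k *_) (e k)

  K-mono : ∀ {n} (ε : V n) {W W′ : V n → Set} → (∀ v → W v → W′ v) → ∀ j {v} → K ε W j v → K ε W′ j v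
  K-mono ε f zero    z≈0                   = z≈0
  K-mono ε f (suc j) (w , x , w∈ , x∈ , e) = w , x , f w w∈ , K-mono ε f j x∈ , e

  module Krylov {n} (ε : V n) {W : V n → Set} (W-sub : IsSub W) where

    K-sub : ∀ j → IsSub (K ε W j)
    K-sub zero    = Zero-sub
    K-sub (suc j) =
      (λ { u v e (w , x , w∈ , x∈ , eq) → w , x , w∈ , x∈ , ≈.trans (≈.sym e) eq }) ,
      (0ᵥ , 0ᵥ , Sub.0∈ W-sub , Sub.0∈ (K-sub j) , λ k → sym (trans (+-identityˡ _) (zeroʳ (ε k)))) ,
      (λ { u v (w , x , w∈ , x∈ , e) (w′ , x′ , w′∈ , x′∈ , e′) →
           w +ᵥ w′ , x +ᵥ x′ , Sub.+∈ W-sub w∈ w′∈ , Sub.+∈ (K-sub j) x∈ x′∈ , λ k →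
           trans (cong₂ _+_ (e k) (e′ k)) (trans (interchange (w k) _ (w′ k) _)
             (cong (w k + w′ k +_) (sym (⊛-+ ε x x′ k)))) }) ,
      (λ { a v (w , x , w∈ , x∈ , e) → a ·ᵥ w , a ·ᵥ x , Sub.·∈ W-sub a w∈ , Sub.·∈ (K-sub j) a x∈ , λ k →
           trans (cong (a *_) (e k)) (trans (distribˡ a _ _) (cong (a * w k +_) (sym (⊛-· a ε x k)))) })

    K-suc : ∀ j {v} → K ε W j v → K ε W (suc j) v
    K-suc zero    z≈0 = Sub.resp (K-sub 1) (≈.sym z≈0) (Sub.0∈ (K-sub 1))
    K-suc (suc j) (w , x , w∈ , x∈ , e) = w , x , w∈ , K-suc j x∈ , e

    K-≤ : ∀ {i j v} → i ℕ.≤ j → K ε W i v → K ε W j v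
    K-≤ i≤j = go (ℕ.≤⇒≤′ i≤j)
      where
      go : ∀ {i j v} → i ℕ.≤′ j → K ε W i v → K ε W j v
      go (ℕ.≤′-reflexive refl) v∈ = v∈
      go (ℕ.≤′-step i≤j)       v∈ = K-suc _ (go i≤j v∈)

    K-generator : ∀ {v} j → W v → K ε W (suc j) v
    K-generator {v} j v∈ = v , 0ᵥ , v∈ , Sub.0∈ (K-sub j) ,
      λ k → sym (trans (cong (v k +_) (zeroʳ (ε k))) (+-identityʳ (v k)))

    K-⊛ : ∀ {v} j → K ε W j v → K ε W (suc j) (ε ⊛ v)
    K-⊛ {v} j v∈ = 0ᵥ , v , Sub.0∈ W-sub , v∈ , λ k → sym (+-identityˡ _)

    K-1 : ∀ {v} → K ε W 1 v → W v
    K-1 (w , x , w∈ , x≈0 , e) = Sub.resp W-sub (λ k → sym (trans (e k)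
      (trans (cong (λ z → w k + ε k * z) (x≈0 k)) (trans (cong (w k +_) (zeroʳ (ε k))) (+-identityʳ (w k)))))) w∈

    module _ (W? : Decidable W) where

      K? : ∀ j → Decidable (K ε W j)
      K? zero    v = v ≟ᵥ 0ᵥ
      K? (suc j) v = ∃V? n
        (λ { e (x , w∈ , x∈ , eq) → x , Sub.resp W-sub e w∈ , x∈ , λ k → trans (eq k) (cong (_+ ε k * x k) (e k)) })
        (λ w → ∃V? n
          (λ { e (w∈ , x∈ , eq) → w∈ , Sub.resp (K-sub j) e x∈ , λ k → trans (eq k) (cong (λ z → w k + ε k * z) (e k)) })
          (λ x → W? w ×-dec K? j x ×-dec (v ≟ᵥ (w +ᵥ ε ⊛ x))))

      K-dim : ∀ j → ∃ (Dim (K ε W j))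
      K-dim j = relBasis (K-sub j) Zero-sub (K? j) (_≟ᵥ 0ᵥ)

  -- For x in the j-th space, ε x = ε′ x + a x, and the extra term a x lies in the next space
  -- because the chain increases.
  K-shift : ∀ {n} {ε ε′ : V n} {W : V n → Set} → IsSub W → ∀ a → (∀ k → ε k ≡ ε′ k + a) →
    ∀ j {v} → K ε W j v → K ε′ W j v
  K-shift W-sub a h zero    z≈0 = z≈0
  K-shift {ε = ε} {ε′} {W} W-sub a h (suc j) {v} (w , x , w∈ , x∈ , e) =
    Sub.resp (K-sub (suc j)) (λ k → sym (trans (e k) (expand k)))
      (Sub.+∈ (K-sub (suc j)) (w , x , w∈ , x∈′ , λ _ → refl) (Sub.·∈ (K-sub (suc j)) a (K-suc j x∈′)))
    where
    open Krylov ε′ W-sub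
    x∈′ : K ε′ W j x
    x∈′ = K-shift W-sub a h j x∈
    expand : ∀ k → w k + ε k * x k ≡ (w k + ε′ k * x k) + a * x k
    expand k = trans (cong (λ z → w k + z * x k) (h k)) (trans (cong (w k +_) (distribʳ (x k) (ε′ k) a)) (sym (+-assoc _ _ _)))

  Dim-Zero : ∀ {n} → Dim (Zero {n}) 0
  Dim-Zero = record { basis = λ () ; basis∈ = λ () ; unique = λ _ _ _ _ _ ()
                    ; span = λ v v≈0 → v , (λ ()) , v≈0 , λ k → sym (+-identityʳ (v k)) }

  RelBasis-0 : ∀ {n} {U S : V n → Set} → IsSub S → RelBasis U S 0 → ∀ v → U v → S v
  RelBasis-0 S-sub B v v∈ with span B v v∈
  ... | s , c , s∈ , e = Sub.resp S-sub (λ k → sym (trans (e k) (+-identityʳ (s k)))) s∈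

  Dim-≡⇒⊇ : ∀ {n d} {X Y : V n → Set} → IsSub X → IsSub Y → Decidable X → Decidable Y →
    (∀ v → X v → Y v) → Dim X d → Dim Y d → ∀ v → Y v → X v
  Dim-≡⇒⊇ {d = d} X-sub Y-sub X? Y? X⊆Y B C v v∈ with relBasis Y-sub X-sub Y? X?
  ... | r , D with ℕ.+-cancelʳ-≡ d r 0 (Dim-unique Y-sub (RelBasis-+ Y-sub X-sub X⊆Y D B) C)
  ...   | refl = RelBasis-0 X-sub D v v∈

  Dim-≤ : ∀ {n d d′} {X Y : V n → Set} → IsSub X → (∀ v → X v → Y v) → Dim X d → Dim Y d′ → d ℕ.≤ d′
  Dim-≤ X-sub X⊆Y B C = RelBasis-≤ X-sub Zero-sub X⊆Y (λ _ → id) C B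

  -- Dimension sequences

  -- As `take` stops at the end of the list, `D μ` stays constant from `length μ` on, so prescribing
  -- it at every `j` includes the stabilization.
  D : List ℕ → ℕ → ℕ
  D μ j = ListAction.sum (List.take j μ)

  D-suc : ∀ μ j → D μ (suc j) ≡ D μ j ℕ.+ nth μ j
  D-suc []      zero    = refl
  D-suc []      (suc j) = refl
  D-suc (x ∷ μ) zero    = ℕ.+-comm x 0
  D-suc (x ∷ μ) (suc j) = trans (cong (x ℕ.+_) (D-suc μ j)) (sym (ℕ.+-assoc x (D μ j) (nth μ j)))

  D-all : ∀ μ {j} → List.length μ ℕ.≤ j → D μ j ≡ ListAction.sum μ
  D-all μ {j} le = cong ListAction.sum (take-all j μ le)

  D-decAt-≤ : ∀ μ {j} t → t ℕ.≤ j → D (decAt j μ) t ≡ D μ t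
  D-decAt-≤ μ       zero    le                = refl
  D-decAt-≤ []      (suc t) le                = refl
  D-decAt-≤ (x ∷ μ) {suc j} (suc t) (s≤s le)  = cong (x ℕ.+_) (D-decAt-≤ μ t le)

  D-decAt-> : ∀ μ {i j} t → nth μ j ≡ suc i → j ℕ.< t → D μ t ≡ suc (D (decAt j μ) t)
  D-decAt-> (.(suc _) ∷ μ) {j = zero} (suc t) refl lt = refl
  D-decAt-> (x ∷ μ) {j = suc j} (suc t) eq (s≤s lt) = trans (cong (x ℕ.+_) (D-decAt-> μ t eq lt)) (ℕ.+-suc x _)

  module Stable {n} (ε : V n) {W : V n → Set} (W-sub : IsSub W) where

    open Krylov ε W-sub

    K-stable : ∀ m → (∀ v → K ε W (suc m) v → K ε W m v) → ∀ d v → K ε W (d ℕ.+ m) v → K ε W m v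
    K-stable m h zero    v v∈ = v∈
    K-stable m h (suc d) v (w , x , w∈ , x∈ , e) = h v (w , x , w∈ , K-stable m h d x x∈ , e)

    -- Equal dimensions at two consecutive steps make the spaces equal, and K_(j+1) = W + ε K_j then
    -- keeps all later ones equal. Finitely many conditions thus yield the dimension at every step.
    Dim-stable : ∀ μ → (∀ j → j ℕ.≤ List.length μ → Dim (K ε W j) (D μ j)) →
      Dim (K ε W (suc (List.length μ))) (D μ (List.length μ)) → ∀ j → Dim (K ε W j) (D μ j)
    Dim-stable μ h last j with ℕ.≤-total j (List.length μ)
    ... | inj₁ le = h j le
    ... | inj₂ ge = subst (Dim (K ε W j)) (trans (D-all μ ℕ.≤-refl) (sym (D-all μ ge)))
      (RelBasis-cong (λ v → K-≤ ge) (λ v v∈ → K-stable m shrink (j ℕ.∸ m) v (subst (λ i → K ε W i v) (sym (ℕ.m∸n+n≡m ge)) v∈))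
        (λ _ → id) (λ _ → id) (h m ℕ.≤-refl))
      where
      m = List.length μ
      shrink : ∀ v → K ε W (suc m) v → K ε W m v
      shrink = Dim-≡⇒⊇ (K-sub m) (K-sub (suc m)) (Dim-member? (K-sub m) (h m ℕ.≤-refl))
        (Dim-member? (K-sub (suc m)) last) (λ v → K-suc m) (h m ℕ.≤-refl) last

  -- Boolean subspaces and their projection forgetting coordinate 0

  Subset : ℕ → Set
  Subset n = V n → Bool

  Mem : ∀ {n} → Subset n → V n → Set
  Mem W v = W v ≡ true

  Mem? : ∀ {n} (W : Subset n) → Decidable (Mem W)
  Mem? W v = W v Bool.≟ true

  subsets : ℕ → Setoid 0ℓ 0ℓ
  subsets n = V n →-setoid Bool

  ≗-ext : ∀ {n} {W W′ : Subset n} → (∀ v → Mem W v → Mem W′ v) → (∀ v → Mem W′ v → Mem W v) → W ≗ W′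
  ≗-ext f g v = ⇔→≡ (mk⇔ (f v) (g v))

  Mem-resp : ∀ {n} {W W′ : Subset n} → W ≗ W′ → ∀ v → Mem W v → Mem W′ v
  Mem-resp e v v∈ = trans (sym (e v)) v∈

  IsSub-cong : ∀ {n} {U U′ : V n → Set} → (∀ v → U v → U′ v) → (∀ v → U′ v → U v) → IsSub U → IsSub U′
  IsSub-cong f g U-sub =
    (λ u v e u∈ → f v (Sub.resp U-sub e (g u u∈))) , f _ (Sub.0∈ U-sub) ,
    (λ u v u∈ v∈ → f _ (Sub.+∈ U-sub (g u u∈) (g v v∈))) , (λ c v v∈ → f _ (Sub.·∈ U-sub c (g v v∈)))

  IsSub-≗ : ∀ {n} {W W′ : Subset n} → W ≗ W′ → IsSub (Mem W) → IsSub (Mem W′)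
  IsSub-≗ e = IsSub-cong (Mem-resp e) (Mem-resp (λ v → sym (e v)))

  e₀ : ∀ {n} → V (suc n)
  e₀ = 1# ∷ᵥ 0ᵥ

  module _ {n : ℕ} where

    fibre? : ∀ (W : Subset (suc n)) u → Dec (∃ λ x → Mem W (x ∷ᵥ u))
    fibre? W u = ∃F? (λ x → Mem? W (x ∷ᵥ u))

    π : Subset (suc n) → Subset n
    π W u = does (fibre? W u)

    π-lift : ∀ W {u} → Mem (π W) u → ∃ λ x → Mem W (x ∷ᵥ u)
    π-lift W {u} = does-sound (fibre? W u)

    π-∷ : ∀ W {x u} → Mem W (x ∷ᵥ u) → Mem (π W) u
    π-∷ W {x} {u} m = dec-true (fibre? W u) (x , m)

    π-tail : ∀ W {v} → IsSub (Mem W) → Mem W v → Mem (π W) (v ∘ suc)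
    π-tail W {v} W-sub v∈ = π-∷ W (Sub.resp W-sub (∷-η v) v∈)

    π-sub : ∀ W → IsSub (Mem W) → IsSub (Mem (π W))
    π-sub W W-sub =
      (λ u v e u∈ → let (x , m) = π-lift W u∈ in π-∷ W (Sub.resp W-sub (∷-cong refl e) m)) ,
      π-tail W W-sub (Sub.0∈ W-sub) ,
      (λ u v u∈ v∈ → let (x , m) = π-lift W u∈ ; (y , m′) = π-lift W v∈ in π-tail W W-sub (Sub.+∈ W-sub m m′)) ,
      (λ c v v∈ → let (x , m) = π-lift W v∈ in π-tail W W-sub (Sub.·∈ W-sub c m))

    scaled-e₀ : ∀ {A : V (suc n) → Set} → IsSub A → ¬ A e₀ → ∀ {v} → A v → Zero (v ∘ suc) → Zero v
    scaled-e₀ A-sub e₀∉ {v} v∈ tail≈0 zero with v zero ≟F 0#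
    ... | yes eq = eq
    ... | no ne  = ⊥-elim (e₀∉ (Sub.resp A-sub scaled (Sub.·∈ A-sub a⁻¹ v∈)))
      where
      a⁻¹ = proj₁ (inverse (v zero) ne)
      scaled : a⁻¹ ·ᵥ v ≈ᵥ e₀
      scaled zero    = trans (*-comm a⁻¹ (v zero)) (proj₂ (inverse (v zero) ne))
      scaled (suc k) = trans (cong (a⁻¹ *_) (tail≈0 k)) (zeroʳ a⁻¹)
    scaled-e₀ A-sub e₀∉ v∈ tail≈0 (suc k) = tail≈0 k

    graph : ∀ {A : V (suc n) → Set} → IsSub A → ¬ A e₀ → ∀ {v w} → A v → A w →
      (v ∘ suc) ≈ᵥ (w ∘ suc) → v ≈ᵥ w
    graph A-sub e₀∉ {v} {w} v∈ w∈ e k = +-cancelʳ (- w k) _ _ (trans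
      (scaled-e₀ A-sub e₀∉ (Sub.+∈ A-sub v∈ (Sub.-∈ A-sub w∈)) (λ k → trans (cong (_- w (suc k)) (e k)) (-‿inverseʳ _)) k)
      (sym (-‿inverseʳ (w k))))

    -- `A` and `B` stand for the Krylov spaces of `W` and of `π W`. The kernel of the projection is
    -- the part of `A` on the line of e₀, hence of dimension 0 or 1.
    module Fibration {A : V (suc n) → Set} {B : V n → Set} (A-sub : IsSub A)
      (A→B : ∀ {v} → A v → B (v ∘ suc)) (B→A : ∀ {u} → B u → ∃ λ x → A (x ∷ᵥ u)) where

      Ker : V (suc n) → Set
      Ker v = A v × Zero (v ∘ suc)

      Ker-sub : IsSub Ker
      Ker-sub =
        (λ { u v e (u∈ , z) → Sub.resp A-sub e u∈ , Sub.resp Zero-sub (λ k → e (suc k)) z }) ,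
        (Sub.0∈ A-sub , λ _ → refl) ,
        (λ { u v (u∈ , z) (v∈ , z′) → Sub.+∈ A-sub u∈ v∈ , Sub.+∈ Zero-sub z z′ }) ,
        (λ { c v (v∈ , z) → Sub.·∈ A-sub c v∈ , Sub.·∈ Zero-sub c z })

      lift-basis : ∀ {d} → Dim B d → RelBasis A Ker d
      lift-basis {d} C = record
        { basis  = t
        ; basis∈ = λ i → proj₂ (B→A (basis∈ C i))
        ; unique = λ { c c′ (_ , z) (_ , z′) e → unique C c c′ z z′ (λ k → e (suc k)) }
        ; span   = spanning
        }
        where
        t : Fin d → V (suc n)
        t i = proj₁ (B→A (basis∈ C i)) ∷ᵥ basis C i
        spanning : ∀ v → A v → ∃₂ λ s c → Ker s × v ≈ᵥ s +ᵥ lc c t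
        spanning v v∈ with span C (v ∘ suc) (A→B v∈)
        ... | z , c , z≈0 , e = (λ k → v k - lc c t k) , c ,
          (Sub.+∈ A-sub v∈ (Sub.-∈ A-sub (Sub.lc∈ A-sub c (λ i → proj₂ (B→A (basis∈ C i))))) ,
           λ k → trans (cong (_- lc c (basis C) k) (trans (e k) (≈0-+ (lc c (basis C)) z≈0 k))) (-‿inverseʳ _)) ,
          λ k → sym (trans (+-assoc (v k) _ _) (trans (cong (v k +_) (-‿inverseˡ _)) (+-identityʳ (v k))))

      Ker-dim-1 : A e₀ → Dim Ker 1
      Ker-dim-1 e₀∈ = record
        { basis  = λ _ → e₀
        ; basis∈ = λ _ → e₀∈ , λ _ → refl
        ; unique = λ { {s} {s′} c c′ z z′ e zero → trans (sym (coefficient s c z)) (trans (e zero) (coefficient s′ c′ z′)) }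
        ; span   = λ { v (v∈ , z) → 0ᵥ , (λ _ → v zero) , (λ _ → refl) ,
            λ { zero    → sym (trans (+-identityˡ _) (trans (+-identityʳ _) (trans (*-comm (v zero) 1#) (*-identityˡ (v zero)))))
              ; (suc k) → trans (z k) (sym (trans (+-identityˡ _) (trans (+-identityʳ _) (zeroʳ (v zero))))) } }
        }
        where
        coefficient : ∀ s (c : V 1) → Zero s → s zero + (c zero * 1# + 0#) ≡ c zero
        coefficient s c z = trans (cong₂ _+_ (z zero) (+-identityʳ _)) (trans (+-identityˡ _)
          (trans (*-comm (c zero) 1#) (*-identityˡ (c zero))))

      dim-∋ : ∀ {d} → A e₀ → Dim B d → Dim A (suc d)
      dim-∋ {d} e₀∈ C = subst (Dim A) (ℕ.+-comm d 1)
        (RelBasis-+ A-sub Ker-sub (λ _ → proj₁) (lift-basis C) (Ker-dim-1 e₀∈))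

      dim-∌ : ∀ {d} → ¬ A e₀ → Dim B d → Dim A d
      dim-∌ e₀∉ C = RelBasis-cong (λ _ → id) (λ _ → id)
        (λ { v (v∈ , z) → scaled-e₀ A-sub e₀∉ v∈ z })
        (λ v z → Sub.resp A-sub (≈.sym z) (Sub.0∈ A-sub) , λ k → z (suc k))
        (lift-basis C)

  -- U ∩ ε K_j, on which the functional defining `W` must vanish for e₀ to stay outside the Krylov
  -- space of `W` with index `suc j`.
  Meet : ∀ {n} → V n → (V n → Set) → ℕ → V n → Set
  Meet ε U j u = U u × ∃ λ x → K ε U j x × u ≈ᵥ ε ⊛ x

  module MeetProperties {n} (ε : V n) (ε≢0 : ∀ k → ¬ (ε k ≡ 0#)) {U : V n → Set} (U-sub : IsSub U) (U? : Decidable U) where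

    open Krylov ε U-sub

    Image : ℕ → V n → Set
    Image j u = ∃ λ x → K ε U j x × u ≈ᵥ ε ⊛ x

    Image-sub : ∀ j → IsSub (Image j)
    Image-sub j =
      (λ { u v e (x , x∈ , eq) → x , x∈ , ≈.trans (≈.sym e) eq }) ,
      (0ᵥ , Sub.0∈ (K-sub j) , λ k → sym (zeroʳ (ε k))) ,
      (λ { u v (x , x∈ , e) (y , y∈ , e′) → x +ᵥ y , Sub.+∈ (K-sub j) x∈ y∈ ,
           λ k → trans (cong₂ _+_ (e k) (e′ k)) (sym (⊛-+ ε x y k)) }) ,
      (λ { c v (x , x∈ , e) → c ·ᵥ x , Sub.·∈ (K-sub j) c x∈ , λ k → trans (cong (c *_) (e k)) (sym (⊛-· c ε x k)) })

    Meet-sub : ∀ j → IsSub (Meet ε U j)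
    Meet-sub j =
      (λ { u v e (u∈ , i) → Sub.resp U-sub e u∈ , Sub.resp (Image-sub j) e i }) ,
      (Sub.0∈ U-sub , Sub.0∈ (Image-sub j)) ,
      (λ { u v (u∈ , i) (v∈ , i′) → Sub.+∈ U-sub u∈ v∈ , Sub.+∈ (Image-sub j) i i′ }) ,
      (λ { c v (v∈ , i) → Sub.·∈ U-sub c v∈ , Sub.·∈ (Image-sub j) c i })

    Meet? : ∀ j → Decidable (Meet ε U j)
    Meet? j u = U? u ×-dec ∃V? n (λ { e (x∈ , eq) → Sub.resp (K-sub j) e x∈ , ≈.trans eq (⊛-cong ε e) })
      (λ x → K? U? j x ×-dec (u ≟ᵥ (ε ⊛ x)))

    -- Nonvanishing of the entries of ε, which comes from the distinctness of the original diagonal,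
    -- enters here; it makes `Image j` as large as K_j.
    ⊛-cancel : ∀ {u v : V n} → ε ⊛ u ≈ᵥ ε ⊛ v → u ≈ᵥ v
    ⊛-cancel {u} {v} e k = trans (sym (undo (u k))) (trans (cong (a⁻¹ *_) (e k)) (undo (v k)))
      where
      a⁻¹ = proj₁ (inverse (ε k) (ε≢0 k))
      undo : ∀ x → a⁻¹ * (ε k * x) ≡ x
      undo x = trans (sym (*-assoc a⁻¹ (ε k) x)) (trans (cong (_* x)
        (trans (*-comm a⁻¹ (ε k)) (proj₂ (inverse (ε k) (ε≢0 k))))) (*-identityˡ x))

    Image-dim : ∀ j {d} → Dim (K ε U j) d → Dim (Image j) d
    Image-dim j B = record
      { basis  = λ i → ε ⊛ basis B i
      ; basis∈ = λ i → basis B i , basis∈ B i , λ _ → refl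
      ; unique = λ {s} {s′} c c′ z z′ e → unique B {s = 0ᵥ} {s′ = 0ᵥ} c c′ (λ _ → refl) (λ _ → refl)
          (≈.trans (≈0-+ _ (λ _ → refl)) (≈.trans (⊛-cancel (≈.trans (≈.sym (lc-⊛ ε c (basis B)))
            (≈.trans (≈.sym (≈0-+ _ z)) (≈.trans e (≈.trans (≈0-+ _ z′) (lc-⊛ ε c′ (basis B)))))))
            (≈.sym (≈0-+ _ (λ _ → refl)))))
      ; span   = spanning
      }
      where
      spanning : ∀ v → Image j v → ∃₂ λ s c → Zero s × v ≈ᵥ s +ᵥ lc c (λ i → ε ⊛ basis B i)
      spanning v (x , x∈ , e) with span B x x∈
      ... | z , c , z≈0 , e′ = 0ᵥ , c , (λ _ → refl) ,
        ≈.trans e (≈.trans (⊛-cong ε (≈.trans e′ (≈0-+ _ z≈0))) (≈.trans (≈.sym (lc-⊛ ε c (basis B))) (≈.sym (≈0-+ _ (λ _ → refl)))))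

    -- U / (U ∩ εK) ≅ (U + εK) / εK
    second-isomorphism : ∀ j {r} → RelBasis U (Meet ε U j) r → RelBasis (K ε U (suc j)) (Image j) r
    second-isomorphism j {r} B = record
      { basis  = t
      ; basis∈ = λ i → K-generator j (basis∈ B i)
      ; unique = uniq
      ; span   = spanning
      }
      where
      t = basis B
      uniq : ∀ {s s′} c c′ → Image j s → Image j s′ → s +ᵥ lc c t ≈ᵥ s′ +ᵥ lc c′ t → c ≈ᵥ c′
      -- The difference of the two combinations lies in U; being equal to `s′ - s`, it also lies in
      -- the image, hence in `Meet`. So both combinations have the same class modulo `Meet`.
      uniq {s} {s′} c c′ s∈ s′∈ e = unique B {s = 0ᵥ} {s′ = λ k → lc c t k - lc c′ t k} c c′ (Sub.0∈ (Meet-sub j))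
        (Sub.+∈ U-sub (Sub.lc∈ U-sub c (basis∈ B)) (Sub.-∈ U-sub (Sub.lc∈ U-sub c′ (basis∈ B))) ,
         Sub.resp (Image-sub j) rearranged (Sub.+∈ (Image-sub j) s′∈ (Sub.-∈ (Image-sub j) s∈)))
        (λ k → trans (+-identityˡ _) (sym (trans (+-assoc _ _ _) (trans (cong (lc c t k +_) (-‿inverseˡ _)) (+-identityʳ _)))))
        where
        rearranged : (λ k → s′ k - s k) ≈ᵥ (λ k → lc c t k - lc c′ t k)
        rearranged k = sym (trans (difference {p = lc c t k} {y = 0#} {y′ = 0#}
          (trans (cong (s k +_) (+-identityʳ _)) (trans (e k) (cong (s′ k +_) (sym (+-identityʳ _))))))
          (trans (cong ((s′ k - s k) +_) (-‿inverseʳ 0#)) (+-identityʳ _)))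
      spanning : ∀ v → K ε U (suc j) v → ∃₂ λ s c → Image j s × v ≈ᵥ s +ᵥ lc c t
      spanning v (w , x , w∈ , x∈ , e) with span B w w∈
      ... | s , c , (_ , s∈) , e′ = s +ᵥ ε ⊛ x , c , Sub.+∈ (Image-sub j) s∈ (x , x∈ , λ _ → refl) ,
        λ k → trans (e k) (trans (cong (_+ ε k * x k) (e′ k)) (lem (s k) (lc c t k) (ε k * x k)))
        where
        lem : ∀ a b c → (a + b) + c ≡ (a + c) + b
        lem = solve 3 (λ a b c → ((a ⊕ b) ⊕ c) ⊜ ((a ⊕ c) ⊕ b)) refl

    K-suc-dim : ∀ j {r d} → RelBasis U (Meet ε U j) r → Dim (K ε U j) d → Dim (K ε U (suc j)) (r ℕ.+ d)
    K-suc-dim j B C = RelBasis-+ (K-sub (suc j)) (Image-sub j)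
      (λ { v (x , x∈ , e) → Sub.resp (K-sub (suc j)) (≈.sym e) (K-⊛ j x∈) })
      (second-isomorphism j B) (Image-dim j C)

    module _ (μ : List ℕ) (dims : ∀ j → Dim (K ε U j) (D μ j)) where

      -- By the second isomorphism and `Image-dim`, the codimension of `Meet` is dim K_(j+1) - dim
      -- K_j, which is a part of `μ`.
      Meet-basis : ∀ j → RelBasis U (Meet ε U j) (nth μ j)
      Meet-basis j with relBasis U-sub (Meet-sub j) U? (Meet? j)
      ... | r , B = subst (RelBasis U (Meet ε U j)) r≡ B
        where
        r≡ : r ≡ nth μ j
        r≡ = ℕ.+-cancelʳ-≡ (D μ j) r (nth μ j) (trans
          (Dim-unique (K-sub (suc j)) (K-suc-dim j B (dims j)) (dims (suc j)))
          (trans (D-suc μ j) (ℕ.+-comm (D μ j) (nth μ j))))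

      -- `Meet` grows with `j`, so its codimension in U falls. This is what later forces an enlarged
      -- part to sit at a corner.
      increments-antitone : ∀ j → nth μ (suc j) ℕ.≤ nth μ j
      increments-antitone j = RelBasis-≤ U-sub (Meet-sub (suc j)) (λ _ → id)
        (λ { v (v∈ , x , x∈ , e) → v∈ , x , K-suc j x∈ , e }) (Meet-basis j) (Meet-basis (suc j))

  -- Fibres of the projection

  module _ {n : ℕ} where

    Over : Subset n → Subset (suc n) → Set
    Over U W = π W ≗ U

    pullback : Subset n → Subset (suc n)
    pullback U v = U (v ∘ suc)

    Counted-containing-e₀ : ∀ (U : Subset n) → IsSub (Mem U) →
      Counting.Counted (subsets (suc n)) (λ W → (IsSub (Mem W) × Mem W e₀) × Over U W) 1
    Counted-containing-e₀ U U-sub = pullback U ∷ [] , refl , [] ∷ [] ,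
      λ W → mk⇔ (λ { ((W-sub , e₀∈) , over) → here (≗-ext (to W W-sub over) (from W W-sub e₀∈ over)) })
                (λ { (here e) → (IsSub-≗ (λ v → sym (e v)) pullback-sub , trans (e e₀) (Sub.0∈ U-sub)) , over W e })
      where
      pullback-sub : IsSub (Mem (pullback U))
      pullback-sub = (λ u v e → Sub.resp U-sub (λ k → e (suc k))) , Sub.0∈ U-sub ,
        (λ u v → Sub.+∈ U-sub) , (λ c v → Sub.·∈ U-sub c)
      to : ∀ W → IsSub (Mem W) → Over U W → ∀ v → Mem W v → Mem (pullback U) v
      to W W-sub over v v∈ = Mem-resp over _ (π-tail W W-sub v∈)
      from : ∀ W → IsSub (Mem W) → Mem W e₀ → Over U W → ∀ v → Mem (pullback U) v → Mem W v
      -- Some vector of `W` has the tail of `v`; a multiple of e₀ corrects its first coordinate.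
      from W W-sub e₀∈ over v v∈ with π-lift W (Mem-resp (λ u → sym (over u)) (v ∘ suc) v∈)
      ... | x , m = Sub.resp W-sub adjusted (Sub.+∈ W-sub m (Sub.·∈ W-sub (v zero - x) e₀∈))
        where
        adjusted : (x ∷ᵥ (v ∘ suc)) +ᵥ (v zero - x) ·ᵥ e₀ ≈ᵥ v
        adjusted zero = begin
          x + (v zero - x) * 1#  ≡⟨ cong (x +_) (trans (*-comm _ 1#) (*-identityˡ _)) ⟩
          x + (v zero - x)       ≡⟨ +-swap x (v zero) (- x) ⟩
          v zero + (x - x)       ≡⟨ cong (v zero +_) (-‿inverseʳ x) ⟩
          v zero + 0#            ≡⟨ +-identityʳ (v zero) ⟩
          v zero                 ∎
          where open ≡-Reasoning
        adjusted (suc k) = trans (cong (v (suc k) +_) (zeroʳ _)) (+-identityʳ _)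
      over : ∀ W → W ≗ pullback U → Over U W
      over W e = ≗-ext (λ u u∈ → trans (sym (e _)) (proj₂ (π-lift W u∈)))
                       (λ u u∈ → π-∷ W {0#} (trans (e _) u∈))

    -- A subspace over U not containing e₀ is the graph of a linear function
    -- on U; if that function vanishes on S, it is determined by the arbitrary
    -- values y it takes on a basis of U modulo S.
    module Graphs (U : Subset n) (U-sub : IsSub (Mem U)) {S : V n → Set} (S-sub : IsSub S) (S? : Decidable S)
      (S⊆U : ∀ u → S u → Mem U u) {r : ℕ} (B : RelBasis (Mem U) S r) where

      t : Fin r → V n
      t = basis B

      S⁰ : V (suc n) → Set
      S⁰ v = v zero ≡ 0# × S (v ∘ suc)

      S⁰-sub : IsSub S⁰
      S⁰-sub =
        (λ { u v e (z , s∈) → trans (sym (e zero)) z , Sub.resp S-sub (λ k → e (suc k)) s∈ }) ,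
        (refl , Sub.0∈ S-sub) ,
        (λ { u v (z , s∈) (z′ , s′∈) → trans (cong₂ _+_ z z′) (+-identityˡ 0#) , Sub.+∈ S-sub s∈ s′∈ }) ,
        (λ { c v (z , s∈) → trans (cong (c *_) z) (zeroʳ c) , Sub.·∈ S-sub c s∈ })

      S⁰? : Decidable S⁰
      S⁰? v = (v zero ≟F 0#) ×-dec S? (v ∘ suc)

      t⁺ : V r → Fin r → V (suc n)
      t⁺ y i = y i ∷ᵥ t i

      Graph : V r → V (suc n) → Set
      Graph y = Spanned S⁰ (t⁺ y)

      Graph? : ∀ y → Decidable (Graph y)
      Graph? y = Spanned? S⁰-sub S⁰? (t⁺ y)

      Graph-sub : ∀ y → IsSub (Graph y)
      Graph-sub y = Spanned-sub S⁰-sub (t⁺ y)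

      graphᵇ : V r → Subset (suc n)
      graphᵇ y v = does (Graph? y v)

      graphᵇ⁻ : ∀ y v → Mem (graphᵇ y) v → Graph y v
      graphᵇ⁻ y v = does-sound (Graph? y v)

      graphᵇ⁺ : ∀ y v → Graph y v → Mem (graphᵇ y) v
      graphᵇ⁺ y v = dec-true (Graph? y v)

      graphᵇ-sub : ∀ y → IsSub (Mem (graphᵇ y))
      graphᵇ-sub y = IsSub-cong (graphᵇ⁺ y) (graphᵇ⁻ y) (Graph-sub y)

      Admissible : Subset (suc n) → Set
      Admissible W = (IsSub (Mem W) × ¬ Mem W e₀ × (∀ u → S u → Mem W (0# ∷ᵥ u))) × Over U W

      t⁺∈ : ∀ y i → Graph y (t⁺ y i)
      t⁺∈ y i = 0ᵥ , unit i , (refl , Sub.0∈ S-sub) , λ k → sym (trans (+-identityˡ _) (lc-unit i (t⁺ y) k))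

      S∈ : ∀ y u → S u → Graph y (0# ∷ᵥ u)
      S∈ y u u∈ = (0# ∷ᵥ u) , 0ᵥ , (refl , u∈) , λ k → sym (trans (cong (_ +_) (lc-0 (t⁺ y) k)) (+-identityʳ _))

      Graph-cong : ∀ {y y′} → y ≈ᵥ y′ → ∀ v → Graph y v → Graph y′ v
      Graph-cong {y} {y′} e v (s , c , s∈ , eq) = s , c , s∈ , λ k → trans (eq k) (cong (s k +_) (lc-t⁺ k))
        where
        lc-t⁺ : lc c (t⁺ y) ≈ᵥ lc c (t⁺ y′)
        lc-t⁺ zero    = lc-cong₂ c e
          where
          lc-cong₂ : ∀ {d} (c : V d) {y y′ : V d} → y ≈ᵥ y′ → lc {n = 1} c (λ i _ → y i) zero ≡ lc {n = 1} c (λ i _ → y′ i) zero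
          lc-cong₂ {zero}  c e = refl
          lc-cong₂ {suc d} c e = cong₂ _+_ (cong (c zero *_) (e zero)) (lc-cong₂ (c ∘ suc) (e ∘ suc))
        lc-t⁺ (suc k) = refl

      graphᵇ-injective : ∀ {y y′} → graphᵇ y ≗ graphᵇ y′ → y ≈ᵥ y′
      graphᵇ-injective {y} {y′} e i with graphᵇ⁻ y′ _ (Mem-resp e _ (graphᵇ⁺ y _ (t⁺∈ y i)))
      ... | s , c , (s0 , s∈) , eq = begin
        y i                              ≡⟨ eq zero ⟩
        s zero + lc c (t⁺ y′) zero       ≡⟨ cong (_+ lc c (t⁺ y′) zero) s0 ⟩
        0# + lc c (t⁺ y′) zero           ≡⟨ +-identityˡ _ ⟩
        lc c (t⁺ y′) zero                ≡⟨ lc-cong (t⁺ y′) c≈unit zero ⟩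
        lc (unit i) (t⁺ y′) zero         ≡⟨ lc-unit i (t⁺ y′) zero ⟩
        y′ i                             ∎
        where
        open ≡-Reasoning
        -- The tail of `eq` expands `t i` modulo `S`, which leaves no choice for the coefficients.
        c≈unit : c ≈ᵥ unit i
        c≈unit = unique B {s′ = 0ᵥ} c (unit i) s∈ (Sub.0∈ S-sub)
          (λ k → trans (sym (eq (suc k))) (sym (trans (+-identityˡ _) (lc-unit i t k))))

      e₀∉Graph : ∀ y → ¬ Graph y e₀
      e₀∉Graph y (s , c , (s0 , s∈) , eq) = 𝟘≢𝟙 (sym (begin
        1#                          ≡⟨ eq zero ⟩
        s zero + lc c (t⁺ y) zero   ≡⟨ cong (_+ lc c (t⁺ y) zero) s0 ⟩
        0# + lc c (t⁺ y) zero       ≡⟨ +-identityˡ _ ⟩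
        lc c (t⁺ y) zero            ≡⟨ lc-cong (t⁺ y) c≈0 zero ⟩
        lc 0ᵥ (t⁺ y) zero           ≡⟨ lc-0 (t⁺ y) zero ⟩
        0#                          ∎))
        where
        open ≡-Reasoning
        c≈0 : c ≈ᵥ 0ᵥ
        c≈0 = unique B {s′ = 0ᵥ} c 0ᵥ s∈ (Sub.0∈ S-sub)
          (λ k → trans (sym (eq (suc k))) (sym (trans (+-identityˡ _) (lc-0 t k))))

      Graph-over : ∀ y {x u} → Graph y (x ∷ᵥ u) → Mem U u
      Graph-over y (s , c , (_ , s∈) , eq) = Sub.resp U-sub (λ k → sym (eq (suc k)))
        (Sub.+∈ U-sub (S⊆U _ s∈) (Sub.lc∈ U-sub c (basis∈ B)))

      point : ∀ y {u} → Mem U u → ∃ λ v → Graph y v × (v ∘ suc) ≈ᵥ u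
      point y {u} u∈ with span B u u∈
      ... | s , c , s∈ , e = (0# ∷ᵥ s) +ᵥ lc c (t⁺ y) , ((0# ∷ᵥ s) , c , (refl , s∈) , λ _ → refl) , λ k → sym (e k)

      graphᵇ-admissible : ∀ y → Admissible (graphᵇ y)
      graphᵇ-admissible y = (graphᵇ-sub y , (λ e₀∈ → e₀∉Graph y (graphᵇ⁻ y _ e₀∈)) , (λ u u∈ → graphᵇ⁺ y _ (S∈ y u u∈))) ,
        ≗-ext (λ u u∈ → Graph-over y (graphᵇ⁻ y _ (proj₂ (π-lift (graphᵇ y) u∈))))
              (λ u u∈ → let (v , v∈ , e) = point y u∈ in
                Sub.resp (π-sub (graphᵇ y) (graphᵇ-sub y)) e (π-tail (graphᵇ y) (graphᵇ-sub y) (graphᵇ⁺ y v v∈)))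

      Admissible-resp : ∀ {W W′} → W ≗ W′ → Admissible W → Admissible W′
      Admissible-resp {W} {W′} e ((W-sub , e₀∉ , S⊆) , over) =
        (IsSub-≗ e W-sub , (λ e₀∈ → e₀∉ (trans (e _) e₀∈)) , (λ u u∈ → Mem-resp e _ (S⊆ u u∈))) ,
        λ u → trans (sym (π-cong u)) (over u)
        where
        π-cong : π W ≗ π W′
        π-cong = ≗-ext (λ u u∈ → π-∷ W′ (Mem-resp e _ (proj₂ (π-lift W u∈))))
                       (λ u u∈ → π-∷ W (Mem-resp (λ v → sym (e v)) _ (proj₂ (π-lift W′ u∈))))

      -- Lifting the basis into `W` gives the values `y`, and the graph of `y` lies in `W`. Equality
      -- follows because both project onto `U` and `W` contains at most one vector over each point.
      graphᵇ-onto : ∀ W → Admissible W → ∃ λ y → ⊤ × W ≗ graphᵇ y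
      graphᵇ-onto W ((W-sub , e₀∉ , S⊆) , over) = y , _ , ≗-ext
        (λ v v∈ → graphᵇ⁺ y v (let (w , w∈ , e) = point y (Mem-resp over _ (π-tail W W-sub v∈)) in
          Sub.resp (Graph-sub y) (graph W-sub e₀∉ (Graph⊆W w w∈) v∈ e) w∈))
        (λ v v∈ → Graph⊆W v (graphᵇ⁻ y v v∈))
        where
        values : ∀ i → ∃ λ x → Mem W (x ∷ᵥ t i)
        values i = π-lift W (Mem-resp (λ u → sym (over u)) (t i) (basis∈ B i))
        y : V r
        y i = proj₁ (values i)
        Graph⊆W : ∀ v → Graph y v → Mem W v
        Graph⊆W v (s , c , (s0 , s∈) , eq) = Sub.resp W-sub (≈.sym eq) (Sub.+∈ W-sub
          (Sub.resp W-sub (≈.trans (∷-cong (sym s0) (λ _ → refl)) (≈.sym (∷-η s))) (S⊆ _ s∈))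
          (Sub.lc∈ W-sub c (λ i → proj₂ (values i))))

      Counted-Admissible : Counting.Counted (subsets (suc n)) Admissible (q ℕ.^ r)
      Counted-Admissible = Counted-image (vectors r) (subsets (suc n)) graphᵇ (Counted-V r)
        (λ {y} {y′} e → ≗-ext (λ v v∈ → graphᵇ⁺ y′ v (Graph-cong e v (graphᵇ⁻ y v v∈)))
                              (λ v v∈ → graphᵇ⁺ y v (Graph-cong (≈.sym e) v (graphᵇ⁻ y′ v v∈))))
        (λ _ _ → graphᵇ-injective) Admissible-resp (λ y _ → graphᵇ-admissible y) graphᵇ-onto

  -- Adjoining a coordinate on which the operator vanishes

  module Step {n} (ε : V (suc n)) (ε₀≡0 : ε zero ≡ 0#) (ε≢0 : ∀ k → ¬ (ε (suc k) ≡ 0#)) where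

    ε′ : V n
    ε′ = ε ∘ suc

    K-π : ∀ W → IsSub (Mem W) → ∀ j {v} → K ε (Mem W) j v → K ε′ (Mem (π W)) j (v ∘ suc)
    K-π W W-sub zero    z≈0 = λ k → z≈0 (suc k)
    K-π W W-sub (suc j) (w , x , w∈ , x∈ , e) =
      w ∘ suc , x ∘ suc , π-tail W W-sub w∈ , K-π W W-sub j x∈ , λ k → e (suc k)

    K-lift : ∀ W → ∀ j {u} → K ε′ (Mem (π W)) j u → ∃ λ x → K ε (Mem W) j (x ∷ᵥ u)
    K-lift W zero    z≈0 = 0# , λ { zero → refl ; (suc k) → z≈0 k }
    K-lift W (suc j) (w , z , w∈ , z∈ , e) with π-lift W w∈ | K-lift W j z∈
    -- Since ε kills the first coordinate, `y` has no influence and the lift keeps the coordinate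
    -- `x` of its summand in `W`.
    ... | x , m | y , m′ = x , (x ∷ᵥ w) , (y ∷ᵥ z) , m , m′ ,
      λ { zero    → sym (trans (cong (λ a → x + a * y) ε₀≡0) (trans (cong (x +_) (zeroˡ y)) (+-identityʳ x)))
        ; (suc k) → e k }

    module _ (W : Subset (suc n)) (W-sub : IsSub (Mem W)) where

      open Krylov ε W-sub using (K-sub; K-generator)

      Enters : ℕ → Set
      Enters j = K ε (Mem W) j e₀

      Enters? : ∀ j → Dec (Enters j)
      Enters? j = Krylov.K? ε W-sub (Mem? W) j e₀

      ¬Enters-0 : ¬ Enters 0
      ¬Enters-0 e₀≈0 = 𝟘≢𝟙 (sym (e₀≈0 zero))

      Enters-≤ : ∀ {i j} → i ℕ.≤ j → Enters i → Enters j
      Enters-≤ = Krylov.K-≤ ε W-sub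

      open module F j = Fibration {n} {K ε (Mem W) j} {K ε′ (Mem (π W)) j} (K-sub j) (K-π W W-sub j) (K-lift W j)
        public using (dim-∋; dim-∌)

      -- For u = ε′ z with lifts `x ∷ᵥ u` in `W` and `y ∷ᵥ z` in the j-th space, (x, u) - ε (y, z)
      -- is x e₀ and lies in the next space. If e₀ does not, then x = 0.
      ¬Enters⇒⊇ : ∀ j → ¬ Enters (suc j) → ∀ u → Meet ε′ (Mem (π W)) j u → Mem W (0# ∷ᵥ u)
      ¬Enters⇒⊇ j e₀∉ u (u∈ , z , z∈ , eq) with π-lift W u∈ | K-lift W j z∈
      ... | x , m | y , m′ = Sub.resp W-sub (∷-cong x≡0 (λ _ → refl)) m
        where
        v : V (suc n)
        v k = (x ∷ᵥ u) k - ε k * (y ∷ᵥ z) k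
        v∈ : K ε (Mem W) (suc j) v
        v∈ = Sub.+∈ (K-sub (suc j)) (K-generator j m) (Sub.-∈ (K-sub (suc j)) (Krylov.K-⊛ ε W-sub j m′))
        v₀ : v zero ≡ x
        v₀ = trans (cong (λ a → x - a * y) ε₀≡0) (trans (cong (λ a → x - a) (zeroˡ y))
          (trans (cong (x +_) (trans (sym (+-identityˡ _)) (-‿inverseʳ 0#))) (+-identityʳ x)))
        x≡0 : x ≡ 0#
        x≡0 = trans (sym v₀) (scaled-e₀ (K-sub (suc j)) e₀∉ v∈
          (λ k → trans (cong (_- ε (suc k) * z k) (eq k)) (-‿inverseʳ _)) zero)

      -- If e₀ = w + ε x, the negated tail of w equals ε′ times the tail of x and so lies in `Meet`.
      -- Adding its lift with first coordinate 0 to w gives e₀ inside `W`.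
      ⊇⇒¬Enters : ∀ j → ¬ Mem W e₀ → (∀ u → Meet ε′ (Mem (π W)) j u → Mem W (0# ∷ᵥ u)) → ¬ Enters (suc j)
      ⊇⇒¬Enters j e₀∉ S⊆ (w , x , w∈ , x∈ , eq) = e₀∉ (Sub.resp W-sub cancelled (Sub.+∈ W-sub w∈ -w∈))
        where
        tail-meets : Meet ε′ (Mem (π W)) j (λ k → - w (suc k))
        tail-meets = Sub.-∈ (π-sub W W-sub) (π-tail W W-sub w∈) , x ∘ suc , K-π W W-sub j x∈ ,
          λ k → sym (+-cancelˡ (w (suc k)) _ _ (trans (sym (eq (suc k))) (sym (-‿inverseʳ (w (suc k))))))
        -w∈ : Mem W (0# ∷ᵥ (λ k → - w (suc k)))
        -w∈ = S⊆ _ tail-meets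
        cancelled : w +ᵥ (0# ∷ᵥ (λ k → - w (suc k))) ≈ᵥ e₀
        cancelled zero    = trans (+-identityʳ _) (sym (trans (eq zero)
          (trans (cong (λ a → w zero + a * x zero) ε₀≡0) (trans (cong (w zero +_) (zeroˡ (x zero))) (+-identityʳ _)))))
        cancelled (suc k) = -‿inverseʳ (w (suc k))

    module _ (U : Subset n) (U-sub : IsSub (Mem U)) (ν : List ℕ) (dims : ∀ j → Dim (K ε′ (Mem U) j) (D ν j)) where

      open MeetProperties ε′ ε≢0 U-sub (Mem? U)

      Meet-over : ∀ {U U′ : Subset n} → U ≗ U′ → ∀ j u → Meet ε′ (Mem U) j u → Meet ε′ (Mem U′) j u
      Meet-over e j u (u∈ , x , x∈ , eq) = Mem-resp e u u∈ , x , K-mono ε′ (Mem-resp e) j x∈ , eq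

      Counted-¬Enters : ∀ j → Counting.Counted (subsets (suc n))
        (λ W → (IsSub (Mem W) × ¬ K ε (Mem W) (suc j) e₀) × Over U W) (q ℕ.^ nth ν j)
      Counted-¬Enters j = Counting.Counted-cong (subsets (suc n))
        (Graphs.Counted-Admissible U U-sub (Meet-sub j) (Meet? j) (λ _ → proj₁) (Meet-basis ν dims j))
        (λ { W ((W-sub , e₀∉ , S⊆) , over) → (W-sub , ⊇⇒¬Enters W W-sub j e₀∉ (λ u → S⊆ u ∘ Meet-over over j u)) , over })
        (λ { W ((W-sub , ¬enters) , over) → (W-sub , (λ e₀∈ → ¬enters (Krylov.K-generator ε W-sub j e₀∈)) ,
             (λ u → ¬Enters⇒⊇ W W-sub j ¬enters u ∘ Meet-over (λ v → sym (over v)) j u)) , over })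

      EntersAt : ℕ → Subset (suc n) → Set
      EntersAt j W = (IsSub (Mem W) × K ε (Mem W) (suc j) e₀ × ¬ K ε (Mem W) j e₀) × Over U W

      Counted-EntersAt-0 : Counting.Counted (subsets (suc n)) (EntersAt 0) 1
      Counted-EntersAt-0 = Counting.Counted-cong (subsets (suc n)) (Counted-containing-e₀ U U-sub)
        (λ { W ((W-sub , e₀∈) , over) → (W-sub , Krylov.K-generator ε W-sub 0 e₀∈ , ¬Enters-0 W W-sub) , over })
        (λ { W ((W-sub , enters , _) , over) → (W-sub , Krylov.K-1 ε W-sub enters) , over })

      Counted-EntersAt-suc : ∀ j → Counting.Counted (subsets (suc n)) (EntersAt (suc j))
        (q ℕ.^ nth ν j ℕ.∸ q ℕ.^ nth ν (suc j))
      Counted-EntersAt-suc j = Counting.Counted-cong (subsets (suc n))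
        (Counting.Counted-∸ (subsets (suc n)) (Counted-¬Enters j) (Counted-¬Enters (suc j))
          (λ { W ((W-sub , ¬enters) , over) → (W-sub , λ enters → ¬enters (Enters-≤ W W-sub (ℕ.n≤1+n _) enters)) , over })
          (λ { {W} ((W-sub , _) , over) → map′ (λ ¬enters → (W-sub , ¬enters) , over) (λ { ((_ , ¬enters) , _) → ¬enters })
               (¬? (Enters? W W-sub (suc (suc j)))) }))
        (λ { W (((W-sub , ¬enters) , over) , ¬later) → (W-sub ,
             decidable-stable (Enters? W W-sub (suc (suc j))) (λ ¬enters′ → ¬later ((W-sub , ¬enters′) , over)) , ¬enters) , over })
        (λ { W ((W-sub , enters , ¬enters) , over) → ((W-sub , ¬enters) , over) , λ { ((_ , ¬later) , _) → ¬later enters } })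

  -- Profiles

  Profile : ∀ {n} → V n → List ℕ → Subset n → Set
  Profile ε μ W = IsSub (Mem W) × ∀ j → Dim (K ε (Mem W) j) (D μ j)

  Profile-shift : ∀ {n} {ε ε′ : V n} μ a a′ → (∀ k → ε k ≡ ε′ k + a) → (∀ k → ε′ k ≡ ε k + a′) →
    ∀ W → Profile ε μ W → Profile ε′ μ W
  Profile-shift μ a a′ h h′ W (W-sub , dims) = W-sub , λ j → RelBasis-cong
    (λ v → K-shift W-sub a h j) (λ v → K-shift W-sub a′ h′ j) (λ _ → id) (λ _ → id) (dims j)

  Counted-Profile-0 : (ε : V 0) (μ : List ℕ) →
    Counting.Counted (subsets 0) (Profile ε μ) (sigmaFormula q 0 μ)
  Counted-Profile-0 ε μ = go (ListAction.sum μ) refl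
    where
    D-0 : ListAction.sum μ ≡ 0 → ∀ j → D μ j ≡ 0
    D-0 eq j = ℕ.n≤0⇒n≡0 (subst (D μ j ℕ.≤_) eq (take-sum j μ))
      where
      take-sum : ∀ j μ → D μ j ℕ.≤ ListAction.sum μ
      take-sum zero    μ       = z≤n
      take-sum (suc j) []      = z≤n
      take-sum (suc j) (x ∷ μ) = ℕ.+-monoʳ-≤ x (take-sum j μ)
    full : ∀ {W} → W ≗ (λ _ → true) → ∀ j v → K ε (Mem W) j v
    full e zero    v = λ ()
    full e (suc j) v = v , v , e v , full e j v , λ ()
    go : ∀ N → ListAction.sum μ ≡ N → Counting.Counted (subsets 0) (Profile ε μ) (sigmaFormula q 0 μ)
    go zero eq = subst (Counting.Counted (subsets 0) (Profile ε μ)) (sym (sigmaFormula-0-zero q μ eq))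
      ((λ _ → true) ∷ [] , refl , [] ∷ [] , λ W → mk⇔
        (λ { (W-sub , _) → here (λ v → Sub.resp W-sub (λ ()) (Sub.0∈ W-sub)) })
        (λ { (here e) → ((λ u v _ _ → e v) , e _ , (λ u v _ _ → e _) , (λ c v _ → e _)) ,
             λ j → subst (Dim _) (sym (D-0 eq j))
               (RelBasis-cong (λ v _ → full e j v) (λ _ _ ()) (λ _ → id) (λ _ → id) Dim-Zero) }))
    go (suc N) eq = subst (Counting.Counted (subsets 0) (Profile ε μ)) (sym (sigmaFormula-0-suc q μ eq))
      (Counting.Counted-∅ (subsets 0) (λ { W (W-sub , dims) → ℕ.1+n≰n (ℕ.≤-trans
        (subst (ℕ._≤ 0) (trans (D-all μ ℕ.≤-refl) eq)
          (Dim-≤ (Krylov.K-sub ε W-sub (List.length μ)) (λ _ _ ()) (dims (List.length μ)) Dim-Zero)) z≤n) }))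

  -- The recursion in n for the number of subspaces of given profile

  module Recursion {n} (ε : V (suc n)) (ε₀≡0 : ε zero ≡ 0#) (ε≢0 : ∀ k → ¬ (ε (suc k) ≡ 0#))
    (count : ∀ ν → Linked ℕ._≥_ ν → Counting.Counted (subsets n) (Profile (ε ∘ suc) ν) (sigmaFormula q n ν))
    (μ : List ℕ) (desc : Linked ℕ._≥_ μ) where

    open Step ε ε₀≡0 ε≢0
    open Counting (subsets (suc n))

    len : ℕ
    len = List.length μ

    column : ℕ → ℕ
    column i = pred (countGe (suc i) μ)

    EntersIn : ℕ → Subset (suc n) → Set
    EntersIn j W = IsSub (Mem W) × K ε (Mem W) (suc j) e₀ × ¬ K ε (Mem W) j e₀

    -- Testing up to `suc len` suffices, as e₀ can enter only where `μ` has a positive part. At that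
    -- step the fibre has q^0 = 1 element, `nth μ len` being 0.
    Never : Subset (suc n) → Set
    Never W = (IsSub (Mem W) × ¬ K ε (Mem W) (suc len) e₀) × Profile ε′ μ (π W)

    -- Indexed by the rows of `conj μ`, as in the recursion for the formula. Equal parts of `μ`
    -- share one corner, and the corner condition selects the single column where e₀ can enter.
    AtRow : ℕ → Subset (suc n) → Set
    AtRow i W = nth μ (column i) ≡ suc i × EntersIn (column i) W × Profile ε′ (decAt (column i) μ) (π W)

    Counted-Never : Counted Never (sigmaFormula q n μ)
    Counted-Never = subst (Counted Never) (trans (cong (λ k → sigmaFormula q n μ ℕ.* q ℕ.^ k) (nth-length μ)) (ℕ.*-identityʳ _))
      (Counted-fibre (subsets n) (subsets (suc n)) π (count μ desc)
        (λ { U (U-sub , dims) → Counted-¬Enters U U-sub μ dims len }))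

    Counted-EntersIn : ∀ {i} j → countGe (suc i) μ ≡ suc j → nth μ j ≡ suc i →
      Counted (λ W → EntersIn j W × Profile ε′ (decAt j μ) (π W)) (sigmaFormula q n (decAt j μ) ℕ.* stepWeight q i j μ)
    Counted-EntersIn zero    l≡ m≡ = Counted-fibre (subsets n) (subsets (suc n)) π
      (count (decAt 0 μ) (decAt-corner-Linked desc l≡ m≡))
      (λ { U (U-sub , dims) → Counted-EntersAt-0 U U-sub (decAt 0 μ) dims })
    Counted-EntersIn {i} (suc j) l≡ m≡ = Counted-fibre (subsets n) (subsets (suc n)) π
      (count (decAt (suc j) μ) (decAt-corner-Linked desc l≡ m≡))
      (λ { U (U-sub , dims) → subst (Counted (EntersAt U U-sub (decAt (suc j) μ) dims (suc j)))
        (cong₂ (λ x y → q ℕ.^ x ℕ.∸ q ℕ.^ y) (nth-decAt-≢ (suc j) j μ ℕ.1+n≢n) (trans (nth-decAt (suc j) μ) (cong pred m≡)))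
        (Counted-EntersAt-suc U U-sub (decAt (suc j) μ) dims j) })

    Counted-AtRow : ∀ i → i ℕ.< head0 μ → Counted (AtRow i) (rowCount q n μ i)
    Counted-AtRow i i<M with row-nonempty desc i<M
    ... | j , l≡ with nth μ j ℕ.≟ suc i
    ...   | yes m≡ = subst (Counted (AtRow i)) (sym (rowCount-corner q n μ l≡ m≡))
      (Counted-cong (Counted-EntersIn j l≡ m≡)
        (λ W p → subst (λ j → nth μ j ≡ suc i × EntersIn j W × Profile ε′ (decAt j μ) (π W)) (sym (cong pred l≡)) (m≡ , p))
        (λ W p → proj₂ (subst (λ j → nth μ j ≡ suc i × EntersIn j W × Profile ε′ (decAt j μ) (π W)) (cong pred l≡) p)))
    ...   | no m≢ = subst (Counted (AtRow i)) (sym (rowCount-noncorner q n μ l≡ m≢))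
      (Counted-∅ (λ W p → m≢ (subst (λ j → nth μ j ≡ suc i) (cong pred l≡) (proj₁ p))))

    entry-unique : ∀ {j j′ W} → EntersIn j W → EntersIn j′ W → j ≡ j′
    entry-unique {j} {j′} {W} (W-sub , in₁ , out₁) (_ , in₂ , out₂) = ℕ.≤-antisym
      (ℕ.≮⇒≥ (λ j′<j → out₁ (Enters-≤ W W-sub j′<j in₂)))
      (ℕ.≮⇒≥ (λ j<j′ → out₂ (Enters-≤ W W-sub j<j′ in₁)))

    AtRow-unique : ∀ i i′ W → AtRow i W → AtRow i′ W → i ≡ i′
    AtRow-unique i i′ W (m≡ , enters , _) (m≡′ , enters′ , _) =
      ℕ.suc-injective (trans (sym m≡) (trans (cong (nth μ) (entry-unique enters enters′)) m≡′))

    Never-AtRow : ∀ W → Never W → ¬ (∃ λ i → i ℕ.< head0 μ × AtRow i W)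
    Never-AtRow W ((W-sub , never) , _) (i , _ , m≡ , (_ , enters , _) , _) =
      never (Enters-≤ W W-sub (ℕ.s≤s (ℕ.<⇒≤ (nth>0⇒<length μ m≡))) enters)

    first-entry : ∀ W (W-sub : IsSub (Mem W)) m →
      ¬ K ε (Mem W) m e₀ ⊎ ∃ λ j → j ℕ.< m × EntersIn j W
    first-entry W W-sub zero    = inj₁ (¬Enters-0 W W-sub)
    first-entry W W-sub (suc m) with first-entry W W-sub m
    ... | inj₂ (j , j<m , enters) = inj₂ (j , ℕ.m<n⇒m<1+n j<m , enters)
    ... | inj₁ out with Enters? W W-sub (suc m)
    ...   | yes enters = inj₂ (m , ℕ.n<1+n m , W-sub , enters , out)
    ...   | no out′    = inj₁ out′

    module _ (W : Subset (suc n)) (W-sub : IsSub (Mem W)) where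

      private
        U-sub = π-sub W W-sub
        module KW = Krylov ε W-sub
        module KU = Krylov ε′ U-sub

      Never⇒Profile : Never W → Profile ε μ W
      Never⇒Profile ((_ , never) , (_ , dims)) = W-sub , Stable.Dim-stable ε W-sub μ
        (λ j le → dim-∌ W W-sub j (never ∘ Enters-≤ W W-sub (ℕ.m≤n⇒m≤1+n le)) (dims j))
        (subst (Dim (K ε (Mem W) (suc len))) (trans (D-all μ (ℕ.n≤1+n len)) (sym (D-all μ ℕ.≤-refl)))
          (dim-∌ W W-sub (suc len) never (dims (suc len))))

      AtRow⇒Profile : ∀ {i} → AtRow i W → Profile ε μ W
      AtRow⇒Profile {i} (m≡ , (_ , enters , out) , (_ , dims)) = W-sub , dim
        where
        dim : ∀ t → Dim (K ε (Mem W) t) (D μ t)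
        dim t with t ℕ.≤? column i
        ... | yes t≤ = subst (Dim (K ε (Mem W) t)) (D-decAt-≤ μ t t≤)
                         (dim-∌ W W-sub t (out ∘ Enters-≤ W W-sub t≤) (dims t))
        ... | no t≰  = subst (Dim (K ε (Mem W) t)) (sym (D-decAt-> μ t m≡ (ℕ.≰⇒> t≰)))
                         (dim-∋ W W-sub t (Enters-≤ W W-sub (ℕ.≰⇒> t≰) enters) (dims t))

      dimU : ∀ t → ∃ (Dim (K ε′ (Mem (π W)) t))
      dimU = KU.K-dim (Mem? (π W))

      module _ (dims : ∀ t → Dim (K ε (Mem W) t) (D μ t)) where

        before : ∀ t → ¬ K ε (Mem W) t e₀ → Dim (K ε′ (Mem (π W)) t) (D μ t)
        before t out with dimU t
        ... | d , B = subst (Dim (K ε′ (Mem (π W)) t)) (Dim-unique (KW.K-sub t) (dim-∌ W W-sub t out B) (dims t)) B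

        after : ∀ t → K ε (Mem W) t e₀ → ∃ λ d → Dim (K ε′ (Mem (π W)) t) d × D μ t ≡ suc d
        after t enters with dimU t
        ... | d , B = d , B , Dim-unique (KW.K-sub t) (dims t) (dim-∋ W W-sub t enters B)

        Profile⇒Never : ¬ K ε (Mem W) (suc len) e₀ → Never W
        Profile⇒Never never = (W-sub , never) , U-sub , Stable.Dim-stable ε′ U-sub μ
          (λ j le → before j (never ∘ Enters-≤ W W-sub (ℕ.m≤n⇒m≤1+n le)))
          (subst (Dim (K ε′ (Mem (π W)) (suc len))) (trans (D-all μ (ℕ.n≤1+n len)) (sym (D-all μ ℕ.≤-refl)))
            (before (suc len) never))

        corner⇒AtRow : ∀ {i j} → EntersIn j W → nth μ j ≡ suc i → i ℕ.< head0 μ × AtRow i W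
        corner⇒AtRow {i} {j} enters-in@(_ , enters , out) m≡ = subst (ℕ._≤ head0 μ) m≡ (nth-≤-head0 desc j) ,
          subst (λ j → nth μ j ≡ suc i × EntersIn j W × Profile ε′ (decAt j μ) (π W)) (sym (cong pred l≡))
            (m≡ , enters-in , U-sub , dims′)
          where
          ν = decAt j μ
          dims′ : ∀ t → Dim (K ε′ (Mem (π W)) t) (D ν t)
          dims′ t with t ℕ.≤? j
          ... | yes t≤ = subst (Dim (K ε′ (Mem (π W)) t)) (sym (D-decAt-≤ μ t t≤)) (before t (out ∘ Enters-≤ W W-sub t≤))
          ... | no t≰ = let (d , B , D≡) = after t (Enters-≤ W W-sub (ℕ.≰⇒> t≰) enters) in
                subst (Dim (K ε′ (Mem (π W)) t)) (ℕ.suc-injective (trans (sym D≡) (D-decAt-> μ t m≡ (ℕ.≰⇒> t≰)))) B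
          l≡ : countGe (suc i) μ ≡ suc j
          -- By `dims′` the increments for `π W` are the parts of `ν`, and they decrease. Hence the
          -- part of `μ` after position `j` is at most `i`, the lowered part.
          l≡ = corner-row desc j m≡ (subst₂ ℕ._≤_ (nth-decAt-≢ j (suc j) μ (ℕ.1+n≢n ∘ sym))
            (trans (nth-decAt j μ) (cong pred m≡))
            (MeetProperties.increments-antitone ε′ ε≢0 U-sub (Mem? (π W)) ν dims′ j))

        -- At the entry of e₀ the space of `W` exceeds that of `π W` by one dimension, while the
        -- latter still contains its predecessor, of dimension `D μ j`. So `D μ` must grow.
        part>0 : ∀ {j} → EntersIn j W → nth μ j ≢ 0
        part>0 {j} (_ , enters , out) m≡0 = let (d , B , D≡) = after (suc j) enters in
          ℕ.<-irrefl (trans (sym (ℕ.+-identityʳ (D μ j))) (trans (cong (D μ j ℕ.+_) (sym m≡0)) (sym (D-suc μ j))))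
            (subst (D μ j ℕ.<_) (sym D≡) (ℕ.s≤s (Dim-≤ (KU.K-sub j) (λ v → KU.K-suc j) (before j out) B)))

        Profile⇒AtRow : ∀ {j} → EntersIn j W → ∃ λ i → i ℕ.< head0 μ × AtRow i W
        Profile⇒AtRow {j} enters = pred (nth μ j) ,
          corner⇒AtRow enters (sym (ℕ.suc-pred (nth μ j) {{ℕ.≢-nonZero (part>0 enters)}}))

        classify : Never W ⊎ ∃ λ i → i ℕ.< head0 μ × AtRow i W
        classify with first-entry W W-sub (suc len)
        ... | inj₁ never             = inj₁ (Profile⇒Never never)
        ... | inj₂ (j , _ , enters)  = inj₂ (Profile⇒AtRow enters)

    Counted-Profile-suc : Counted (Profile ε μ) (sigmaFormula q (suc n) μ)
    Counted-Profile-suc = subst (Counted (Profile ε μ)) (sym (sigmaFormula-rec desc (ℕ.<-trans ℕ.z<s 1<q) n))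
      (Counted-cong
        (Counted-⊎ Counted-Never
          (Counted-∑ (head0 μ) AtRow (rowCount q n μ) Counted-AtRow (λ i j W _ _ → AtRow-unique i j W))
          Never-AtRow)
        (λ { W (inj₁ p@((W-sub , _) , _))                       → Never⇒Profile W W-sub p
           ; W (inj₂ (i , _ , p@(_ , (W-sub , _) , _))) → AtRow⇒Profile W W-sub p })
        (λ { W (W-sub , dims) → classify W W-sub dims }))

  Counted-Profile : ∀ n (δ : V n) → (∀ {i j} → δ i ≡ δ j → i ≡ j) → ∀ μ → Linked ℕ._≥_ μ →
    Counting.Counted (subsets n) (Profile δ μ) (sigmaFormula q n μ)
  Counted-Profile zero    δ δ-inj μ desc = Counted-Profile-0 δ μ
  Counted-Profile (suc n) δ δ-inj μ desc = Counting.Counted-cong (subsets (suc n))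
    (Recursion.Counted-Profile-suc ε (-‿inverseʳ (δ zero)) ε≢0 (Counted-Profile n (ε ∘ suc) ε-inj) μ desc)
    (Profile-shift μ (- δ zero) (δ zero) (λ _ → refl) restore)
    (Profile-shift μ (δ zero) (- δ zero) restore (λ _ → refl))
    where
    ε : V (suc n)
    ε k = δ k - δ zero
    restore : ∀ k → δ k ≡ ε k + δ zero
    restore k = sym (trans (+-assoc _ _ _) (trans (cong (δ k +_) (-‿inverseˡ (δ zero))) (+-identityʳ (δ k))))
    ε≢0 : ∀ k → ¬ (ε (suc k) ≡ 0#)
    ε≢0 k e with δ-inj {suc k} {zero} (trans (restore (suc k)) (trans (cong (_+ δ zero) e) (+-identityˡ _)))
    ... | ()
    ε-inj : ∀ {i j} → ε (suc i) ≡ ε (suc j) → i ≡ j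
    ε-inj e = Fin.suc-injective (δ-inj (+-cancelʳ (- δ zero) _ _ e))

  -- Comparison with the definitions of the statement

  module _ {n} (δ : V n) where

    private module LA = LinAlg 𝔽 n δ

    Σᵥ-sum : ∀ {d} (f : Fin d → V n) k → LA.Σᵥ f k ≡ sum (λ i → f i k)
    Σᵥ-sum {zero}  f k = refl
    Σᵥ-sum {suc d} f k = cong (f zero k +_) (Σᵥ-sum (f ∘ suc) k)

    linComb≈lc : ∀ {d} (c : V d) (t : Fin d → V n) → LA.linComb c t ≈ᵥ lc c t
    linComb≈lc c t = Σᵥ-sum (λ i → c i ·ᵥ t i)

    HasDim⇒Dim : ∀ {U d} → LA.HasDim U d → Dim U d
    HasDim⇒Dim (t , t∈ , indep , spans) = record
      { basis  = t
      ; basis∈ = t∈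
      ; unique = λ {s} {s′} c c′ z z′ e i → +-cancelʳ (- c′ i) _ _ (trans
          (trans (cong (c i +_) (sym (-1*x≈-x (c′ i)))) (indep (c +ᵥ (- 1#) ·ᵥ c′) (λ k → begin
            LA.linComb (c +ᵥ (- 1#) ·ᵥ c′) t k   ≡⟨ linComb≈lc (c +ᵥ (- 1#) ·ᵥ c′) t k ⟩
            lc (c +ᵥ (- 1#) ·ᵥ c′) t k           ≡⟨ lc-+ c _ t k ⟩
            lc c t k + lc ((- 1#) ·ᵥ c′) t k     ≡⟨ cong (lc c t k +_) (trans (lc-· (- 1#) c′ t k) (-1*x≈-x _)) ⟩
            lc c t k - lc c′ t k                 ≡⟨ cong (_- lc c′ t k) (trans (sym (≈0-+ (lc c t) z k)) (trans (e k) (≈0-+ (lc c′ t) z′ k))) ⟩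
            lc c′ t k - lc c′ t k                ≡⟨ -‿inverseʳ _ ⟩
            0#                                   ∎) i))
          (sym (-‿inverseʳ (c′ i))))
      ; span   = λ v v∈ → let (c , e) = spans v v∈ in
          0ᵥ , c , (λ _ → refl) , λ k → trans (e k) (trans (linComb≈lc c t k) (sym (+-identityˡ _)))
      }
      where open ≡-Reasoning

    Dim⇒HasDim : ∀ {U d} → Dim U d → LA.HasDim U d
    Dim⇒HasDim B = basis B , basis∈ B ,
      (λ c e → unique B {0ᵥ} {0ᵥ} c 0ᵥ (λ _ → refl) (λ _ → refl)
        (λ k → cong (0# +_) (trans (sym (linComb≈lc c (basis B) k)) (trans (e k) (sym (lc-0 (basis B) k)))))) ,
      λ v v∈ → let (s , c , z , e) = span B v v∈ in
        c , λ k → trans (e k) (trans (≈0-+ (lc c (basis B)) z k) (sym (linComb≈lc c (basis B) k)))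

    Σᵥ-⊛ : ∀ {d} (f : Fin d → V n) → δ ⊛ LA.Σᵥ f ≈ᵥ LA.Σᵥ (λ i → δ ⊛ f i)
    Σᵥ-⊛ f k = trans (cong (δ k *_) (Σᵥ-sum f k))
      (trans (*-distribˡ-sum (δ k) (λ i → f i k)) (sym (Σᵥ-sum (λ i → δ ⊛ f i) k)))

    -- Taking one factor δ out of every summand but the first turns the sum over powers into the
    -- recursion of `K`.
    SumSpace⇒K : ∀ W j {v} → LA.SumSpace W j v → K δ (Mem W) j v
    SumSpace⇒K W zero    (ws , ws∈ , e) = e
    SumSpace⇒K W (suc j) (ws , ws∈ , e) = ws zero , x , ws∈ zero ,
      SumSpace⇒K W j (ws ∘ suc , ws∈ ∘ suc , λ _ → refl) ,
      λ k → trans (e k) (cong (ws zero k +_) (sym (Σᵥ-⊛ (λ i → LA.Δ^ (toℕ i) (ws (suc i))) k)))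
      where
      x : V n
      x = LA.Σᵥ (λ i → LA.Δ^ (toℕ i) (ws (suc i)))

    K⇒SumSpace : ∀ W j {v} → K δ (Mem W) j v → LA.SumSpace W j v
    K⇒SumSpace W zero    z = (λ ()) , (λ ()) , z
    K⇒SumSpace W (suc j) (w , x , w∈ , x∈ , e) with K⇒SumSpace W j x∈
    ... | ws , ws∈ , e′ = w ∷ᵥ ws , (λ { zero → w∈ ; (suc i) → ws∈ i }) ,
      λ k → trans (e k) (cong (w k +_) (trans (cong (δ k *_) (e′ k)) (Σᵥ-⊛ (λ i → LA.Δ^ (toℕ i) (ws i)) k)))

    dim : ∀ {W} j {d} → LA.HasDim (LA.SumSpace W j) d → Dim (K δ (Mem W) j) d
    dim {W} j h = RelBasis-cong (λ v → SumSpace⇒K W j) (λ v → K⇒SumSpace W j) (λ _ → id) (λ _ → id) (HasDim⇒Dim h)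

    hasDim : ∀ {W} j {d} → Dim (K δ (Mem W) j) d → LA.HasDim (LA.SumSpace W j) d
    hasDim {W} j B = Dim⇒HasDim (RelBasis-cong (λ v → K⇒SumSpace W j) (λ v → SumSpace⇒K W j) (λ _ → id) (λ _ → id) B)

    Profile⇒HasProfile : ∀ μ W → Profile δ μ W → LA.IsSubspace W × LA.HasProfile W μ
    Profile⇒HasProfile μ W (W-sub , dims) = W-sub , (λ j _ _ → hasDim j (dims j)) ,
      D μ len , hasDim len (dims len) ,
      hasDim (suc len) (subst (Dim (K δ (Mem W) (suc len))) (trans (D-all μ (ℕ.n≤1+n len)) (sym (D-all μ ℕ.≤-refl))) (dims (suc len)))
      where len = List.length μ

    HasProfile⇒Profile : ∀ μ W → LA.IsSubspace W × LA.HasProfile W μ → Profile δ μ W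
    HasProfile⇒Profile μ W (W-sub , partial , d , now , next) = W-sub ,
      Stable.Dim-stable δ W-sub μ dims
        (subst (Dim (K δ (Mem W) (suc len))) (Dim-unique (K-sub len) (dim len now) (dims len ℕ.≤-refl)) (dim (suc len) next))
      where
      open Krylov δ W-sub
      len = List.length μ
      dims : ∀ j → j ℕ.≤ len → Dim (K δ (Mem W) j) (D μ j)
      -- `HasPartialProfile` starts at j = 1; the zero space is supplied for j = 0, which is also
      -- the last index when `μ` is empty.
      dims zero    _  = Dim-Zero
      dims (suc j) le = dim (suc j) (partial (suc j) (s≤s z≤n) le)

theorem4p8 : (q : ℕ) (𝔽 : FiniteField q) (n : ℕ) → 1 ≤ n →
    (δ : Fin n → FiniteField.F 𝔽) → Injective _≡_ _≡_ δ →
    (μ : List ℕ) → IsPartition μ →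
    LinAlg.Counts 𝔽 n δ (λ W → LinAlg.IsSubspace 𝔽 n δ W × LinAlg.HasProfile 𝔽 n δ W μ)
    (sigmaFormula q n μ)
theorem4p8 q 𝔽 n _ δ δ-inj μ (_ , desc) = Counting.Counted-cong (subsets n)
  (Counted-Profile n δ δ-inj μ desc) (Profile⇒HasProfile δ μ) (HasProfile⇒Profile δ μ)
  where open Linear 𝔽
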